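{- Let $\mathcal{G}=(G,\lambda)$ be a multilabel temporal graph. The following assertions are equivalent: (i) $\mathcal{G}$ admits an MTTO (multilabel temporal transitive orientation); (ii) $\mathcal{G}$ admits an AMTTO (almost multilabel temporal transitive orientation); (iii) $\mathrm{Ness}(\mathcal{G})$, the set of necessary arcs of $\mathcal{G}$, induces an acyclic digraph (no directed cycle, directed 2-cycles included). Furthermore, there is an $O(nm+\min\{kn,m^2\})$-time algorithm that decides whether $\mathcal{G}$ is a comparability multilabel temporal graph (i.e. admits an MTTO) and constructs an MTTO if the answer is YES, where $n$ is the number of vertices, $m$ the number of edges, and $k$ the number of monolabel triangles with a singleton time-label set associated to their edges.
   Context: A multilabel temporal graph $\mathcal{G}=(G,\lambda)$ consists of a finite simple undirected graph $G=(V,E)$ and a function $\lambda$ assigning to each edge a finite nonempty set of time-labels $\lambda(e)\subset\mathbb{N}$. For the algorithmic statement, label sets are given as ordered sets, so that the minimum and maximum of each are directly available. For sets $S_1,S_2\subseteq\mathbb{N}$: $S_1\preceq S_2$ (resp. $S_1\prec S_2$) if there exist $x\in S_1$, $y\in S_2$ with $x\le y$ (resp. $x<y$); $\not\preceq$ and $\not\prec$ denote the negations. Let $AP(G)=\{(u,v):uv\in E\}$ (both directions of each edge). An orientation $O\subseteq AP(G)$ contains exactly one of $(a,b),(b,a)$ for each edge $ab$. An orientation $O$ is an MTTO if whenever $(a,b),(b,c)\in O$ with $\lambda(ab)\preceq\lambda(bc)$, then $(a,c)\in O$ and $\lambda(ac)\not\prec\lambda(bc)$. The implication digraph $\mathrm{Imp}(\mathcal{G})$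 has vertex set $AP(G)$ and, for all distinct $a,b,c$ with $ab,bc\in E$, $\lambda(ab)\preceq\lambda(bc)$ and ($ac\notin E$ or $\lambda(ac)\prec\lambda(bc)$), an arc from $(a,b)$ to $(c,b)$ and an arc from $(b,c)$ to $(b,a)$. A quadruple of distinct vertices $(a,b,c,d)$ forms a correlated monolabel triangle if there is a singleton $T\subset\mathbb{N}$ such that $ab,bc,ac\in E$ with $\lambda(ab)=\lambda(bc)=\lambda(ac)=T$; $bd\in E$ with $\lambda(bd)\preceq T$; $cd\in E$ with $\lambda(cd)\not\preceq T$; and if $ad\in E$ then $\lambda(ad)\prec T$. The augmented implication digraph $\mathrm{Aug}(\mathcal{G})$ is obtained from $\mathrm{Imp}(\mathcal{G})$ by adding, for every correlated monolabel triangle $(a,b,c,d)$, the arcs $((b,c),(a,c))$ and $((c,a),(c,b))$. An arc $(x,y)$ forces $(u,v)$ if there is a directed path (possibly of length $0$) from $(x,y)$ to $(u,v)$ in $\mathrm{Aug}(\mathcal{G})$. For $O\subseteq AP(G)$, $O^+$ is the set of elements of $AP(G)$ forced by some arc of $O$. An orientation $O$ is an AMTTO if $O^+=O$. An arc $(x,y)\in AP(G)$ is necessary if $(y,x)$ forces $(x,y)$; $\mathrm{Ness}(\mathcal{G})$ is the set of necessary arcs. -}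

module Defs where

open import Data.Fin using (Fin; toℕ)
import Data.Fin as Fin
open import Data.List
  using (List; []; _∷_; [_]; length; map; filter; take; concat; allFin; cartesianProduct; lookup)
import Data.List.Membership.Propositional as List
open import Data.List.Relation.Binary.Permutation.Propositional using (_↭_)
open import Data.List.Relation.Unary.Linked using (Linked)
open import Data.Nat using (ℕ; zero; suc; _+_; _*_; _∸_; _≤_; _<_; _⊓_)
import Data.Nat as ℕ
import Data.List.Properties as Listₚ
open import Data.Product using (_×_; _,_; proj₁; proj₂; ∃; ∃₂; ∃-syntax; Σ-syntax)
open import Data.Sum using (_⊎_)
open import Level using (0ℓ)
open import Relation.Binary using (Rel; Decidable; Symmetric; Irreflexive)
open import Relation.Binary.Construct.Closure.ReflexiveTransitive using (Star)
open import Relation.Binary.Construct.Closure.Transitive using (TransClosure)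
open import Relation.Binary.PropositionalEquality using (_≡_; _≢_; refl)
open import Relation.Nullary using (¬_; Dec; yes; no; _×-dec_)
open import Relation.Nullary.Decidable using (⌊_⌋)
open import Relation.Unary using (Pred; _∈_; _⊆_; _≐_)
open import Data.Bool using (if_then_else_)

------------------------------------------------------------------------
-- Multilabel temporal graphs

record SimpleGraph : Set₁ where
  field
    n        : ℕ
    Adj      : Rel (Fin n) 0ℓ
    adj?     : Decidable Adj
    adj-sym  : Symmetric Adj
    adj-irr  : Irreflexive _≡_ Adj

-- A finite set of time-labels is the strictly increasing list of its elements,
-- so that equality of sets is equality of lists.
LabelSet : Set
LabelSet = List ℕ

_⪯_ _≺_ _⋠_ _⊀_ : LabelSet → LabelSet → Set
S₁ ⪯ S₂ = ∃₂ λ x y → x List.∈ S₁ × y List.∈ S₂ × x ≤ y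
S₁ ≺ S₂ = ∃₂ λ x y → x List.∈ S₁ × y List.∈ S₂ × x < y
S₁ ⋠ S₂ = ¬ (S₁ ⪯ S₂)
S₁ ⊀ S₂ = ¬ (S₁ ≺ S₂)

infix 4 _⪯_ _≺_ _⋠_ _⊀_

IsSingleton : LabelSet → Set
IsSingleton S = ∃[ t ] S ≡ [ t ]

isSingleton? : ∀ S → Dec (IsSingleton S)
isSingleton? []          = no λ ()
isSingleton? (t ∷ [])    = yes (t , refl)
isSingleton? (_ ∷ _ ∷ _) = no λ ()

-- `label` is total for convenience: its values on non-edges are arbitrary and
-- never matter below.
record TemporalGraph : Set₁ where
  field
    graph : SimpleGraph
  open SimpleGraph graph public
  field
    label          : Fin n → Fin n → LabelSet
    label-sym      : ∀ {u v} → Adj u v → label u v ≡ label v u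
    label-sorted   : ∀ {u v} → Adj u v → Linked _<_ (label u v)
    label-nonempty : ∀ {u v} → Adj u v → label u v ≢ []

module _ (𝒢 : TemporalGraph) where
  open TemporalGraph 𝒢

  Vertex : Set
  Vertex = Fin n

  Arc : Set
  Arc = Vertex × Vertex

  AP : Pred Arc 0ℓ
  AP (u , v) = Adj u v

  record IsOrientation (O : Pred Arc 0ℓ) : Set where
    field
      within-AP   : O ⊆ AP
      exactly-one : ∀ {a b} → Adj a b →
        ((a , b) ∈ O × ¬ ((b , a) ∈ O)) ⊎ (¬ ((a , b) ∈ O) × (b , a) ∈ O)

  record IsMTTO (O : Pred Arc 0ℓ) : Set where
    field
      orientation : IsOrientation O
      transitive  : ∀ {a b c} → (a , b) ∈ O → (b , c) ∈ O →
        label a b ⪯ label b c → (a , c) ∈ O × label a c ⊀ label b c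

  HasMTTO : Set₁
  HasMTTO = ∃[ O ] IsMTTO O

  record Implies (a b c : Vertex) : Set where
    field
      a≢b : a ≢ b
      b≢c : b ≢ c
      a≢c : a ≢ c
      ab  : Adj a b
      bc  : Adj b c
      ab⪯bc    : label a b ⪯ label b c
      obstruct : ¬ Adj a c ⊎ label a c ≺ label b c

  data Imp : Rel Arc 0ℓ where
    into : ∀ {a b c} → Implies a b c → Imp (a , b) (c , b)
    out  : ∀ {a b c} → Implies a b c → Imp (b , c) (b , a)

  record CorrelatedMonolabelTriangle (a b c d : Vertex) : Set where
    field
      a≢b : a ≢ b
      a≢c : a ≢ c
      a≢d : a ≢ d
      b≢c : b ≢ c
      b≢d : b ≢ d
      c≢d : c ≢ d
      t   : ℕ
      ab  : Adj a b
      bc  : Adj b c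
      ac  : Adj a c
      ab≡ : label a b ≡ [ t ]
      bc≡ : label b c ≡ [ t ]
      ac≡ : label a c ≡ [ t ]
      bd  : Adj b d
      bd⪯ : label b d ⪯ [ t ]
      cd  : Adj c d
      cd⋠ : label c d ⋠ [ t ]
      ad≺ : Adj a d → label a d ≺ [ t ]

  data Aug : Rel Arc 0ℓ where
    imp  : ∀ {e f} → Imp e f → Aug e f
    tri₁ : ∀ {a b c d} → CorrelatedMonolabelTriangle a b c d → Aug (b , c) (a , c)
    tri₂ : ∀ {a b c d} → CorrelatedMonolabelTriangle a b c d → Aug (c , a) (c , b)

  Forces : Rel Arc 0ℓ
  Forces = Star Aug

  _⁺ : Pred Arc 0ℓ → Pred Arc 0ℓ
  (O ⁺) e = e ∈ AP × ∃[ f ] f ∈ O × Forces f e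

  record IsAMTTO (O : Pred Arc 0ℓ) : Set where
    field
      orientation : IsOrientation O
      closed      : (O ⁺) ≐ O

  HasAMTTO : Set₁
  HasAMTTO = ∃[ O ] IsAMTTO O

  Ness : Pred Arc 0ℓ
  Ness (x , y) = (x , y) ∈ AP × Forces (y , x) (x , y)

  InducesAcyclic : Pred Arc 0ℓ → Set
  InducesAcyclic A = ∀ v → ¬ TransClosure (λ x y → (x , y) ∈ A) v v

  edges : List Arc
  edges = filter (λ (u , v) → (u Fin.<? v) ×-dec adj? u v)
                 (cartesianProduct (allFin n) (allFin n))

  #edges : ℕ
  #edges = length edges

  MonolabelTriangle : Vertex → Vertex → Vertex → Set
  MonolabelTriangle a b c =
    (Adj a b × Adj b c × Adj a c) ×
    (label a b ≡ label b c × label b c ≡ label a c × IsSingleton (label a b))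

  monolabelTriangle? : ∀ a b c → Dec (MonolabelTriangle a b c)
  monolabelTriangle? a b c =
    (adj? a b ×-dec adj? b c ×-dec adj? a c) ×-dec
    (label a b ≟ label b c ×-dec label b c ≟ label a c ×-dec isSingleton? (label a b))
    where _≟_ = Listₚ.≡-dec ℕ._≟_

  -- Ordered as a < b < c, so that each triangle is counted once.
  monolabelTriangles : List (Vertex × Vertex × Vertex)
  monolabelTriangles =
    filter (λ (a , b , c) → (a Fin.<? b) ×-dec (b Fin.<? c) ×-dec monolabelTriangle? a b c)
           (cartesianProduct (allFin n) (cartesianProduct (allFin n) (allFin n)))

  #monolabelTriangles : ℕ
  #monolabelTriangles = length monolabelTriangles

------------------------------------------------------------------------
-- Algorithms: programs of a random access machine over ℕ, with a fixed
-- finite set of registers and arrays named in the program.  Every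
-- arithmetic operation and memory access costs one unit.  There is no
-- multiplication, as unit-cost multiplication would make the machine
-- unreasonably strong.

Reg Arr : Set
Reg = ℕ
Arr = ℕ

data Exp : Set where
  lit       : ℕ → Exp
  reg       : Reg → Exp
  _[_]      : Arr → Exp → Exp
  _⊕_ _⊖_   : Exp → Exp → Exp

infixl 6 _⊕_ _⊖_

data Program : Set where
  skip    : Program
  _≔_     : Reg → Exp → Program
  _[_]≔_  : Arr → Exp → Exp → Program
  _⨾_     : Program → Program → Program
  If_Then_Else_ : Exp → Program → Program → Program
  While_Do_     : Exp → Program → Program

infixr 4 _⨾_
infix  5 _≔_ _[_]≔_ If_Then_Else_ While_Do_

record State : Set where
  constructor ⟪_,_⟫
  field
    regs : Reg → ℕ
    arrs : Arr → ℕ → ℕ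
open State public

eval : State → Exp → ℕ
eval s (lit k)   = k
eval s (reg r)   = regs s r
eval s (A [ e ]) = arrs s A (eval s e)
eval s (e ⊕ f)   = eval s e + eval s f
eval s (e ⊖ f)   = eval s e ∸ eval s f

size : Exp → ℕ
size (lit _)   = 1
size (reg _)   = 1
size (_ [ e ]) = 1 + size e
size (e ⊕ f)   = 1 + size e + size f
size (e ⊖ f)   = 1 + size e + size f

update : {X : Set} → (ℕ → X) → ℕ → X → ℕ → X
update f i x j = if ⌊ i ℕ.≟ j ⌋ then x else f j

setReg : State → Reg → ℕ → State
setReg s r x = ⟪ update (regs s) r x , arrs s ⟫

setArr : State → Arr → ℕ → ℕ → State
setArr s A i x = ⟪ regs s , update (arrs s) A (update (arrs s A) i x) ⟫

-- ⟨ p , s ⟩⇓ s′ [ t ]: started in state s, the program p halts in state s′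
-- after t time units.  A test succeeds when its value is nonzero.
data ⟨_,_⟩⇓_[_] : Program → State → State → ℕ → Set where
  skip   : ∀ {s} → ⟨ skip , s ⟩⇓ s [ 1 ]
  assign : ∀ {s r e} → ⟨ r ≔ e , s ⟩⇓ setReg s r (eval s e) [ 1 + size e ]
  store  : ∀ {s A e f} →
    ⟨ A [ e ]≔ f , s ⟩⇓ setArr s A (eval s e) (eval s f) [ 1 + size e + size f ]
  seq    : ∀ {p q s s′ s″ t t′} →
    ⟨ p , s ⟩⇓ s′ [ t ] → ⟨ q , s′ ⟩⇓ s″ [ t′ ] → ⟨ p ⨾ q , s ⟩⇓ s″ [ t + t′ ]
  ifTrue  : ∀ {e p q s s′ t} → eval s e ≢ 0 → ⟨ p , s ⟩⇓ s′ [ t ] →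
    ⟨ If e Then p Else q , s ⟩⇓ s′ [ 1 + size e + t ]
  ifFalse : ∀ {e p q s s′ t} → eval s e ≡ 0 → ⟨ q , s ⟩⇓ s′ [ t ] →
    ⟨ If e Then p Else q , s ⟩⇓ s′ [ 1 + size e + t ]
  whileTrue  : ∀ {e p s s′ s″ t t′} → eval s e ≢ 0 →
    ⟨ p , s ⟩⇓ s′ [ t ] → ⟨ While e Do p , s′ ⟩⇓ s″ [ t′ ] →
    ⟨ While e Do p , s ⟩⇓ s″ [ 1 + size e + t + t′ ]
  whileFalse : ∀ {e p s} → eval s e ≡ 0 → ⟨ While e Do p , s ⟩⇓ s [ 1 + size e ]

------------------------------------------------------------------------
-- Input and output conventions

at : List ℕ → ℕ → ℕ
at []       _       = 0
at (x ∷ _)  zero    = x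
at (_ ∷ xs) (suc i) = at xs i

module _ (𝒢 : TemporalGraph) where
  open TemporalGraph 𝒢

  labelSets : List (Arc 𝒢) → List LabelSet
  labelSets = map (λ (u , v) → label u v)

  -- For an enumeration es = e₀, …, e₍ₘ₋₁₎ of the edges:
  --   registers 0 and 1 hold n and m;
  --   arrays 0 and 1 hold the two ends of each edge;
  --   array 3 holds the increasing label lists of e₀, …, e₍ₘ₋₁₎ one after another;
  --   array 2 holds the offsets into array 3: the labels of eᵢ occupy the
  --   positions from (array 2)[i] up to, but excluding, (array 2)[i + 1].
  -- All other memory is zero.
  input : List (Arc 𝒢) → State
  input es = ⟪ registers , arrays ⟫
    where
    registers : Reg → ℕ
    registers 0 = n
    registers 1 = length es
    registers _ = 0

    arrays : Arr → ℕ → ℕ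
    arrays 0 = at (map (λ (u , _) → toℕ u) es)
    arrays 1 = at (map (λ (_ , v) → toℕ v) es)
    arrays 2 = λ i → length (concat (take i (labelSets es)))
    arrays 3 = at (concat (labelSets es))
    arrays _ = λ _ → 0

  -- The answer is left in register 2, and the direction of the i-th edge in
  -- array 4: 0 if it is oriented as listed, 1 if it is reversed.
  answer : State → ℕ
  answer s = regs s 2

  outputArcs : List (Arc 𝒢) → State → Pred (Arc 𝒢) 0ℓ
  outputArcs es s (a , b) = Σ[ i ∈ Fin (length es) ]
    ((lookup es i ≡ (a , b) × arrs s 4 (toℕ i) ≡ 0) ⊎
     (lookup es i ≡ (b , a) × arrs s 4 (toℕ i) ≡ 1))

  CorrectOutput : List (Arc 𝒢) → State → Set₁
  CorrectOutput es s =
    (answer s ≡ 1 × IsMTTO 𝒢 (outputArcs es s)) ⊎ (answer s ≡ 0 × ¬ HasMTTO 𝒢)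

-- p decides, within time f 𝒢, whether 𝒢 has an MTTO, and constructs one if so,
-- whatever the order in which the edges of 𝒢 are listed.
ConstructsMTTOWithin : (TemporalGraph → ℕ) → Program → Set₁
ConstructsMTTOWithin f p = ∀ 𝒢 (es : List (Arc 𝒢)) → es ↭ edges 𝒢 →
  ∃₂ λ s t → ⟨ p , input 𝒢 es ⟩⇓ s [ t ] × t ≤ f 𝒢 × CorrectOutput 𝒢 es s

-- n m + min {k n, m²}
timeBound : TemporalGraph → ℕ
timeBound 𝒢 = n * m + (k * n) ⊓ (m * m)
  where
  n = TemporalGraph.n 𝒢
  m = #edges 𝒢
  k = #monolabelTriangles 𝒢

-- The summand 1 only matters for edgeless graphs, where timeBound is 0.
ConstructsMTTOInO : (TemporalGraph → ℕ) → Set₁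
ConstructsMTTOInO f = ∃[ p ] ∃[ C ] ConstructsMTTOWithin (λ 𝒢 → C * (1 + f 𝒢)) p

{-# OPTIONS --safe #-}
module Submission where

open import Defs
open import Data.Bool using (Bool; true; false; not; _∧_; T)
open import Data.Bool.Properties using (T-∧)
open import Data.Empty using (⊥; ⊥-elim)
open import Data.Fin using (Fin; toℕ; fromℕ<; combine)
import Data.Fin as Fin
open import Data.Fin.Induction using (spo-wellFounded)
import Data.Fin.Properties as Finₚ
open import Data.List
  using (List; []; _∷_; length; map; _++_; _∷ʳ_; take; lookup; filter; concat; concatMap; allFin; cartesianProduct; tabulate)
import Data.List.Membership.Propositional as List
open import Data.List.Membership.Propositional using (lose) renaming (_∈_ to _∈ₗ_; _∉_ to _∉ₗ_)
open import Data.List.Membership.Propositional.Properties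
import Data.List.Properties as Listₚ
open import Data.List.Relation.Binary.Permutation.Propositional using (_↭_; ↭-refl; ↭-sym; ↭⇒↭ₛ)
open import Data.List.Relation.Binary.Permutation.Propositional.Properties using (∈-resp-↭; ↭-length)
import Data.List.Relation.Binary.Permutation.Setoid.Properties as Permₚ
open import Data.List.Relation.Unary.All as All using (All; []; _∷_)
open import Data.List.Relation.Unary.AllPairs using ([]; _∷_)
open import Data.List.Relation.Unary.Any as Any using (here; there)
open import Data.List.Relation.Unary.Any.Properties using (lookup-index)
open import Data.List.Relation.Unary.Linked using (Linked; [-]; _∷_)
open import Data.List.Relation.Unary.Unique.Propositional using (Unique)
import Data.List.Relation.Unary.Unique.Propositional.Properties as Uniqueₚ
open import Data.Nat using (ℕ; zero; suc; _+_; _*_; _∸_; _≤_; _<_; _⊓_; z≤n; s≤s; s≤s⁻¹; _≡ᵇ_)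
import Data.Nat as ℕ
open import Data.Nat.ListAction using (sum)
open import Data.Nat.ListAction.Properties using (sum-++)
open import Data.Nat.Properties
open import Algebra.Properties.CommutativeSemigroup +-commutativeSemigroup using (interchange)
open import Data.Nat.Tactic.RingSolver using (solve-∀)
open import Data.Product using (_×_; _,_; proj₁; proj₂; ∃₂; ∃-syntax; swap)
open import Data.Product.Properties using () renaming (≡-dec to ×-≡-dec)
open import Data.Sum using (_⊎_; inj₁; inj₂; [_,_]′)
open import Data.Unit using (⊤; tt)
open import Function.Base using (_∘_; case_of_; id)
open import Function.Bundles using (Equivalence; _⇔_; mk⇔)
open import Induction.WellFounded as WF using (WellFounded; Acc)
open import Level using (0ℓ)
open import Relation.Binary.Construct.Closure.ReflexiveTransitive using (Star; ε; _◅_; _◅◅_; gmap)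
open import Relation.Binary.Construct.Closure.Transitive as Plus using (TransClosure; _∷_)
open import Relation.Binary.Definitions using (DecidableEquality; tri<; tri≈; tri>)
open import Relation.Binary.PropositionalEquality
  using (_≡_; _≢_; refl; sym; trans; cong; cong₂; subst; subst₂; setoid; resp₂; ≢-sym; isEquivalence)
open import Relation.Nullary using (¬_; Dec; yes; no; ¬?; _×-dec_)
open import Relation.Unary using (Pred; _∈_)


-- Let each label set be given by its extremes. An MTTO is an AMTTO without a cyclic
-- monolabel triangle. The key fact (cyclic-step) is that if p → q → r → p is such a
-- triangle of an AMTTO O and an arc e of O forces (q , r), then e forms such a triangle
-- with p as well. It follows that necessary arcs lie in no such triangle. Moreover the
-- arcs of O which lie in none (the core of O) form an acyclic digraph; so Ness is
-- acyclic if there is an AMTTO.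
--
-- To find an AMTTO, solve the underlying 2-SAT problem: for each undecided edge,
-- compute the arcs forced by either direction in two searches that advance in lockstep,
-- and adopt the set that is completed first, to whose arcs all the work is charged. If
-- this set contains both directions of the edge, then, being the smaller one, it equals
-- the other set, and these directions force each other.
--
-- To turn the AMTTO into an MTTO, process the vertices in an order along which all arcs
-- of its core point forward, and orient the undecided edges at the current vertex
-- outwards, together with all forced arcs. This meets no contradiction since necessary
-- arcs belong to the core. Suppose that x → y → z → x is a cyclic monolabel triangle of
-- the result whose vertex x was processed first. By the key fact, the chosen arc from
-- which (z , x) was forced forms such a triangle with y; hence it starts at x, and then
-- y → x, which is absurd.
--
-- All correlated monolabel triangles (a , b , c , d) are found by scanning the neighbours
-- d of b for each monolabel triangle a, b, c, in time Σ deg b ≤ min {6 k n, 4 m²}.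

-- The relations compare only the earliest label of one edge with the latest label of another. With
-- the value 0 for non-edges, the alternative "no edge, or an edge that is too early" in the
-- definition of forcing becomes a single strict inequality.
--
-- The core is acyclic because its arcs compose wherever the labels do not strictly drop. A closed
-- walk contracted as far as possible would have to drop at every vertex, all the way round.
--
-- One step of a search tries all third vertices for one arc, hence costs O(n). An arc is adopted at
-- most once per colouring, so the successful searches take O(nm) altogether; the search that meets
-- a contradiction happens only once and is paid for separately. A search must start in constant
-- time, which is why marks are stamped rather than erased.
--
-- There is no separate existence proof: the step from acyclicity to an MTTO runs the verified
-- program. Its negative answer comes with an edge whose two directions force each other, that is,
-- with a directed 2-cycle of necessary arcs. This keeps the argument constructive.

lo hi : LabelSet → ℕ
lo []      = 0
lo (x ∷ _) = x
hi []           = 0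
hi (x ∷ [])     = x
hi (_ ∷ y ∷ ys) = hi (y ∷ ys)

lo≤hi : ∀ {S} → Linked _<_ S → lo S ≤ hi S
lo≤hi {[]}        _          = z≤n
lo≤hi {_ ∷ []}    _          = ≤-refl
lo≤hi {_ ∷ _ ∷ _} (x<y ∷ xs) = ≤-trans (<⇒≤ x<y) (lo≤hi xs)

lo-lower : ∀ {S x} → Linked _<_ S → x List.∈ S → lo S ≤ x
lo-lower _          (here refl)       = ≤-refl
lo-lower (x<y ∷ xs) (there x∈@(here _))  = ≤-trans (<⇒≤ x<y) (lo-lower xs x∈)
lo-lower (x<y ∷ xs) (there x∈@(there _)) = ≤-trans (<⇒≤ x<y) (lo-lower xs x∈)

hi-upper : ∀ {S x} → Linked _<_ S → x List.∈ S → x ≤ hi S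
hi-upper xs@([-]) (here refl) = ≤-refl
hi-upper (x<y ∷ xs) (here refl) = ≤-trans (<⇒≤ x<y) (lo≤hi xs)
hi-upper (_ ∷ xs) (there x∈) = hi-upper xs x∈

lo-∈ : ∀ {S} → S ≢ [] → lo S List.∈ S
lo-∈ {[]}    S≢[] = ⊥-elim (S≢[] refl)
lo-∈ {_ ∷ _} _    = here refl

hi-∈ : ∀ {S} → S ≢ [] → hi S List.∈ S
hi-∈ {[]}         S≢[] = ⊥-elim (S≢[] refl)
hi-∈ {_ ∷ []}     _    = here refl
hi-∈ {_ ∷ _ ∷ _} _    = there (hi-∈ λ ())

constant⇒singleton : ∀ {S t} → Linked _<_ S → S ≢ [] → lo S ≡ t → hi S ≡ t → S ≡ (t ∷ [])
constant⇒singleton {[]}        _          S≢[] _    _   = ⊥-elim (S≢[] refl)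
constant⇒singleton {_ ∷ []}    _          _    refl _   = refl
constant⇒singleton {_ ∷ _ ∷ _} (x<y ∷ xs) _    refl eq =
  ⊥-elim (<-irrefl (sym eq) (<-≤-trans x<y (lo≤hi xs)))

-- Edges as label intervals, conflicts, and forcing.

module _ (𝒢 : TemporalGraph) where
  open TemporalGraph 𝒢

  -- The earliest and the latest label of an edge, both increased by 1 so that
  -- the value 0 can stand for a non-edge.
  opaque
    α ω : Fin n → Fin n → ℕ
    α x y with adj? x y
    ... | yes _ = suc (lo (label x y))
    ... | no  _ = 0
    ω x y with adj? x y
    ... | yes _ = suc (hi (label x y))
    ... | no  _ = 0

module Intervals (𝒢 : TemporalGraph) where
  open TemporalGraph 𝒢

  private
    V A : Set
    V = Vertex 𝒢
    A = Arc 𝒢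
    a b : V → V → ℕ
    a = α 𝒢
    b = ω 𝒢

  opaque
    unfolding α ω

    α-adj : ∀ {x y} → Adj x y → a x y ≡ suc (lo (label x y))
    α-adj {x} {y} xy with adj? x y
    ... | yes _ = refl
    ... | no ¬xy = ⊥-elim (¬xy xy)

    ω-adj : ∀ {x y} → Adj x y → b x y ≡ suc (hi (label x y))
    ω-adj {x} {y} xy with adj? x y
    ... | yes _ = refl
    ... | no ¬xy = ⊥-elim (¬xy xy)

    α-nonadj : ∀ {x y} → ¬ Adj x y → a x y ≡ 0
    α-nonadj {x} {y} ¬xy with adj? x y
    ... | yes xy = ⊥-elim (¬xy xy)
    ... | no  _  = refl

    ω-nonadj : ∀ {x y} → ¬ Adj x y → b x y ≡ 0
    ω-nonadj {x} {y} ¬xy with adj? x y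
    ... | yes xy = ⊥-elim (¬xy xy)
    ... | no  _  = refl

    α>0⇒adj : ∀ {x y} → 0 < a x y → Adj x y
    α>0⇒adj {x} {y} 0<α with adj? x y
    ... | yes xy = xy

    adj⇒α>0 : ∀ {x y} → Adj x y → 0 < a x y
    adj⇒α>0 xy = subst (0 <_) (sym (α-adj xy)) (s≤s z≤n)

    α-sym : ∀ x y → a x y ≡ a y x
    α-sym x y with adj? x y
    ... | yes xy = sym (trans (α-adj (adj-sym xy)) (cong (suc ∘ lo) (label-sym (adj-sym xy))))
    ... | no ¬xy = sym (α-nonadj (¬xy ∘ adj-sym))

    ω-sym : ∀ x y → b x y ≡ b y x
    ω-sym x y with adj? x y
    ... | yes xy = sym (trans (ω-adj (adj-sym xy)) (cong (suc ∘ hi) (label-sym (adj-sym xy))))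
    ... | no ¬xy = sym (ω-nonadj (¬xy ∘ adj-sym))

    α≤ω : ∀ x y → a x y ≤ b x y
    α≤ω x y with adj? x y
    ... | yes xy = s≤s (lo≤hi (label-sorted xy))
    ... | no _   = z≤n

    ω>0⇒adj : ∀ {x y} → 0 < b x y → Adj x y
    ω>0⇒adj {x} {y} 0<ω with adj? x y
    ... | yes xy = xy

  adj⇒≢ : ∀ {x y} → Adj x y → x ≢ y
  adj⇒≢ xy refl = adj-irr refl xy

  -- Any witnesses can be moved to the extremes, the left one down to `lo` and the right one up to
  -- `hi`. So only `α` of the left edge and `ω` of the right edge matter, and the common shift by 1
  -- cancels. The next three lemmas rest on the same remark.
  ⪯⇒≤ : ∀ {x y u v} → Adj x y → Adj u v → label x y ⪯ label u v → a x y ≤ b u v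
  ⪯⇒≤ xy uv (_ , _ , p∈ , q∈ , p≤q) rewrite α-adj xy | ω-adj uv =
    s≤s (≤-trans (lo-lower (label-sorted xy) p∈) (≤-trans p≤q (hi-upper (label-sorted uv) q∈)))

  ≤⇒⪯ : ∀ {x y u v} → Adj x y → Adj u v → a x y ≤ b u v → label x y ⪯ label u v
  ≤⇒⪯ xy uv α≤ rewrite α-adj xy | ω-adj uv =
    _ , _ , lo-∈ (label-nonempty xy) , hi-∈ (label-nonempty uv) , s≤s⁻¹ α≤

  ≺⇒< : ∀ {x y u v} → Adj x y → Adj u v → label x y ≺ label u v → a x y < b u v
  ≺⇒< xy uv (_ , _ , p∈ , q∈ , p<q) rewrite α-adj xy | ω-adj uv =
    s≤s (≤-<-trans (lo-lower (label-sorted xy) p∈) (<-≤-trans p<q (hi-upper (label-sorted uv) q∈)))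

  <⇒≺ : ∀ {x y u v} → Adj x y → Adj u v → a x y < b u v → label x y ≺ label u v
  <⇒≺ xy uv α< rewrite α-adj xy | ω-adj uv =
    _ , _ , lo-∈ (label-nonempty xy) , hi-∈ (label-nonempty uv) , s≤s⁻¹ α<

  -- The shift of `α` and `ω` is inherited: label t appears as `Mono (suc t)`, while `Mono 0`
  -- describes the non-edges. Where an edge is meant, t > 0 has to come from other data.
  record Mono (t : ℕ) (x y : V) : Set where
    constructor mono
    field
      α≡ : a x y ≡ t
      ω≡ : b x y ≡ t

  mono-sym : ∀ {t x y} → Mono t x y → Mono t y x
  mono-sym {x = x} {y} (mono p q) = mono (trans (α-sym y x) p) (trans (ω-sym y x) q)

  label⇒mono : ∀ {t x y} → Adj x y → label x y ≡ (t ∷ []) → Mono (suc t) x y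
  label⇒mono xy eq = mono (trans (α-adj xy) (cong (suc ∘ lo) eq)) (trans (ω-adj xy) (cong (suc ∘ hi) eq))

  mono⇒label : ∀ {t x y} → Mono (suc t) x y → Adj x y × label x y ≡ (t ∷ [])
  mono⇒label (mono p q) with xy ← α>0⇒adj (subst (0 <_) (sym p) (s≤s z≤n)) =
    xy , constant⇒singleton (label-sorted xy) (label-nonempty xy)
           (suc-injective (trans (sym (α-adj xy)) p)) (suc-injective (trans (sym (ω-adj xy)) q))

  -- In the notation of Defs, the vertices x, y, z, w of Correlated t x y z w
  -- are a, b, c, d; distinctness is automatic.
  record Correlated (t : ℕ) (x y z w : V) : Set where
    field
      xy  : Mono t x y
      yz  : Mono t y z
      xz  : Mono t x z
      yw>0 : 0 < a y w
      yw≤ : a y w ≤ t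
      -- A value above t is positive, so this field also makes zw an edge. In the next field a
      -- non-edge xw has value 0 and is therefore covered.
      zw> : t < a z w
      xw< : a x w < t

  -- The reason why x → y → z is impossible: (x , y) forces (z , y).
  data Conflict (x y z : V) : Set where
    ordered : x ≢ z → 0 < a x y → a x y ≤ b y z → a x z < b y z → Conflict x y z
    correlated : ∀ {t w} → Correlated t z x y w → Conflict x y z

  data Step : A → A → Set where
    into : ∀ {x y z} → Conflict x y z → Step (x , y) (z , y)
    out  : ∀ {x y z} → Conflict z x y → Step (x , y) (x , z)

  private
    obstruct⇒< : ∀ {x y z} → Adj y z → ¬ Adj x z ⊎ label x z ≺ label y z → a x z < b y z
    obstruct⇒< yz (inj₁ ¬xz) rewrite α-nonadj ¬xz | ω-adj yz = s≤s z≤n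
    obstruct⇒< {x} {_} {z} yz (inj₂ xz≺yz) with adj? x z
    ... | yes xz = ≺⇒< xz yz xz≺yz
    ... | no ¬xz rewrite α-nonadj ¬xz | ω-adj yz = s≤s z≤n

    implies⇒conflict : ∀ {x y z} → Implies 𝒢 x y z → Conflict x y z
    implies⇒conflict i = ordered a≢c (adj⇒α>0 ab) (⪯⇒≤ ab bc ab⪯bc) (obstruct⇒< bc obstruct)
      where open Implies i

    triangle⇒correlated : ∀ {x y z w} → CorrelatedMonolabelTriangle 𝒢 x y z w → ∃[ t ] Correlated t x y z w
    triangle⇒correlated {x} {y} {z} {w} tr = suc t , record
      { xy = label⇒mono ab ab≡ ; yz = label⇒mono bc bc≡ ; xz = label⇒mono ac ac≡
      ; yw>0 = adj⇒α>0 bd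
      ; yw≤ = subst (_≤ suc t) (sym (α-adj bd)) (s≤s (yw bd⪯))
      ; zw> = subst (suc t <_) (sym (α-adj cd)) (s≤s (≰⇒> zw))
      ; xw< = xw }
      where
      open CorrelatedMonolabelTriangle tr
      yw : label y w ⪯ (t ∷ []) → lo (label y w) ≤ t
      yw (_ , _ , p∈ , here refl , p≤t) = ≤-trans (lo-lower (label-sorted bd) p∈) p≤t
      zw : ¬ lo (label z w) ≤ t
      zw lo≤t = cd⋠ (_ , _ , lo-∈ (label-nonempty cd) , here refl , lo≤t)
      xw′ : (p : Adj x w) → label x w ≺ (t ∷ []) → lo (label x w) < t
      xw′ p (_ , _ , q∈ , here refl , q<t) = ≤-<-trans (lo-lower (label-sorted p) q∈) q<t
      xw : a x w < suc t
      xw with adj? x w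
      ... | yes p = subst (_< _) (sym (α-adj p)) (s≤s (xw′ p (ad≺ p)))
      ... | no ¬p = subst (_< _) (sym (α-nonadj ¬p)) (s≤s z≤n)

    correlated⇒triangle : ∀ {t x y z w} → Correlated t x y z w → CorrelatedMonolabelTriangle 𝒢 x y z w
    correlated⇒triangle {zero} c = case ≤-trans yw>0 yw≤ of λ ()
      where open Correlated c
    correlated⇒triangle {suc t} {x} {y} {z} {w} c = record
      { a≢b = adj⇒≢ ab ; a≢c = adj⇒≢ ac ; b≢c = adj⇒≢ bc ; b≢d = adj⇒≢ bd ; c≢d = adj⇒≢ cd
      ; a≢d = λ { refl → <-irrefl (trans (sym (Mono.α≡ xz)) (α-sym x z)) zw> }
      ; t = t ; ab = ab ; bc = bc ; ac = ac
      ; ab≡ = proj₂ (mono⇒label xy) ; bc≡ = proj₂ (mono⇒label yz) ; ac≡ = proj₂ (mono⇒label xz)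
      ; bd = bd ; cd = cd
      ; bd⪯ = _ , _ , lo-∈ (label-nonempty bd) , here refl , s≤s⁻¹ (subst (_≤ suc t) (α-adj bd) yw≤)
      ; cd⋠ = λ { (_ , _ , p∈ , here refl , p≤t) →
          <⇒≱ (s≤s⁻¹ (subst (suc t <_) (α-adj cd) zw>)) (≤-trans (lo-lower (label-sorted cd) p∈) p≤t) }
      ; ad≺ = λ p → _ , _ , lo-∈ (label-nonempty p) , here refl , s≤s⁻¹ (subst (_< suc t) (α-adj p) xw<)
      }
      where
      open Correlated c
      ab = proj₁ (mono⇒label xy)
      bc = proj₁ (mono⇒label yz)
      ac = proj₁ (mono⇒label xz)
      bd = α>0⇒adj yw>0
      cd = α>0⇒adj (≤-<-trans z≤n zw>)

    conflict⇒implies⊎triangle : ∀ {x y z} → Conflict x y z → Implies 𝒢 x y z ⊎ ∃[ w ] CorrelatedMonolabelTriangle 𝒢 z x y w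
    conflict⇒implies⊎triangle {x} {y} {z} (ordered x≢z xy>0 xy≤yz xz<yz) = inj₁ record
      { a≢b = adj⇒≢ xy ; b≢c = adj⇒≢ yz ; a≢c = x≢z ; ab = xy ; bc = yz
      ; ab⪯bc = ≤⇒⪯ xy yz xy≤yz ; obstruct = obs }
      where
      xy = α>0⇒adj xy>0
      yz = ω>0⇒adj (≤-<-trans z≤n xz<yz)
      obs : ¬ Adj x z ⊎ label x z ≺ label y z
      obs with adj? x z
      ... | yes xz = inj₂ (<⇒≺ xz yz xz<yz)
      ... | no ¬xz = inj₁ ¬xz
    conflict⇒implies⊎triangle (correlated c) = inj₂ (_ , correlated⇒triangle c)

  aug⇒step : ∀ {e f} → Aug 𝒢 e f → Step e f
  aug⇒step (imp (Imp.into i)) = into (implies⇒conflict i)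
  aug⇒step (imp (Imp.out i))  = out (implies⇒conflict i)
  aug⇒step (tri₁ c) = into (correlated (proj₂ (triangle⇒correlated c)))
  aug⇒step (tri₂ c) = out (correlated (proj₂ (triangle⇒correlated c)))

  step⇒aug : ∀ {e f} → Step e f → Aug 𝒢 e f
  step⇒aug (into c) with conflict⇒implies⊎triangle c
  ... | inj₁ i       = imp (Imp.into i)
  ... | inj₂ (_ , t) = tri₁ t
  step⇒aug (out c) with conflict⇒implies⊎triangle c
  ... | inj₁ i       = imp (Imp.out i)
  ... | inj₂ (_ , t) = tri₂ t

  -- The skew-symmetry of a 2-SAT implication digraph: one conflict excludes x → y → z and is read
  -- once from either arc, so `into` and `out` are contrapositives of each other.
  step-swap : ∀ {e f} → Step e f → Step (swap f) (swap e)
  step-swap (into c) = out c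
  step-swap (out c)  = into c

  _⟶*_ : A → A → Set
  _⟶*_ = Star Step

  ⟶*-swap : ∀ {e f} → e ⟶* f → swap f ⟶* swap e
  ⟶*-swap ε        = ε
  ⟶*-swap (s ◅ ss) = ⟶*-swap ss ◅◅ (step-swap s ◅ ε)

  forces⇒⟶* : ∀ {e f} → Forces 𝒢 e f → e ⟶* f
  forces⇒⟶* = gmap (λ e → e) aug⇒step

  ⟶*⇒forces : ∀ {e f} → e ⟶* f → Forces 𝒢 e f
  ⟶*⇒forces = gmap (λ e → e) step⇒aug

  conflict-adjˡ : ∀ {x y z} → Conflict x y z → Adj x y
  conflict-adjˡ (ordered _ xy _ _) = α>0⇒adj xy
  conflict-adjˡ (correlated c) = α>0⇒adj (subst (0 <_) (sym (Mono.α≡ yz)) (≤-trans yw>0 yw≤))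
    where open Correlated c

  conflict-adjʳ : ∀ {x y z} → Conflict x y z → Adj y z
  conflict-adjʳ (ordered _ _ _ lt) = ω>0⇒adj (≤-<-trans z≤n lt)
  conflict-adjʳ (correlated c) = adj-sym (α>0⇒adj (subst (0 <_) (sym (Mono.α≡ xz)) (≤-trans yw>0 yw≤)))
    where open Correlated c

  AP-step : ∀ {e f} → Step e f → f ∈ AP 𝒢
  AP-step (into c) = adj-sym (conflict-adjʳ c)
  AP-step (out c)  = adj-sym (conflict-adjˡ c)

  AP-⟶* : ∀ {e f} → e ∈ AP 𝒢 → e ⟶* f → f ∈ AP 𝒢
  AP-⟶* e∈ ε        = e∈
  AP-⟶* e∈ (s ◅ ss) = AP-⟶* (AP-step s) ss

  -- AMTTOs in working form. `total` and `asym` split the choice of one direction per edge, and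
  -- closure under forcing is reduced to single steps; the colourings computed by the program are
  -- brought into this form as well.
  record Almost (O : Pred A 0ℓ) : Set where
    field
      within : ∀ {e} → e ∈ O → e ∈ AP 𝒢
      total  : ∀ {x y} → Adj x y → (x , y) ∈ O ⊎ (y , x) ∈ O
      asym   : ∀ {x y} → (x , y) ∈ O → ¬ (y , x) ∈ O
      closed : ∀ {e f} → e ∈ O → Step e f → f ∈ O

  -- Cyclic monolabel triangles of an AMTTO.

  module AlmostProperties {O : Pred A 0ℓ} (almost : Almost O) where
    open Almost almost

    total⁺ : ∀ {k x y} → k < a x y → (x , y) ∈ O ⊎ (y , x) ∈ O
    total⁺ k<α = total (α>0⇒adj (≤-<-trans z≤n k<α))

    closed* : ∀ {e f} → e ∈ O → e ⟶* f → f ∈ O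
    closed* e∈ ε        = e∈
    closed* e∈ (s ◅ ss) = closed* (closed e∈ s) ss

    -- Otherwise the conflict `ordered` would force z → y. As `α` vanishes on non-edges, the bound
    -- also makes xz an edge. It says nothing about the direction of xz, which is exactly what
    -- separates an AMTTO from an MTTO.
    transit : ∀ {x y z} → (x , y) ∈ O → (y , z) ∈ O → a x y ≤ b y z → b y z ≤ a x z
    transit xy yz le = ≮⇒≥ λ lt →
      asym yz (closed xy (into (ordered (λ { refl → asym xy yz }) (adj⇒α>0 (within xy)) le lt)))

    transit′ : ∀ {k x y z} → (x , y) ∈ O → (y , z) ∈ O → a x y ≤ k → k ≤ b y z → k ≤ a x z
    transit′ xy yz p q = ≤-trans q (transit xy yz (≤-trans p q))

    correlated₁ : ∀ {t x y z w} → Correlated t x y z w → (y , z) ∈ O → (x , z) ∈ O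
    correlated₁ c yz = closed yz (into (correlated c))

    correlated₂ : ∀ {t x y z w} → Correlated t x y z w → (z , x) ∈ O → (z , y) ∈ O
    correlated₂ c zx = closed zx (out (correlated c))

    record Cyclic (t : ℕ) (x y z : V) : Set where
      constructor cyclic
      pattern
      field
        xy : (x , y) ∈ O
        yz : (y , z) ∈ O
        zx : (z , x) ∈ O
        mxy : Mono t x y
        myz : Mono t y z
        mzx : Mono t z x

    rotate : ∀ {t x y z} → Cyclic t x y z → Cyclic t y z x
    rotate (cyclic xy yz zx mxy myz mzx) = cyclic yz zx xy myz mzx mxy

    -- Applying `transit` at the three corners in turn gives a cyclic chain through all six values
    -- of `α` and `ω` on the triangle, so they coincide. Hence a directed triangle with one
    -- comparable corner is automatically monolabel.
    directed-triangle : ∀ {x y z} → (x , y) ∈ O → (y , z) ∈ O → (z , x) ∈ O →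
      a x y ≤ b y z → Cyclic (a x y) x y z
    directed-triangle {x} {y} {z} xy yz zx le = cyclic xy yz zx
      (mono refl (≤-antisym (≤-trans bxy≤ ayz≤) (α≤ω x y)))
      (mono (≤-antisym ayz≤ (≤-trans (α≤ω x y) bxy≤)) (≤-antisym byz≤ le))
      (mono (≤-antisym (≤-trans (α≤ω z x) bzx≤) (≤-trans le (subst (b y z ≤_) (α-sym x z) p₁)))
            (≤-antisym bzx≤ (≤-trans le q₁)))
      where
      p₁ : b y z ≤ a x z
      p₁ = transit xy yz le
      q₁ : b y z ≤ b z x
      q₁ = ≤-trans (subst (b y z ≤_) (α-sym x z) p₁) (α≤ω z x)
      bzx≤ : b z x ≤ a x y
      bzx≤ = subst (b z x ≤_) (α-sym y x) (transit yz zx (≤-trans (α≤ω y z) q₁))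
      byz≤ : b y z ≤ a x y
      byz≤ = ≤-trans q₁ bzx≤
      ayz≤ : a y z ≤ a x y
      ayz≤ = ≤-trans (α≤ω y z) byz≤
      bxy≤ : b x y ≤ a y z
      bxy≤ = subst (b x y ≤_) (α-sym z y)
        (transit zx xy (≤-trans (α≤ω z x) (≤-trans bzx≤ (α≤ω x y))))

    private
      α≤ : ∀ {t x y} → Mono t x y → a x y ≤ t
      α≤ m = ≤-reflexive (Mono.α≡ m)
      ≤α : ∀ {t x y} → Mono t x y → t ≤ a x y
      ≤α m = ≤-reflexive (sym (Mono.α≡ m))
      ω≤ : ∀ {t x y} → Mono t x y → b x y ≤ t
      ω≤ m = ≤-reflexive (Mono.ω≡ m)
      ≤ω : ∀ {t x y} → Mono t x y → t ≤ b x y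
      ≤ω m = ≤-reflexive (sym (Mono.ω≡ m))
      mono-unique : ∀ {s t x y} → Mono s x y → Mono t x y → s ≡ t
      mono-unique m m′ = trans (sym (Mono.α≡ m)) (Mono.α≡ m′)
      flip≤ : ∀ {k x y} → k ≤ a x y → k ≤ a y x
      flip≤ {k} {x} {y} = subst (k ≤_) (α-sym x y)
      flip≥ : ∀ {k x y} → a x y ≤ k → a y x ≤ k
      flip≥ {k} {x} {y} = subst (_≤ k) (α-sym x y)
      flip> : ∀ {k x y} → a x y < k → a y x < k
      flip> {k} {x} {y} = subst (_< k) (α-sym x y)
      directed-triangle′ : ∀ {t x y z} → (x , y) ∈ O → (y , z) ∈ O → (z , x) ∈ O →
        a x y ≡ t → t ≤ b y z → Cyclic t x y z
      directed-triangle′ xy yz zx refl le = directed-triangle xy yz zx le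

    -- The apex p of a cyclic monolabel triangle is kept when an arc opposite
    -- to it is replaced by an arc of O forcing it.
    cyclic-step : ∀ {t p q r e} → Cyclic t p q r → e ∈ O → Step e (q , r) → Cyclic t p (proj₁ e) (proj₂ e)
    -- The given arc is d → r, and dq is too early. If `α d p` is below t, this contradicts
    -- `transit` along d → r → p. If it is above t, then q, r, p, d is a correlated monolabel
    -- triangle, by which p → q forces p → r. So it equals t, and dp points out of p because d → p →
    -- q would make dq late; then p → d → r → p is a directed triangle.
    cyclic-step {t} {p} {q} {r} (cyclic pq qr rp mpq mqr mrp) dr (into {d} (ordered _ dr>0 dr≤ dq<))
      with <-cmp (a d p) t
    ... | tri< dp<t _ _ = ⊥-elim (<⇒≱ dp<t (transit′ dr rp (≤-trans dr≤ (ω≤ (mono-sym mqr))) (≤ω mrp)))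
    ... | tri> _ _ t<dp = ⊥-elim (asym rp (correlated₂ correl pq))
      where
      correl : Correlated t q r p d
      correl = record
        { xy = mqr ; yz = mrp ; xz = mono-sym mpq ; yw>0 = flip≤ dr>0
        ; yw≤ = flip≥ (≤-trans dr≤ (ω≤ (mono-sym mqr)))
        ; zw> = flip≤ t<dp ; xw< = flip> (<-≤-trans dq< (ω≤ (mono-sym mqr))) }
    ... | tri≈ _ dp≡t _ with total⁺ {0} {d} {p} (≤-trans (≤-trans (adj⇒α>0 (within pq)) (α≤ mpq)) (≤-reflexive (sym dp≡t)))
    ...   | inj₁ dp = ⊥-elim (<⇒≱ dq< (≤-trans (ω≤ (mono-sym mqr)) (transit′ dp pq (≤-reflexive dp≡t) (≤ω mpq))))
    ...   | inj₂ pd = directed-triangle′ pd dr rp (trans (α-sym p d) dp≡t)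
            (≤-trans t≤pd (≤-trans (flip≤ (transit rp pd (≤-trans (α≤ mrp) t≤pd))) (α≤ω d r)))
      where
      t≤pd : t ≤ b p d
      t≤pd = ≤-trans (flip≤ (≤-reflexive (sym dp≡t))) (α≤ω p d)
    -- The given arc is e → r, and d is the fourth vertex of the correlated triangle q, e, r. The
    -- labels at d leave only d → r, d → e and q → e, and then p → q → e makes pe an edge. If p → e,
    -- the triangle p, e, r is directed. If e → p, then p, q, e is a cyclic monolabel triangle, and
    -- no value of `α p d` is possible: below or above t there is a correlated triangle with fourth
    -- vertex d, and at t neither direction of pd agrees with the labels.
    cyclic-step {t} {p} {q} {r} (cyclic pq qr rp mpq mqr mrp) er (into {e} (correlated {w = d} c))
      with mono-unique mqr (Correlated.xz c)
    ... | refl = caseₑ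
      where
      open Correlated c renaming (xy to mqe; yz to mer; xz to mqr′; yw>0 to ed>0; yw≤ to ed≤; zw> to rd>; xw< to qd<)
      dr∈ : (d , r) ∈ O
      dr∈ with total⁺ rd>
      ... | inj₂ dr = dr
      ... | inj₁ rd = ⊥-elim (<⇒≱ rd> (≤-trans (α≤ω r d)
              (≤-trans (transit er rd (≤-trans (α≤ mer) (≤-trans (<⇒≤ rd>) (α≤ω r d)))) ed≤)))
      dr> : t < b d r
      dr> = <-≤-trans (flip≤ rd>) (α≤ω d r)
      de∈ : (d , e) ∈ O
      de∈ with total⁺ ed>0
      ... | inj₂ de = de
      ... | inj₁ ed = ⊥-elim (<⇒≱ dr> (≤-trans (transit ed dr∈ (≤-trans ed≤ (<⇒≤ dr>))) (α≤ mer)))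
      qe∈ : (q , e) ∈ O
      qe∈ with total⁺ (≤-trans ed>0 (≤-trans ed≤ (≤α mqe)))
      ... | inj₁ qe = qe
      ... | inj₂ eq = ⊥-elim (<⇒≱ qd< (flip≤ (transit′ de∈ eq (flip≥ ed≤) (≤ω (mono-sym mqe)))))
      t≤pe : t ≤ a p e
      t≤pe = transit′ pq qe∈ (α≤ mpq) (≤ω mqe)
      caseₑ : Cyclic t p e r
      caseₑ with total⁺ (≤-trans ed>0 (≤-trans ed≤ t≤pe))
      ... | inj₁ pe = rotate (directed-triangle′ rp pe er (Mono.α≡ mrp) (≤-trans t≤pe (α≤ω p e)))
      ... | inj₂ ep with mep ← Cyclic.mzx (directed-triangle′ pq qe∈ ep (Mono.α≡ mpq) (≤ω mqe)) | <-cmp (a p d) t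
      ...   | tri< pd< _ _ = ⊥-elim (asym rp (correlated₁ correl er))
        where
        correl : Correlated t p e r d
        correl = record { xy = mono-sym mep ; yz = mer ; xz = mono-sym mrp
          ; yw>0 = ed>0 ; yw≤ = ed≤ ; zw> = rd> ; xw< = pd< }
      ...   | tri> _ _ pd> = ⊥-elim (asym ep (correlated₂ correl pq))
        where
        correl : Correlated t q e p d
        correl = record { xy = mqe ; yz = mep ; xz = mono-sym mpq
          ; yw>0 = ed>0 ; yw≤ = ed≤ ; zw> = pd> ; xw< = qd< }
      ...   | tri≈ _ pd≡ _ with total⁺ (≤-trans ed>0 (≤-trans ed≤ (≤-reflexive (sym pd≡))))
      ...     | inj₁ pd = ⊥-elim (<⇒≱ dr> (≤-trans (transit pd dr∈ (≤-trans (≤-reflexive pd≡) (<⇒≤ dr>))) (α≤ (mono-sym mrp))))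
      ...     | inj₂ dp = ⊥-elim (<⇒≱ qd< (flip≤ (transit′ dp pq (flip≥ (≤-reflexive pd≡)) (≤ω mpq))))
    -- The given arc is q → d. Along p → q → d, the edge pd starts no earlier than qd ends. If p →
    -- d, then r → p → d would make rd as late as qd, which the conflict denies. Hence d → p, which
    -- closes the triangle.
    cyclic-step {t} {p} {q} {r} (cyclic pq qr rp mpq mqr mrp) qd (out {y = d} (ordered _ _ rq≤ rd<))
      with total⁺ (≤-<-trans z≤n (<-≤-trans rd< (transit pq qd pq≤)))
      where
      pq≤ : a p q ≤ b q d
      pq≤ = ≤-trans (α≤ mpq) (≤-trans (flip≤ (≤α mqr)) rq≤)
    ... | inj₂ dp = directed-triangle′ pq qd dp (Mono.α≡ mpq) (≤-trans (flip≤ (≤α mqr)) rq≤)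
    ... | inj₁ pd = ⊥-elim (<⇒≱ rd< (≤-trans qd≤ (≤-trans (α≤ω p d) (transit rp pd (≤-trans rp≤ (α≤ω p d))))))
      where
      pq≤ : a p q ≤ b q d
      pq≤ = ≤-trans (α≤ mpq) (≤-trans (flip≤ (≤α mqr)) rq≤)
      qd≤ : b q d ≤ a p d
      qd≤ = transit pq qd pq≤
      rp≤ : a r p ≤ a p d
      rp≤ = ≤-trans (α≤ mrp) (≤-trans (≤α mpq) (≤-trans pq≤ qd≤))
    -- The given arc is q → e, and d is the fourth vertex of the correlated triangle e, r, q. Along
    -- p → q → e, the edge pe starts at t or later, and e → p closes the triangle. If p → e, then pe
    -- is monolabel too. Now `α p d` above t makes e, r, p, d correlated, by which p → e forces p →
    -- r; a positive value up to t makes e, p, q, d correlated, by which p → q forces e → q; and if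
    -- pd is no edge, every way to direct qd and rd violates `transit`.
    cyclic-step {t} {p} {q} {r} (cyclic pq qr rp mpq mqr mrp) qe (out {y = e} (correlated {w = d} c))
      with mono-unique (mono-sym mqr) (Correlated.yz c)
    ... | refl with t≤pe ← transit′ pq qe (α≤ mpq) (≤ω (mono-sym (Correlated.xz c)))
               | total⁺ (≤-trans (Correlated.yw>0 c) (≤-trans (Correlated.yw≤ c)
                   (transit′ pq qe (α≤ mpq) (≤ω (mono-sym (Correlated.xz c))))))
    ...   | inj₂ ep = directed-triangle′ pq qe ep (Mono.α≡ mpq) (≤ω (mono-sym (Correlated.xz c)))
    ...   | inj₁ pe = ⊥-elim absurd
      where
      open Correlated c renaming (xy to mer; yz to mrq; xz to meq; yw>0 to rd>0; yw≤ to rd≤; zw> to qd>; xw< to ed<)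
      pe≤ : b p e ≤ t
      pe≤ = ≤-trans (transit rp pe (≤-trans (α≤ mrp) (≤-trans t≤pe (α≤ω p e)))) (α≤ (mono-sym mer))
      mpe : Mono t p e
      mpe = mono (≤-antisym (≤-trans (α≤ω p e) pe≤) t≤pe) (≤-antisym pe≤ (≤-trans t≤pe (α≤ω p e)))
      absurd : ⊥
      absurd with 0 <? a p d | a p d ≤? t
      ... | _ | no pd≰ = asym rp (correlated₂ correl pe)
        where
        correl : Correlated t e r p d
        correl = record { xy = mer ; yz = mrp ; xz = mono-sym mpe
          ; yw>0 = rd>0 ; yw≤ = rd≤ ; zw> = ≰⇒> pd≰ ; xw< = ed< }
      ... | yes pd>0 | yes pd≤ = asym qe (correlated₁ correl pq)
        where
        correl : Correlated t e p q d
        correl = record { xy = mono-sym mpe ; yz = mpq ; xz = meq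
          ; yw>0 = pd>0 ; yw≤ = pd≤ ; zw> = qd> ; xw< = ed< }
      ... | no pd≯0 | yes _ with pd≤0 ← ≮⇒≥ pd≯0 | total⁺ qd> | total⁺ rd>0
      ...   | inj₁ qd | _ = case ≤-trans (≤-trans (s≤s z≤n) (≤-trans qd> (α≤ω q d)))
                (≤-trans (transit pq qd (≤-trans (α≤ mpq) (≤-trans (<⇒≤ qd>) (α≤ω q d)))) pd≤0) of λ ()
      ...   | inj₂ dq | inj₁ rd = <⇒≱ (<-≤-trans (flip≤ qd>) (α≤ω d q))
                (≤-trans (transit rd dq (≤-trans rd≤ (≤-trans (<⇒≤ (flip≤ qd>)) (α≤ω d q)))) (α≤ mrq))
      ...   | inj₂ _ | inj₂ dr = case ≤-trans (≤-trans rd>0 rd≤)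
                (≤-trans (flip≤ (transit′ dr rp (flip≥ rd≤) (≤ω mrp))) pd≤0) of λ ()

    cyclic-⟶* : ∀ {t p f e} → Cyclic t p (proj₁ f) (proj₂ f) → e ∈ O → e ⟶* f → Cyclic t p (proj₁ e) (proj₂ e)
    cyclic-⟶* cyc e∈ ε        = cyc
    cyclic-⟶* cyc e∈ (s ◅ ss) = cyclic-step (cyclic-⟶* cyc (closed e∈ s) ss) e∈ s

    IsCyclic : A → Set
    IsCyclic (x , y) = ∃₂ λ t z → Cyclic t x y z

    -- On a path from (y , x) ∉ O to (x , y) ∈ O, consider the step e → f which enters O:
    -- both swap e and f lie in O and force (x , y), which is incompatible with a common apex.
    necessary⇒¬cyclic : ∀ {x y} → (x , y) ∈ O → (y , x) ⟶* (x , y) → ¬ IsCyclic (x , y)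
    necessary⇒¬cyclic {x} {y} xy yx⟶*xy (t , z , cyc) = go xy ε yx⟶*xy
      where
      apex : Cyclic t z x y
      apex = rotate (rotate cyc)
      clash : ∀ {e f} → Step e f → Cyclic t z (proj₁ f) (proj₂ f) → Cyclic t z (proj₂ e) (proj₁ e) → ⊥
      clash (into _) c c′ = asym (Cyclic.zx c) (Cyclic.xy c′)
      clash (out _)  c c′ = asym (Cyclic.xy c) (Cyclic.zx c′)
      go : ∀ {e} → swap e ∈ O → (y , x) ⟶* e → e ⟶* (x , y) → ⊥
      go yx _ ε = asym xy yx
      go ē∈ yx⟶*e (s ◅ ss) with total (AP-step s)
      ... | inj₁ f∈ = clash s (cyclic-⟶* apex f∈ ss) (cyclic-⟶* apex ē∈ (⟶*-swap yx⟶*e))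
      ... | inj₂ f̄∈ = go f̄∈ (yx⟶*e ◅◅ (s ◅ ε)) ss

    -- The core is acyclic.

    Core : A → Set
    Core e = e ∈ O × ¬ IsCyclic e

    -- `transit` makes xz an edge, and z → x would put (x , y) on a cyclic triangle. Suppose that x
    -- → z → w → x is a cyclic monolabel triangle. Then yw is an edge because of y → z → w. If w →
    -- y, the triangle y, z, w is directed and contains (y , z). If y → w, the triangle w, x, y is
    -- directed and contains (x , y); the only label order to which `directed-triangle` does not
    -- apply contradicts `transit`.
    core-transitive : ∀ {x y z} → Core (x , y) → Core (y , z) → a x y ≤ b y z → Core (x , z)
    core-transitive {x} {y} {z} (xy , ¬cxy) (yz , ¬cyz) le = xz , ¬cxz
      where
      yz≤ : b y z ≤ a x z
      yz≤ = transit xy yz le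
      xz : (x , z) ∈ O
      xz with total (α>0⇒adj (<-≤-trans (<-≤-trans (adj⇒α>0 (within yz)) (α≤ω y z)) yz≤))
      ... | inj₁ xz = xz
      ... | inj₂ zx = ⊥-elim (¬cxy (_ , _ , directed-triangle xy yz zx le))
      ¬cxz : ¬ IsCyclic (x , z)
      ¬cxz (t , w , cyclic _ zw wx mxz mzw mwx) = caseʷ (total (α>0⇒adj (<-≤-trans t>0 t≤yw)))
        where
        t>0 : 0 < t
        t>0 = <-≤-trans (adj⇒α>0 (within xz)) (α≤ mxz)
        t≤yw : t ≤ a y w
        t≤yw = transit′ yz zw (≤-trans (α≤ω y z) (≤-trans yz≤ (α≤ mxz))) (≤ω mzw)
        yz≤zw : a y z ≤ b z w
        yz≤zw = ≤-trans (≤-trans (α≤ω y z) (≤-trans yz≤ (α≤ mxz))) (≤ω mzw)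
        caseʷ : (y , w) ∈ O ⊎ (w , y) ∈ O → ⊥
        caseʷ (inj₂ wy) = ¬cyz (_ , _ , directed-triangle yz zw wy yz≤zw)
        caseʷ (inj₁ yw) with t ≤? b x y
        ... | yes t≤xy = ¬cxy (_ , _ , rotate (directed-triangle wx xy yw (≤-trans (α≤ mwx) t≤xy)))
        ... | no  t≰xy = <⇒≱ (≰⇒> t≰xy) (≤-trans (flip≤ (transit′ yw wx yw≤t (≤ω mwx))) (α≤ω x y))
          where
          xy≤yw : a x y ≤ b y w
          xy≤yw = ≤-trans (α≤ω x y) (≤-trans (<⇒≤ (≰⇒> t≰xy)) (≤-trans t≤yw (α≤ω y w)))
          yw≤t : a y w ≤ t
          yw≤t = ≤-trans (α≤ω y w) (≤-trans (transit xy yw xy≤yw) (α≤ (mono-sym mwx)))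

    -- A walk of core arcs that `core-transitive` cannot shorten: at each inner vertex the entering
    -- arc starts strictly later than the leaving arc ends. The indices are the ends of the first
    -- arc, the ends of the last arc, and the number of arcs.
    data Descent : V → V → V → V → ℕ → Set where
      single : ∀ {x y} → Core (x , y) → Descent x y x y 1
      _◁_    : ∀ {x y z u v k} → Core (x , y) × b y z < a x y → Descent y z u v k → Descent x y u v (suc k)

    descends : ∀ {x y u v k} → Descent x y u v k → a u v ≤ b x y
    descends (single _)            = α≤ω _ _
    descends (_◁_ {x} {y} (_ , lt) d) = ≤-trans (descends d) (≤-trans (<⇒≤ lt) (α≤ω x y))

    last-core : ∀ {x y u v k} → Descent x y u v k → Core (u , v)
    last-core (single c) = c
    last-core (_ ◁ d)    = last-core d

    -- Where the labels do not drop, the new arc is contracted with the first arc of the descent,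
    -- and the composite is compared with the next one. The bound on the length is what the
    -- induction in `¬closed-descent` lives on.
    cons : ∀ {x y z u v k} → Core (x , y) → Descent y z u v k →
      ∃₂ λ z′ u′ → ∃[ k′ ] k′ ≤ suc k × Descent x z′ u′ v k′
    cons {x} {y} {z} c d with b y z <? a x y
    ... | yes lt = _ , _ , _ , ≤-refl , ((c , lt) ◁ d)
    ... | no  ge with d
    ...   | single c′ = _ , _ , 1 , s≤s z≤n , single (core-transitive c c′ (≮⇒≥ ge))
    ...   | (c′ , _) ◁ d′ with z′ , u′ , k′ , k′≤ , d″ ← cons (core-transitive c c′ (≮⇒≥ ge)) d′ =
      z′ , u′ , k′ , m≤n⇒m≤1+n k′≤ , d″

    normalise : ∀ {x y} → TransClosure (λ u v → Core (u , v)) x y → ∃₂ λ z u → ∃[ k ] Descent x z u y k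
    normalise Plus.[ c ] = _ , _ , _ , single c
    normalise (c ∷ cs) with _ , _ , _ , d ← normalise cs
                       with z , u , k , _ , d′ ← cons c d = z , u , k , d′

    -- A closed descent is shortened by contracting its last arc with its first.
    ¬closed-descent : ∀ k {x y u j} → j ≤ k → ¬ Descent x y u x j
    ¬closed-descent k _ (single c) = asym (proj₁ c) (proj₁ c)
    ¬closed-descent (suc k) (s≤s j≤k) ((c , lt) ◁ d) = rotated d
      where
      replace-last : ∀ {x y u v w k} → Core (u , v) → Descent x y u v k → Core (u , w) →
        ∃₂ λ y′ u′ → ∃[ k′ ] k′ ≤ k × Descent x y′ u′ w k′
      replace-last _ (single _) c = _ , _ , _ , ≤-refl , single c
      replace-last c₀ ((c₁ , lt) ◁ d) c with _ , _ , _ , le , d′ ← replace-last c₀ d c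
                                        with y′ , u′ , k′ , le′ , d″ ← cons c₁ d′ = y′ , u′ , k′ , ≤-trans le′ (s≤s le) , d″
      rotated : Descent _ _ _ _ _ → ⊥
      -- Labels only fall along the walk, so the last arc starts before the first one ends, and the
      -- two compose at their common vertex. The composite takes the place of the last arc and the
      -- first arc is dropped: the result is closed again, with at least one arc fewer.
      rotated d with y′ , u′ , k′ , le , d′ ← replace-last (last-core d) d
                       (core-transitive (last-core d) c (≤-trans (descends d) (≤-trans (<⇒≤ lt) (α≤ω _ _))))
        = ¬closed-descent k (≤-trans le j≤k) d′

    core-acyclic : ∀ x → ¬ TransClosure (λ u v → Core (u , v)) x x
    core-acyclic x cyc with _ , _ , k , d ← normalise cyc = ¬closed-descent k ≤-refl d

    private
      Before : (V → ℕ) → V → V → Set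
      Before rank x w = w ≡ x ⊎ rank x < rank w

    -- Instead of choosing the vertex of least rank, the argument descends. The arc p → q that leads
    -- (z , x) forms a cyclic triangle with apex y. Either p = x, and y → x contradicts x → y, or
    -- the triangle read from p starts at a vertex of smaller rank.
    led⇒¬cyclic : (rank : V → ℕ) →
      (∀ {f} → f ∈ O → ∃₂ λ x y → (x , y) ∈ O × (x , y) ⟶* f × Before rank x (proj₂ f)) →
      ∀ k {t x y z} → rank x < k → ¬ Cyclic t x y z
    led⇒¬cyclic rank leader (suc k) (s≤s x≤k) c with leader (Cyclic.zx c)
    ... | p , q , pq , pq⟶* , before with cyclic-⟶* (rotate c) pq pq⟶* | before
    ...   | c′ | inj₁ refl = asym (Cyclic.xy c) (Cyclic.xy c′)
    ...   | c′ | inj₂ p<x  = led⇒¬cyclic rank leader k (<-≤-trans p<x x≤k) (rotate c′)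

    orientation : IsOrientation 𝒢 O
    orientation = record { within-AP = within ; exactly-one = λ xy →
      [ (λ p → inj₁ (p , asym p)) , (λ q → inj₂ (asym q , q)) ]′ (total xy) }

    isAMTTO : IsAMTTO 𝒢 O
    isAMTTO = record { orientation = orientation
      ; closed = (λ (_ , _ , f∈ , fs) → closed* f∈ (forces⇒⟶* fs)) , λ e∈ → within e∈ , _ , e∈ , ε }

    -- Only the direction of xz is left open by `transit`, and z → x would close a directed
    -- triangle, which is monolabel by `directed-triangle`.
    isMTTO : (∀ {t x y z} → ¬ Cyclic t x y z) → IsMTTO 𝒢 O
    isMTTO ¬cyc = record { orientation = orientation ; transitive = λ {x} {y} {z} xy yz xy⪯yz →
      let le = ⪯⇒≤ (within xy) (within yz) xy⪯yz
          yz≤xz = transit xy yz le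
          adj = α>0⇒adj (<-≤-trans (<-≤-trans (adj⇒α>0 (within yz)) (α≤ω y z)) yz≤xz)
      in [ (λ xz → xz) , (λ zx → ⊥-elim (¬cyc (directed-triangle xy yz zx le))) ]′ (total adj)
       , λ xz≺yz → <⇒≱ (≺⇒< adj (within yz) xz≺yz) yz≤xz }

    Ness⊆O : ∀ {e} → e ∈ Ness 𝒢 → e ∈ O
    Ness⊆O (xy , forced) = [ (λ e∈ → e∈) , (λ ē∈ → closed* ē∈ (forces⇒⟶* forced)) ]′ (total xy)

    Ness⊆Core : ∀ {e} → e ∈ Ness 𝒢 → Core e
    Ness⊆Core e∈@(_ , forced) = Ness⊆O e∈ , necessary⇒¬cyclic (Ness⊆O e∈) (forces⇒⟶* forced)

    Ness-acyclic : InducesAcyclic 𝒢 (Ness 𝒢)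
    Ness-acyclic v = core-acyclic v ∘ to-core
      where
      to-core : ∀ {x y} → TransClosure (λ u v → (u , v) ∈ Ness 𝒢) x y → TransClosure (λ u v → Core (u , v)) x y
      to-core Plus.[ e ] = Plus.[ Ness⊆Core e ]
      to-core (e ∷ es)   = Ness⊆Core e ∷ to-core es

  -- Comparison with the original notions; contradictions of the 2-SAT problem.

  amtto⇒almost : ∀ {O} → IsAMTTO 𝒢 O → Almost O
  amtto⇒almost {O} am = record
    { within = within-AP
    ; total = λ xy → [ inj₁ ∘ proj₁ , inj₂ ∘ proj₂ ]′ (exactly-one xy)
    ; asym = λ xy yx → [ (λ p → proj₂ p yx) , (λ q → proj₁ q xy) ]′ (exactly-one (within-AP xy))
    ; closed = λ e∈ s → proj₁ closed (AP-step s , _ , e∈ , (step⇒aug s ◅ ε)) }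
    where
    open IsAMTTO am
    open IsOrientation orientation

  mtto⇒almost : ∀ {O} → IsMTTO 𝒢 O → Almost O
  mtto⇒almost {O} mt = record { within = within-AP ; total = total ; asym = asym ; closed = closed }
    where
    open IsMTTO mt
    open IsOrientation orientation
    total : ∀ {x y} → Adj x y → (x , y) ∈ O ⊎ (y , x) ∈ O
    total xy = [ inj₁ ∘ proj₁ , inj₂ ∘ proj₂ ]′ (exactly-one xy)
    asym : ∀ {x y} → (x , y) ∈ O → ¬ (y , x) ∈ O
    asym xy yx = [ (λ p → proj₂ p yx) , (λ q → proj₁ q xy) ]′ (exactly-one (within-AP xy))
    transit : ∀ {x y z} → (x , y) ∈ O → (y , z) ∈ O → a x y ≤ b y z → (x , z) ∈ O × b y z ≤ a x z
    transit {x} {y} {z} xy yz le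
      with xz , ⊀ ← transitive xy yz (≤⇒⪯ (within-AP xy) (within-AP yz) le)
      = xz , ≮⇒≥ λ lt → ⊀ (<⇒≺ (within-AP xz) (within-AP yz) lt)
    -- The fourth vertex w decides. If z → w, then y → z → w makes yw later than t; if y → w → z,
    -- then yz is later than t. Otherwise w → y, and w → y → x gives wx at least t. The arc y → x
    -- used there comes from y → z → x by the full transitivity of an MTTO; an AMTTO need not
    -- contain it.
    no-path : ∀ {t x y z w} → Correlated t x y z w → (y , z) ∈ O → ¬ (z , x) ∈ O
    no-path {t} {x} {y} {z} {w} c yz∈ zx∈ with total (α>0⇒adj (≤-<-trans z≤n zw>)) | total (α>0⇒adj yw>0)
      where open Correlated c
    ... | inj₁ zw∈ | _ = <⇒≱ (<-≤-trans zw> (α≤ω z w))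
        (≤-trans (proj₂ (transit yz∈ zw∈ (≤-trans (≤-reflexive (Mono.α≡ yz)) (<⇒≤ (<-≤-trans zw> (α≤ω z w)))))) yw≤)
      where open Correlated c
    ... | inj₂ wz∈ | inj₁ yw∈ = <⇒≱ t<wz (≤-trans (proj₂ (transit yw∈ wz∈ (≤-trans yw≤ (<⇒≤ t<wz)))) (≤-reflexive (Mono.α≡ yz)))
      where
      open Correlated c
      t<wz : t < b w z
      t<wz = <-≤-trans (subst (t <_) (α-sym z w) zw>) (α≤ω w z)
    ... | inj₂ _ | inj₂ wy∈ = <⇒≱ xw< (subst (t ≤_) (α-sym w x)
        (≤-trans t≤yx (proj₂ (transit wy∈ yx∈ (≤-trans (subst (_≤ t) (α-sym y w) yw≤) t≤yx)))))
      where
      open Correlated c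
      t≤yx : t ≤ b y x
      t≤yx = ≤-reflexive (sym (Mono.ω≡ (mono-sym xy)))
      yx∈ : (y , x) ∈ O
      yx∈ = proj₁ (transit yz∈ zx∈ (≤-reflexive (trans (Mono.α≡ yz) (sym (Mono.ω≡ (mono-sym xz))))))
    conflict-free : ∀ {x y z} → (x , y) ∈ O → (y , z) ∈ O → ¬ Conflict x y z
    conflict-free xy yz (ordered _ _ le lt) = <⇒≱ lt (proj₂ (transit xy yz le))
    conflict-free xy yz (correlated c) = no-path c xy yz
    closed : ∀ {e f} → e ∈ O → Step e f → f ∈ O
    closed e∈ s@(into c) = [ (λ f∈ → f∈) , (λ f̄∈ → ⊥-elim (conflict-free e∈ f̄∈ c)) ]′ (total (AP-step s))
    closed e∈ s@(out c)  = [ (λ f∈ → f∈) , (λ f̄∈ → ⊥-elim (conflict-free f̄∈ e∈ c)) ]′ (total (AP-step s))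

  -- The classical obstruction to 2-SAT: a literal and its negation imply each other.
  Contradictory : Set
  Contradictory = ∃[ e ] e ∈ AP 𝒢 × e ⟶* swap e × swap e ⟶* e

  contradictory⇒¬almost : ∀ {O} → Almost O → ¬ Contradictory
  contradictory⇒¬almost al (_ , e∈ , e⟶ē , ē⟶e) with Almost.total al e∈
  ... | inj₁ p = Almost.asym al p (AlmostProperties.closed* al p e⟶ē)
  ... | inj₂ q = Almost.asym al q (AlmostProperties.closed* al q ē⟶e)

  contradictory⇒cycle : InducesAcyclic 𝒢 (Ness 𝒢) → ¬ Contradictory
  contradictory⇒cycle acyc ((x , y) , xy , xy⟶yx , yx⟶xy) =
    acyc x ((xy , ⟶*⇒forces yx⟶xy) ∷ Plus.[ adj-sym xy , ⟶*⇒forces xy⟶yx ])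

-- A program logic with running times.

update-here : {X : Set} (f : ℕ → X) {i j : ℕ} {x : X} → i ≡ j → update f i x j ≡ x
update-here f {i} {j} i≡j with i ℕ.≟ j
... | yes _ = refl
... | no ne = ⊥-elim (ne i≡j)

update-there : {X : Set} (f : ℕ → X) {i j : ℕ} {x : X} → i ≢ j → update f i x j ≡ f j
update-there f {i} {j} i≢j with i ℕ.≟ j
... | yes eq = ⊥-elim (i≢j eq)
... | no _ = refl

-- A syntactic, hence Boolean, criterion: for a concrete program and register, `T (keepsReg p r)`
-- evaluates to the unit type and is filled in as an implicit argument. Frame conditions then cost
-- no proof.
keepsReg : Program → Reg → Bool
keepsReg skip _ = true
keepsReg (q ≔ _) r = not (q ≡ᵇ r)
keepsReg (_ [ _ ]≔ _) _ = true
keepsReg (p ⨾ q) r = keepsReg p r ∧ keepsReg q r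
keepsReg (If _ Then p Else q) r = keepsReg p r ∧ keepsReg q r
keepsReg (While _ Do p) r = keepsReg p r

keepsArr : Program → Arr → Bool
keepsArr skip _ = true
keepsArr (_ ≔ _) _ = true
keepsArr (B [ _ ]≔ _) A = not (B ≡ᵇ A)
keepsArr (p ⨾ q) A = keepsArr p A ∧ keepsArr q A
keepsArr (If _ Then p Else q) A = keepsArr p A ∧ keepsArr q A
keepsArr (While _ Do p) A = keepsArr p A

record Keeps (p : Program) (s s′ : State) : Set where
  constructor keep
  field
    keep-reg : ∀ r → {T (keepsReg p r)} → regs s′ r ≡ regs s r
    keep-arr : ∀ A → {T (keepsArr p A)} → arrs s′ A ≡ arrs s A
open Keeps public

private
  T-not-≡ᵇ : ∀ {i j} → T (not (i ≡ᵇ j)) → i ≢ j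
  T-not-≡ᵇ {i} t refl with i ≡ᵇ i | ≡⇒≡ᵇ i i refl
  ... | true | _ = t

  T-∧ˡ : ∀ {p q} → T (p ∧ q) → T p
  T-∧ˡ = proj₁ ∘ Equivalence.to T-∧

  T-∧ʳ : ∀ {p q} → T (p ∧ q) → T q
  T-∧ʳ {p} = proj₂ ∘ Equivalence.to (T-∧ {p})

keeps-refl : ∀ {p s} → Keeps p s s
keeps-refl = keep (λ _ → refl) (λ _ → refl)

keeps-trans : ∀ {p s s′ s″} → Keeps p s s′ → Keeps p s′ s″ → Keeps p s s″
keeps-trans k k′ = keep (λ r {t} → trans (keep-reg k′ r {t}) (keep-reg k r {t}))
                        (λ A {t} → trans (keep-arr k′ A {t}) (keep-arr k A {t}))

keeps : ∀ {p s s′ t} → ⟨ p , s ⟩⇓ s′ [ t ] → Keeps p s s′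
keeps skip   = keeps-refl
keeps {q ≔ _} {s} assign = keep (λ r {t} → update-there (regs s) (T-not-≡ᵇ {q} t)) (λ _ → refl)
keeps {B [ _ ]≔ _} {s} store = keep (λ _ → refl) (λ A {t} → update-there (arrs s) (T-not-≡ᵇ {B} t))
keeps {p ⨾ q} (seq d d′) with keeps d | keeps d′
... | k | k′ = keep (λ r {t} → trans (keep-reg k′ r {T-∧ʳ {keepsReg p r} t}) (keep-reg k r {T-∧ˡ t}))
                    (λ A {t} → trans (keep-arr k′ A {T-∧ʳ {keepsArr p A} t}) (keep-arr k A {T-∧ˡ t}))
keeps (ifTrue _ d) with keeps d
... | k = keep (λ r {t} → keep-reg k r {T-∧ˡ t}) (λ A {t} → keep-arr k A {T-∧ˡ t})
keeps {If _ Then p Else _} (ifFalse _ d) with keeps d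
... | k = keep (λ r {t} → keep-reg k r {T-∧ʳ {keepsReg p r} t}) (λ A {t} → keep-arr k A {T-∧ʳ {keepsArr p A} t})
keeps (whileTrue _ d d′) with keeps d | keeps d′
... | k | k′ = keep (λ r {t} → trans (keep-reg k′ r {t}) (keep-reg k r {t}))
                    (λ A {t} → trans (keep-arr k′ A {t}) (keep-arr k A {t}))
keeps (whileFalse _) = keeps-refl

Post : Set₁
Post = State → ℕ → Set

-- Total correctness: a halting run is exhibited, and the postcondition speaks about its final state
-- and its cost.
Does : Program → State → Post → Set
Does p s Q = ∃₂ λ s′ t → ⟨ p , s ⟩⇓ s′ [ t ] × Q s′ t

Within : ℕ → (State → Set) → Post
Within B Q s t = t ≤ B × Q s

straight : Program → Bool
straight skip = true
straight (_ ≔ _) = true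
straight (_ [ _ ]≔ _) = true
straight (p ⨾ q) = straight p ∧ straight q
straight (If _ Then _ Else _) = false
straight (While _ Do _) = false

run : Program → State → State
run (r ≔ e) s = setReg s r (eval s e)
run (A [ e ]≔ f) s = setArr s A (eval s e) (eval s f)
run (p ⨾ q) s = run q (run p s)
run _ s = s

-- Exact on straight-line programs. A test is charged for both branches, so that the value bounds
-- either one. Loops count 0 here and are accounted for separately, by the rules for loops.
cost : Program → ℕ
cost skip = 1
cost (_ ≔ e) = 1 + size e
cost (_ [ e ]≔ f) = 1 + size e + size f
cost (If e Then p Else q) = 1 + size e + (cost p + cost q)
cost (p ⨾ q) = cost p + cost q
cost (While _ Do _) = 0

straight-runs : ∀ p s → T (straight p) → ⟨ p , s ⟩⇓ run p s [ cost p ]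
straight-runs skip _ _ = skip
straight-runs (_ ≔ _) _ _ = assign
straight-runs (_ [ _ ]≔ _) _ _ = store
straight-runs (p ⨾ q) s t = seq (straight-runs p s (T-∧ˡ t)) (straight-runs q _ (T-∧ʳ {straight p} t))

block : ∀ p {s} {Q : Post} {t : T (straight p)} → Q (run p s) (cost p) → Does p s Q
block p {t = t} q = _ , _ , straight-runs p _ t , q

mapDoes : ∀ {p s} {P Q : Post} → (∀ {s′ t} → Keeps p s s′ → P s′ t → Q s′ t) → Does p s P → Does p s Q
mapDoes f (s′ , t , d , p) = s′ , t , d , f (keeps d) p

infixr 4 _►_
_►_ : ∀ {p q s} {P Q : Post} → Does p s P →
  (∀ {s′ t} → Keeps p s s′ → P s′ t → Does q s′ (λ s″ t′ → Q s″ (t + t′))) → Does (p ⨾ q) s Q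
(s′ , t , d , p) ► f with s″ , t′ , d′ , q ← f (keeps d) p = s″ , t + t′ , seq d d′ , q

infixr 4 _▷_
_▷_ : ∀ {p q s A B} {P Q : State → Set} → Does p s (Within A P) →
  (∀ {s′} → Keeps p s s′ → P s′ → Does q s′ (Within B Q)) → Does (p ⨾ q) s (Within (A + B) Q)
d ▷ f = d ► λ k (le , p) → mapDoes (λ _ (le′ , q) → +-mono-≤ le le′ , q) (f k p)

branch : ∀ {e p q s} {Q : Post} →
  (eval s e ≢ 0 → Does p s (λ s′ t → Q s′ (1 + size e + t))) →
  (eval s e ≡ 0 → Does q s (λ s′ t → Q s′ (1 + size e + t))) → Does (If e Then p Else q) s Q
branch {e} {s = s} f g with eval s e ℕ.≟ 0
... | no ne with s′ , t , d , q ← f ne = s′ , _ , ifTrue ne d , q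
... | yes eq with s′ , t , d , q ← g eq = s′ , _ , ifFalse eq d , q

branch≤ : ∀ {e p q s} {A B : ℕ} {Q : State → Set} →
  (eval s e ≢ 0 → Does p s (Within A Q)) → (eval s e ≡ 0 → Does q s (Within B Q)) →
  Does (If e Then p Else q) s (Within (1 + size e + (A + B)) Q)
branch≤ {e} f g = branch
  (λ ne → mapDoes (λ _ (le , q) → +-monoʳ-≤ (1 + size e) (m≤n⇒m≤n+o _ le) , q) (f ne))
  (λ eq → mapDoes (λ _ (le , q) → +-monoʳ-≤ (1 + size e) (m≤n⇒m≤o+n _ le) , q) (g eq))

within-mono : ∀ {p s A B} {Q : State → Set} → A ≤ B → Does p s (Within A Q) → Does p s (Within B Q)
within-mono le = mapDoes λ _ (le′ , q) → ≤-trans le′ le , q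

-- In a loop invariant I s τ, τ is the time spent so far.
while : ∀ {e p s₀} (I : Post) (μ : State → ℕ) →
  (∀ {s τ} → Keeps p s₀ s → I s τ → eval s e ≢ 0 →
    Does p s (λ s′ t → I s′ (τ + (1 + size e + t)) × μ s′ < μ s)) →
  I s₀ 0 → Does (While e Do p) s₀ (λ s′ t → ∃[ τ ] t ≡ τ + (1 + size e) × I s′ τ × eval s′ e ≡ 0)
while {e} {p} {s₀} I μ step init = go _ ≤-refl keeps-refl init
  where
  go : ∀ k {s τ} → μ s ≤ k → Keeps p s₀ s → I s τ →
    Does (While e Do p) s (λ s′ t → ∃[ τ′ ] τ + t ≡ τ′ + (1 + size e) × I s′ τ′ × eval s′ e ≡ 0)
  go k {s} {τ} μ≤ ks is with eval s e ℕ.≟ 0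
  ... | yes eq = s , _ , whileFalse eq , τ , refl , is , eq
  go zero μ≤ ks is | no ne with _ , _ , _ , _ , lt ← step ks is ne =
    ⊥-elim (n≮0 (<-≤-trans lt μ≤))
  go (suc k) {s} {τ} μ≤ ks is | no ne
    with s′ , t , d , is′ , lt ← step ks is ne
    with s″ , t′ , d′ , τ′ , eq , is″ , z ← go k (s≤s⁻¹ (≤-trans lt μ≤)) (keeps-trans ks (keeps d)) is′
    = s″ , _ , whileTrue ne d d′ , τ′ , trans (sym (+-assoc τ (1 + size e + t) t′)) eq , is″ , z

For : Reg → Reg → Program → Program
For r k p = r ≔ lit 0 ⨾ While reg k ⊖ reg r Do (p ⨾ r ≔ reg r ⊕ lit 1)

-- Besides its body, a round costs 4 units for the test and 4 for the increment, hence the 8; the 6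
-- consists of 2 for the initialisation and 4 for the last test, which fails. The body has to
-- establish the invariant for the state with the counter already advanced.
for : ∀ {r k p s₀ N} → regs s₀ k ≡ N → {T (keepsReg (For r k p) k)} → {T (keepsReg p r)} →
  (I : ℕ → Post) →
  (∀ {i s τ} → i < N → Keeps (For r k p) s₀ s → regs s r ≡ i → I i s τ →
    Does p s (λ s′ t → I (suc i) (setReg s′ r (suc i)) (τ + (t + 8)))) →
  I 0 (setReg s₀ r 0) 0 → Does (For r k p) s₀ (λ s′ t → ∃[ τ ] t ≡ τ + 6 × I N s′ τ)
for {r} {k} {p} {s₀} {N} k≡ {kk} {kr} I step init =
  block (r ≔ lit 0) {Q = λ s t → s ≡ setReg s₀ r 0 × t ≡ 2} (refl , refl) ► λ { _ (refl , refl) →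
  mapDoes finish (while J μ step′ (0 , z≤n , update-here (regs s₀) {r} refl , init)) }
  where
  s₁ = setReg s₀ r 0
  body = p ⨾ r ≔ reg r ⊕ lit 1
  J : Post
  J s τ = ∃[ i ] i ≤ N × regs s r ≡ i × I i s τ
  μ : State → ℕ
  μ s = N ∸ regs s r
  body-k : T (keepsReg body k)
  body-k = T-∧ʳ {not (r ≡ᵇ k)} kk
  r≢k : r ≢ k
  r≢k = T-not-≡ᵇ (T-∧ˡ {not (r ≡ᵇ k)} kk)
  k-at : ∀ {s} → Keeps body s₁ s → regs s k ≡ N
  k-at ks = trans (keep-reg ks k {body-k}) (trans (update-there (regs s₀) r≢k) k≡)
  whole : ∀ {s} → Keeps body s₁ s → Keeps (For r k p) s₀ s
  whole ks = keep
    (λ q {t} → trans (keep-reg ks q {T-∧ʳ {not (r ≡ᵇ q)} t}) (update-there (regs s₀) (T-not-≡ᵇ {r} (T-∧ˡ {not (r ≡ᵇ q)} t))))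
    (λ A {t} → keep-arr ks A {t})
  step′ : ∀ {s τ} → Keeps body s₁ s → J s τ → eval s (reg k ⊖ reg r) ≢ 0 →
    Does body s (λ s′ t → J s′ (τ + (4 + t)) × μ s′ < μ s)
  step′ {s} {τ} ks (i , i≤ , r≡ , is) ne =
    step i<N (whole ks) r≡ is ► λ {s′} {t} kp is′ →
      block (r ≔ reg r ⊕ lit 1)
        (let r′ : regs s′ r + 1 ≡ suc i
             r′ = trans (cong (_+ 1) (trans (keep-reg kp r {kr}) r≡)) (+-comm i 1)
         in subst (λ v → J (setReg s′ r v) (τ + (4 + (t + 4))) × μ (setReg s′ r v) < μ s) (sym r′)
           ((suc i , i<N , update-here (regs s′) {r} refl ,
             subst (λ v → I (suc i) (setReg s′ r (suc i)) (τ + v)) (+-comm-4 t) is′) ,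
            subst₂ _<_ (sym (cong (N ∸_) (update-here (regs s′) {r} refl))) (sym (cong (N ∸_) r≡))
              (∸-monoʳ-< (n<1+n i) i<N)))
    where
    i<N : i < N
    i<N with i ℕ.<? N
    ... | yes lt = lt
    ... | no ge = ⊥-elim (ne (trans (cong₂ _∸_ (k-at ks) r≡) (m≤n⇒m∸n≡0 (≮⇒≥ ge))))
    +-comm-4 : ∀ t → t + 8 ≡ 4 + (t + 4)
    +-comm-4 t = trans (+-comm t 8) (cong (4 +_) (+-comm 4 t))
  finish : ∀ {s t} → Keeps (While reg k ⊖ reg r Do body) s₁ s →
    ∃[ τ ] t ≡ τ + 4 × J s τ × eval s (reg k ⊖ reg r) ≡ 0 → ∃[ τ ] 2 + t ≡ τ + 6 × I N s τ
  finish ks (τ , refl , (i , i≤ , r≡ , is) , z) =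
    τ , trans (+-comm 2 (τ + 4)) (+-assoc τ 4 2) , subst (λ j → I j _ τ) i≡N is
    where
    i≡N : i ≡ N
    i≡N = ≤-antisym i≤ (m∸n≡0⇒m≤n (trans (sym (cong₂ _∸_ (k-at (keep (λ q {t} → keep-reg ks q {t}) (λ A {t} → keep-arr ks A {t}))) r≡)) z))

for≤ : ∀ {r k p s₀ N} B → regs s₀ k ≡ N → {T (keepsReg (For r k p) k)} → {T (keepsReg p r)} →
  (I : ℕ → State → Set) →
  (∀ {i s} → i < N → Keeps (For r k p) s₀ s → regs s r ≡ i → I i s →
    Does p s (Within B (λ s′ → I (suc i) (setReg s′ r (suc i))))) →
  I 0 (setReg s₀ r 0) → Does (For r k p) s₀ (Within (N * (B + 8) + 6) (I N))
for≤ {N = N} B k≡ {kk} {kr} I step init =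
  mapDoes (λ { _ (τ , refl , le , is) → +-monoˡ-≤ 6 le , is })
    (for k≡ {kk} {kr} (λ i s τ → τ ≤ i * (B + 8) × I i s)
      (λ {i} {s} {τ} i< ks r≡ (le , is) → mapDoes
        (λ {_} {t} _ (le′ , is′) → (begin
            τ + (t + 8)            ≤⟨ +-mono-≤ le (+-monoˡ-≤ 8 le′) ⟩
            i * (B + 8) + (B + 8)  ≡⟨ +-comm (i * (B + 8)) (B + 8) ⟩
            suc i * (B + 8)        ∎) , is′)
        (step i< ks r≡ is))
      (z≤n , init))
  where open ≤-Reasoning

AllRegs AllArrs : Program → List ℕ → Set
AllRegs p []       = ⊤
AllRegs p (r ∷ rs) = T (keepsReg p r) × AllRegs p rs
AllArrs p []       = ⊤
AllArrs p (A ∷ As) = T (keepsArr p A) × AllArrs p As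

branchᶜ : ∀ {e p q s} {B : ℕ} {Q : State → Set} →
  (eval s e ≢ 0 → Does p s (Within B Q)) → (eval s e ≡ 0 → Does q s (Within B Q)) →
  Does (If e Then p Else q) s (Within (1 + size e + B) Q)
branchᶜ {e} f g = branch
  (λ ne → mapDoes (λ _ (le , q) → +-monoʳ-≤ (1 + size e) le , q) (f ne))
  (λ eq → mapDoes (λ _ (le , q) → +-monoʳ-≤ (1 + size e) le , q) (g eq))

diff-≡ : ∀ {i j} → i ≡ j → (i ∸ j) + (j ∸ i) ≡ 0
diff-≡ {i} refl = cong₂ _+_ (n∸n≡0 i) (n∸n≡0 i)

≡-diff : ∀ {i j} → (i ∸ j) + (j ∸ i) ≡ 0 → i ≡ j
≡-diff {i} {j} eq = ≤-antisym (m∸n≡0⇒m≤n (m+n≡0⇒m≡0 (i ∸ j) eq)) (m∸n≡0⇒m≤n (m+n≡0⇒n≡0 (i ∸ j) eq))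

while-stop : ∀ {e p s} {Q : Post} → eval s e ≡ 0 → Q s (1 + size e) → Does (While e Do p) s Q
while-stop z q = _ , _ , whileFalse z , q

while-go : ∀ {e p s} {P Q : Post} → eval s e ≢ 0 → Does p s P →
  (∀ {s′ t} → Keeps p s s′ → P s′ t → Does (While e Do p) s′ (λ s″ t′ → Q s″ (1 + size e + t + t′))) →
  Does (While e Do p) s Q
while-go ne (s′ , t , d , p) f with s″ , t′ , d′ , q ← f (keeps d) p = s″ , _ , whileTrue ne d d′ , q

-- Lists without repetitions, loops over lists, and codes of pairs and triples.

at-++ˡ : ∀ xs {ys j} → j < length xs → at (xs ++ ys) j ≡ at xs j
at-++ˡ (_ ∷ _)  {j = zero}  _   = refl
at-++ˡ (_ ∷ xs) {j = suc _} (s≤s lt) = at-++ˡ xs lt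

at-++ʳ : ∀ xs {ys} j → at (xs ++ ys) (length xs + j) ≡ at ys j
at-++ʳ []       _ = refl
at-++ʳ (_ ∷ xs) j = at-++ʳ xs j

module _ {X : Set} where

  at-middle : ∀ (f : X → ℕ) {xs} pre {x post} → xs ≡ pre ++ x ∷ post → at (map f xs) (length pre) ≡ f x
  at-middle f []        refl = refl
  at-middle f (_ ∷ pre) refl = at-middle f pre refl

  unique-⊆-length : ∀ {xs ys : List X} → Unique xs → (∀ {x} → x ∈ₗ xs → x ∈ₗ ys) → length xs ≤ length ys
  unique-⊆-length {[]} _ _ = z≤n
  unique-⊆-length {x ∷ xs} (x∉ ∷ u) sub with us , vs , refl ← ∈-∃++ (sub (here refl)) =
    subst (suc (length xs) ≤_) (sym (Listₚ.length-++-sucʳ us x vs)) (s≤s (unique-⊆-length u sub′))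
    where
    sub′ : ∀ {y} → y ∈ₗ xs → y ∈ₗ us ++ vs
    sub′ y∈ with ∈-++⁻ us (sub (there y∈))
    ... | inj₁ y∈us = ∈-++⁺ˡ y∈us
    ... | inj₂ (here refl) = ⊥-elim (All.lookup x∉ y∈ refl)
    ... | inj₂ (there y∈vs) = ∈-++⁺ʳ us y∈vs

  -- If y were missing from xs, then y ∷ xs would be a list without repetitions inside ys that is
  -- longer than ys. This is how two lockstep searches are compared.
  unique-⊆-⊇ : DecidableEquality X → ∀ {xs ys : List X} → Unique xs → (∀ {x} → x ∈ₗ xs → x ∈ₗ ys) →
    length ys ≤ length xs → ∀ {y} → y ∈ₗ ys → y ∈ₗ xs
  unique-⊆-⊇ _≟_ {xs} u sub le {y} y∈ with All.all? (λ x → ¬? (y ≟ x)) xs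
  ... | yes y∉ = ⊥-elim (<⇒≱ (unique-⊆-length (y∉ ∷ u) λ { (here refl) → y∈ ; (there x∈) → sub x∈ }) le)
  ... | no ¬y∉ with Any.any? (y ≟_) xs
  ...   | yes y∈xs = y∈xs
  ...   | no  y∉xs = ⊥-elim (¬y∉ (All.tabulate λ x∈ → λ { refl → y∉xs x∈ }))

  filter-length-mono : ∀ {P Q : X → Set} (P? : ∀ x → Dec (P x)) (Q? : ∀ x → Dec (Q x)) xs →
    (∀ {x} → x ∈ₗ xs → P x → Q x) → length (filter P? xs) ≤ length (filter Q? xs)
  filter-length-mono P? Q? [] _ = z≤n
  filter-length-mono P? Q? (x ∷ xs) f with ih ← filter-length-mono P? Q? xs (f ∘ there) | P? x | Q? x
  ... | yes _ | yes _ = s≤s ih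
  ... | yes p | no ¬q = ⊥-elim (¬q (f (here refl) p))
  ... | no _  | yes _ = m≤n⇒m≤1+n ih
  ... | no _  | no _  = ih

  filter-length-strict : ∀ {P Q : X → Set} (P? : ∀ x → Dec (P x)) (Q? : ∀ x → Dec (Q x)) {xs} →
    (∀ {x} → x ∈ₗ xs → P x → Q x) → ∀ {y} → y ∈ₗ xs → ¬ P y → Q y → length (filter P? xs) < length (filter Q? xs)
  filter-length-strict P? Q? {x ∷ xs} f (here refl) ¬p q with ih ← filter-length-mono P? Q? xs (f ∘ there) | P? x | Q? x
  ... | yes p | _     = ⊥-elim (¬p p)
  ... | no _  | yes _ = s≤s ih
  ... | no _  | no ¬q = ⊥-elim (¬q q)
  filter-length-strict P? Q? {x ∷ xs} f (there y∈) ¬p q with ih ← filter-length-strict P? Q? (f ∘ there) y∈ ¬p q | P? x | Q? x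
  ... | yes _ | yes _ = s≤s ih
  ... | yes p | no ¬q = ⊥-elim (¬q (f (here refl) p))
  ... | no _  | yes _ = m≤n⇒m≤1+n ih
  ... | no _  | no _  = ih

  record Split (xs : List X) (i : ℕ) : Set where
    constructor split
    field
      {pre post} : List X
      {mid}      : X
      eq         : xs ≡ pre ++ mid ∷ post
      length-pre : length pre ≡ i
      take-i     : take i xs ≡ pre
      take-suc-i : take (suc i) xs ≡ pre ∷ʳ mid

  split-at : ∀ xs {i} → i < length xs → Split xs i
  split-at (x ∷ xs) {zero}  _ = split {pre = []} refl refl refl refl
  split-at (x ∷ xs) {suc i} (s≤s lt) with split eq refl t t′ ← split-at xs lt =
    split (cong (x ∷_) eq) refl (cong (x ∷_) t) (cong (x ∷_) t′)

  -- Invariants of the main loops are phrased by the prefix that has been processed, so that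
  -- membership and sums over it can be used directly; the counter is only its length.
  forList : ∀ (xs : List X) {r k p s₀} → regs s₀ k ≡ length xs → {T (keepsReg (For r k p) k)} → {T (keepsReg p r)} →
    (I : List X → Post) →
    (∀ {pre x post s τ} → xs ≡ pre ++ x ∷ post → Keeps (For r k p) s₀ s → regs s r ≡ length pre → I pre s τ →
      Does p s (λ s′ t → I (pre ∷ʳ x) (setReg s′ r (suc (length pre))) (τ + (t + 8)))) →
    I [] (setReg s₀ r 0) 0 → Does (For r k p) s₀ (λ s′ t → ∃[ τ ] t ≡ τ + 6 × I xs s′ τ)
  forList xs {r} {k} {p} k≡ {kk} {kr} I step init =
    mapDoes (λ { {s′} _ (τ , eq , is) → τ , eq , subst (λ ys → I ys s′ τ) (Listₚ.take-all _ xs ≤-refl) is })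
      (for k≡ {kk} {kr} (λ i s τ → I (take i xs) s τ)
        (λ {i} {s} {τ} i< ks r≡ is → go i< ks r≡ is (split-at xs i<))
        init)
    where
    go : ∀ {i s τ} → i < length xs → Keeps (For r k p) _ s → regs s r ≡ i → I (take i xs) s τ → Split xs i →
      Does p s (λ s′ t → I (take (suc i) xs) (setReg s′ r (suc i)) (τ + (t + 8)))
    go {i} {s} {τ} i< ks r≡ is (split eq refl ti ti′) =
      mapDoes (λ {s′} {t} _ → subst (λ ys → I ys (setReg s′ r (suc i)) (τ + (t + 8))) (sym ti′))
        (step eq ks r≡ (subst (λ ys → I ys s τ) ti is))

  forList≤ : ∀ (xs : List X) {r k p s₀} B → regs s₀ k ≡ length xs → {T (keepsReg (For r k p) k)} → {T (keepsReg p r)} →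
    (I : List X → State → Set) →
    (∀ {pre x post s} → xs ≡ pre ++ x ∷ post → Keeps (For r k p) s₀ s → regs s r ≡ length pre → I pre s →
      Does p s (Within B (λ s′ → I (pre ∷ʳ x) (setReg s′ r (suc (length pre)))))) →
    I [] (setReg s₀ r 0) → Does (For r k p) s₀ (Within (length xs * (B + 8) + 6) (I xs))
  forList≤ xs {r} {k} {p} B k≡ {kk} {kr} I step init =
    mapDoes (λ { _ (τ , refl , le , is) → +-monoˡ-≤ 6 le , is })
      (forList xs k≡ {kk} {kr} (λ pre s τ → τ ≤ length pre * (B + 8) × I pre s)
        (λ {pre} {x} {post} {s} {τ} eq ks r≡ (le , is) → mapDoes
          (λ {_} {t} _ (le′ , is′) → (begin
              τ + (t + 8)                     ≤⟨ +-mono-≤ le (+-monoˡ-≤ 8 le′) ⟩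
              length pre * (B + 8) + (B + 8)  ≡⟨ +-comm (length pre * (B + 8)) (B + 8) ⟩
              suc (length pre) * (B + 8)      ≡⟨ cong (_* (B + 8)) (sym (trans (Listₚ.length-++ pre) (+-comm (length pre) 1))) ⟩
              length (pre ∷ʳ x) * (B + 8)     ∎) , is′)
          (step eq ks r≡ is))
        (z≤n , init))
    where open ≤-Reasoning

  ∈-∷ʳ⁻ : ∀ {xs : List X} {x y} → y ∈ₗ xs ∷ʳ x → y ∈ₗ xs ⊎ y ≡ x
  ∈-∷ʳ⁻ {xs} y∈ with ∈-++⁻ xs y∈
  ... | inj₁ y∈xs = inj₁ y∈xs
  ... | inj₂ (here refl) = inj₂ refl

  ∈-middle : ∀ {xs} pre {x : X} {post} → xs ≡ pre ++ x ∷ post → x ∈ₗ xs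
  ∈-middle pre refl = ∈-++⁺ʳ pre (here refl)

module Codes (n : ℕ) where

  code : Fin n → Fin n → ℕ
  code x y = n * toℕ x + toℕ y

  code₃ : Fin n → Fin n → Fin n → ℕ
  code₃ x y z = n * n * toℕ x + code y z

  code-injective : ∀ {x y u v} → code x y ≡ code u v → x ≡ u × y ≡ v
  code-injective {x} {y} {u} {v} eq = Finₚ.combine-injective x y u v (Finₚ.toℕ-injective
    (trans (Finₚ.toℕ-combine x y) (trans eq (sym (Finₚ.toℕ-combine u v)))))

  toℕ-combine₃ : ∀ x y z → toℕ (combine x (combine y z)) ≡ code₃ x y z
  toℕ-combine₃ x y z = trans (Finₚ.toℕ-combine x (combine y z)) (cong (n * n * toℕ x +_) (Finₚ.toℕ-combine y z))

  code₃-injective : ∀ {x y z u v w} → code₃ x y z ≡ code₃ u v w → x ≡ u × y ≡ v × z ≡ w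
  code₃-injective {x} {y} {z} {u} {v} {w} eq
    with refl , p ← Finₚ.combine-injective x (combine y z) u (combine v w) (Finₚ.toℕ-injective
           (trans (toℕ-combine₃ x y z) (trans eq (sym (toℕ-combine₃ u v w)))))
    = refl , Finₚ.combine-injective y z v w p

-- The program.

pattern rn = 0
pattern rm = 1
pattern rans = 2
pattern rnn = 3
pattern rmm = 4
pattern ri = 5
pattern rj = 6
pattern rk = 7
pattern rx = 8
pattern ry = 9
pattern rz = 10
pattern rt = 11
pattern rp = 12
pattern rq = 13
pattern rh = 14
pattern rl = 15
pattern rσ = 16
pattern rh′ = 17
pattern rl′ = 18
pattern rσ′ = 19
pattern rstamp = 20
pattern rfound = 21
pattern rw = 22
pattern rround = 23
pattern racc = 24
pattern rsx = 25
pattern rsy = 26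

pattern aU = 0
pattern aV = 1
pattern aOff = 2
pattern aLab = 3
pattern aOut = 4
pattern aR = 5
pattern aR₃ = 6
pattern aX = 7
pattern aY = 8
pattern aLo = 9
pattern aHi = 10
pattern aα = 11
pattern aω = 12
pattern aN = 13
pattern aDeg = 14
pattern aS = 15
pattern aCol = 16
pattern aMark = 17
pattern aQX = 18
pattern aQY = 19
pattern aCore = 20
pattern aRank = 21
pattern aBlk = 22

-- aX, aY, aLo and aHi list all 2m arcs with their extreme labels. A matrix entry (x , y)
-- is stored at n x + y, where aR holds the multiples of n; likewise, aS holds at
-- n² x + n y + z whether Conflict x y z. A nonzero entry of aCol means that the arc is
-- chosen; aRank numbers the processed vertices from 1 on; aBlk v is the last round in
-- which v had an unprocessed predecessor in the core.

cell : Exp → Exp → Exp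
cell e f = aR [ e ] ⊕ f

cell₃ : Exp → Exp → Exp → Exp
cell₃ e f g = aR₃ [ e ] ⊕ cell f g

-- The distance of two numbers, since subtraction is truncated; as a test it succeeds when they
-- differ.
diff : Exp → Exp → Exp
diff e f = (e ⊖ f) ⊕ (f ⊖ e)

n̂ m̂ x̂ ŷ ẑ ĵ t̂ : Exp
n̂ = reg rn
m̂ = reg rm
x̂ = reg rx
ŷ = reg ry
ẑ = reg rz
ĵ = reg rj
t̂ = reg rt

-- In the absence of multiplication, the offsets n x and n² x are accumulated by addition, in time
-- O(n). The first loop leaves n² in the accumulator, ready for the second.
rows : Program
rows =
  For ri rn (aR [ reg ri ]≔ reg racc ⨾ racc ≔ reg racc ⊕ n̂) ⨾
  rnn ≔ reg racc ⨾
  racc ≔ lit 0 ⨾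
  For ri rn (aR₃ [ reg ri ]≔ reg racc ⨾ racc ≔ reg racc ⊕ reg rnn) ⨾
  rmm ≔ m̂ ⊕ m̂

listArcsBody : Program
listArcsBody =
  aX [ reg ri ]≔ aU [ reg ri ] ⨾
  aY [ reg ri ]≔ aV [ reg ri ] ⨾
  aX [ m̂ ⊕ reg ri ]≔ aV [ reg ri ] ⨾
  aY [ m̂ ⊕ reg ri ]≔ aU [ reg ri ] ⨾
  -- The earliest label is stored at the offset of the edge and the latest just before the next
  -- offset. Adding 1 is the shift in `α` and `ω`.
  rt ≔ aLab [ aOff [ reg ri ] ] ⊕ lit 1 ⨾
  rz ≔ aLab [ aOff [ reg ri ⊕ lit 1 ] ⊖ lit 1 ] ⊕ lit 1 ⨾
  aLo [ reg ri ]≔ t̂ ⨾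
  aLo [ m̂ ⊕ reg ri ]≔ t̂ ⨾
  aHi [ reg ri ]≔ ẑ ⨾
  aHi [ m̂ ⊕ reg ri ]≔ ẑ

listArcs : Program
listArcs = For ri rm listArcsBody

fetch : Program
fetch = rx ≔ aX [ reg ri ] ⨾ ry ≔ aY [ reg ri ]

matricesBody : Program
matricesBody =
  aα [ cell x̂ ŷ ]≔ aLo [ reg ri ] ⨾
  aω [ cell x̂ ŷ ]≔ aHi [ reg ri ] ⨾
  aN [ cell x̂ (aDeg [ x̂ ]) ]≔ ŷ ⨾
  aDeg [ x̂ ]≔ aDeg [ x̂ ] ⊕ lit 1

matrices : Program
matrices = For ri rmm (fetch ⨾ matricesBody)

α̂ ω̂ : Exp → Exp → Exp
α̂ e f = aα [ cell e f ]
ω̂ e f = aω [ cell e f ]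

-- Zero exactly when α and ω equal t on the pair.
monoDefect : Exp → Exp → Exp → Exp
monoDefect t e f = diff (α̂ e f) t ⊕ diff (ω̂ e f) t

-- For an arc (x , y) and a vertex j, does Conflict j x y hold?
scanNeighbour : Program
scanNeighbour =
  rz ≔ aN [ cell ĵ (reg rk) ] ⨾
  -- Zero exactly when jz starts at t or earlier, xz later than t, and yz earlier than t (or is no
  -- edge). A strict inequality is tested by adding 1 to its smaller side.
  If (α̂ ĵ ẑ ⊖ t̂) ⊕ ((t̂ ⊕ lit 1) ⊖ α̂ x̂ ẑ) ⊕ ((α̂ ŷ ẑ ⊕ lit 1) ⊖ t̂)
  Then skip Else (aS [ cell₃ ĵ x̂ ŷ ]≔ lit 1)

scanNeighbours : Program
scanNeighbours = rp ≔ aDeg [ ĵ ] ⨾ For rk rp scanNeighbour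

-- A conflict of the kind `ordered` is settled by a few matrix entries. Neighbours of j are scanned
-- only if this fails and j, x, y is a monolabel triangle, so the other ones among the 2mn tests
-- take constant time.
conflictTest : Program
conflictTest =
  If α̂ ĵ x̂ Then
    (If diff ĵ ŷ Then
      (If (α̂ ĵ x̂ ⊖ ω̂ x̂ ŷ) ⊕ ((α̂ ĵ ŷ ⊕ lit 1) ⊖ ω̂ x̂ ŷ) Then
        (If monoDefect t̂ ĵ x̂ ⊕ monoDefect t̂ x̂ ŷ ⊕ monoDefect t̂ ĵ ŷ Then skip Else scanNeighbours)
       Else (aS [ cell₃ ĵ x̂ ŷ ]≔ lit 1))
     Else skip)
  Else skip

conflicts : Program
conflicts = For ri rmm (fetch ⨾ rt ≔ α̂ x̂ ŷ ⨾ For rj rn conflictTest)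

-- A search closes a set of arcs under Step.  Its k-th arc is stored at
-- position 2k + σ of the queue, and it marks (x , y) at position 2c + σ, where c
-- is the code of (x , y); so two searches (σ = 0, 1) can be kept at once.
markIndex : Exp → Exp → Exp
markIndex e f = cell e f ⊕ cell e f ⊕ reg rσ

-- Coloured arcs are not queued: the coloured set is closed under forcing already, so nothing new
-- lies behind them. A mark is valid only if it equals the current stamp, which lets a new search
-- begin without clearing the array.
push : Program
push =
  If aCol [ cell (reg rp) (reg rq) ] Then skip Else
  (If diff (aMark [ markIndex (reg rp) (reg rq) ]) (reg rstamp) Then
    (aMark [ markIndex (reg rp) (reg rq) ]≔ reg rstamp ⨾
     aQX [ reg rl ⊕ reg rl ⊕ reg rσ ]≔ reg rp ⨾
     aQY [ reg rl ⊕ reg rl ⊕ reg rσ ]≔ reg rq ⨾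
     rl ≔ reg rl ⊕ lit 1)
   Else skip)

pass : Exp → Exp → Program
pass e f = rp ≔ e ⨾ rq ≔ f

visitInto visitOut visit : Program
visitInto = If aS [ cell₃ x̂ ŷ ĵ ] Then (pass ĵ ŷ ⨾ push) Else skip
visitOut  = If aS [ cell₃ ĵ x̂ ŷ ] Then (pass x̂ ĵ ⨾ push) Else skip
visit = visitInto ⨾ visitOut

popFetch : Program
popFetch =
  rx ≔ aQX [ reg rh ⊕ reg rh ⊕ reg rσ ] ⨾
  ry ≔ aQY [ reg rh ⊕ reg rh ⊕ reg rσ ] ⨾
  rh ≔ reg rh ⊕ lit 1

pop : Program
pop = popFetch ⨾ For rj rn visit

-- The two searches start from opposite directions of one edge and share a stamp; their queues and
-- marks occupy the even and the odd positions. Exchanging the registers after each step makes them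
-- alternate.
start start′ exchange : Program
start =
  rstamp ≔ reg rstamp ⊕ lit 1 ⨾
  rh ≔ lit 0 ⨾ rl ≔ lit 1 ⨾ rσ ≔ lit 0 ⨾
  aMark [ markIndex (reg rsx) (reg rsy) ]≔ reg rstamp ⨾
  aQX [ lit 0 ]≔ reg rsx ⨾ aQY [ lit 0 ]≔ reg rsy
start′ =
  rh′ ≔ lit 0 ⨾ rl′ ≔ lit 1 ⨾ rσ′ ≔ lit 1 ⨾
  aMark [ cell (reg rsy) (reg rsx) ⊕ cell (reg rsy) (reg rsx) ⊕ lit 1 ]≔ reg rstamp ⨾
  aQX [ lit 1 ]≔ reg rsy ⨾ aQY [ lit 1 ]≔ reg rsx
exchange =
  rt ≔ reg rh ⨾ rh ≔ reg rh′ ⨾ rh′ ≔ t̂ ⨾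
  rt ≔ reg rl ⨾ rl ≔ reg rl′ ⨾ rl′ ≔ t̂ ⨾
  rt ≔ reg rσ ⨾ rσ ≔ reg rσ′ ⨾ rσ′ ≔ t̂

close lockstep adopt : Program
close    = While reg rl ⊖ reg rh Do pop
lockstep = While reg rl ⊖ reg rh Do (pop ⨾ exchange)
adopt    = While reg rh Do
  (rh ≔ reg rh ⊖ lit 1 ⨾
   aCol [ cell (aQX [ reg rh ⊕ reg rh ⊕ reg rσ ]) (aQY [ reg rh ⊕ reg rh ⊕ reg rσ ]) ]≔ lit 1)

fresh : Exp
fresh = aCol [ cell (reg rsx) (reg rsy) ] ⊕ aCol [ cell (reg rsy) (reg rsx) ]

-- Zero exactly when the current search has found both directions of the edge.
unmarkedEnds : Exp
unmarkedEnds = diff (aMark [ markIndex (reg rsx) (reg rsy) ]) (reg rstamp) ⊕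
               diff (aMark [ markIndex (reg rsy) (reg rsx) ]) (reg rstamp)

decide : Program
decide = If unmarkedEnds Then adopt Else (rans ≔ lit 0)

edgeEnds arcEnds : Program
edgeEnds = rsx ≔ aU [ reg ri ] ⨾ rsy ≔ aV [ reg ri ]
arcEnds  = rsx ≔ x̂ ⨾ rsy ≔ ŷ

assignEdge : Program
assignEdge =
  If reg rans Then
    (edgeEnds ⨾
     If fresh Then skip Else (start ⨾ start′ ⨾ lockstep ⨾ decide))
  Else skip

assign2SAT : Program
assign2SAT = For ri rm assignEdge

-- Zero exactly when x, y, j form a cyclic monolabel triangle, if the arc (x , y)
-- is coloured.
acyclicity : Exp
acyclicity = ((lit 1 ⊖ aCol [ cell ŷ ĵ ]) ⊕ (lit 1 ⊖ aCol [ cell ĵ x̂ ])) ⊕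
  (monoDefect (reg rz) x̂ ŷ ⊕ (monoDefect (reg rz) ŷ ĵ ⊕ monoDefect (reg rz) ĵ x̂))

coreTest : Program
coreTest = If acyclicity Then skip Else (rt ≔ lit 0)

coreInit core : Program
coreInit = rt ≔ aCol [ cell x̂ ŷ ] ⨾ rz ≔ α̂ x̂ ŷ
core = For ri rmm (fetch ⨾ coreInit ⨾ For rj rn coreTest ⨾ aCore [ cell x̂ ŷ ]≔ t̂)

reset : Program
reset = For ri rmm (fetch ⨾ aCol [ cell x̂ ŷ ]≔ lit 0)

-- A topological sort by repeated choice of a vertex without unranked core predecessor. Writing the
-- number of the round saves clearing `aBlk`, and a round needs O(m) apart from the searches.
-- Candidates are sources of arcs, so isolated vertices are never ranked.
blockBody pickBody blockHeads pick : Program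
blockBody = If aCore [ cell x̂ ŷ ] Then (If aRank [ x̂ ] Then skip Else (aBlk [ ŷ ]≔ reg rround)) Else skip
pickBody = If aRank [ x̂ ] Then skip Else
  (If diff (aBlk [ x̂ ]) (reg rround) Then (rfound ≔ lit 1 ⨾ rw ≔ x̂) Else skip)
blockHeads = For ri rmm (fetch ⨾ blockBody)
pick = For ri rmm (fetch ⨾ pickBody)

expandArc rankChosen expand : Program
expandArc = fetch ⨾ If diff x̂ (reg rw) Then skip Else
  (arcEnds ⨾ If fresh Then skip Else (start ⨾ close ⨾ adopt))
rankChosen = aRank [ reg rw ]≔ reg rround ⨾ rround ≔ reg rround ⊕ lit 1
expand = rankChosen ⨾ For ri rmm expandArc

round orient : Program
round = rfound ≔ lit 0 ⨾ blockHeads ⨾ pick ⨾ If reg rfound Then expand Else skip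
orient = (rround ≔ lit 1 ⨾ rfound ≔ lit 1) ⨾ While reg rfound Do round

outputBody output : Program
outputBody = aOut [ reg ri ]≔ lit 1 ⊖ aCol [ cell (aU [ reg ri ]) (aV [ reg ri ]) ]
output = For ri rm outputBody

-- Without edges the time bound is a constant, so even loops over the vertices have to be avoided in
-- that case.
constructMTTO : Program
constructMTTO =
  If m̂ Then
    (rows ⨾ listArcs ⨾ matrices ⨾ conflicts ⨾ rans ≔ lit 1 ⨾ assign2SAT ⨾
     If reg rans Then (core ⨾ reset ⨾ orient ⨾ output) Else skip)
  Else (rans ≔ lit 1)

-- Reading the input into lists of arcs, matrices and neighbour lists.

at-map-lookup : ∀ {X : Set} (f : X → ℕ) (xs : List X) (k : Fin (length xs)) → at (map f xs) (toℕ k) ≡ f (lookup xs k)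
at-map-lookup f (_ ∷ _)  Fin.zero    = refl
at-map-lookup f (_ ∷ xs) (Fin.suc k) = at-map-lookup f xs k

at-lo : ∀ S {ys} → S ≢ [] → at (S ++ ys) 0 ≡ lo S
at-lo [] S≢[] = ⊥-elim (S≢[] refl)
at-lo (_ ∷ _) _ = refl

at-hi : ∀ S {ys} → S ≢ [] → at (S ++ ys) (length S ∸ 1) ≡ hi S
at-hi [] S≢[] = ⊥-elim (S≢[] refl)
at-hi (_ ∷ []) _ = refl
at-hi (_ ∷ y ∷ S) _ = at-hi (y ∷ S) λ ()

double-write : ∀ {f g h : ℕ → ℕ} {m i a b v w} → i < m → a ≡ i → b ≡ m + i → v ≡ g i → w ≡ h i →
  (∀ j → j < i → f j ≡ g j × f (m + j) ≡ h j) →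
  ∀ j → j < suc i → update (update f a v) b w j ≡ g j × update (update f a v) b w (m + j) ≡ h j
double-write {f} {g} {h} {m} {i} {v = v} i<m refl refl refl refl old j (s≤s j≤i) with j ℕ.≟ i
... | yes refl =
  trans (update-there (update f i v) {m + i} (>⇒≢ (<-≤-trans i<m (m≤m+n m i)))) (update-here f {i} refl) , update-here (update f i v) {m + i} refl
... | no j≢i with j<i ← ≤∧≢⇒< j≤i j≢i | fj , fmj ← old j (≤∧≢⇒< j≤i j≢i) =
  trans (update-there (update f i v) {m + i} (>⇒≢ (<-≤-trans j<i (m≤n+m i m)))) (trans (update-there f {i} (≢-sym j≢i)) fj) ,
  trans (update-there (update f i v) {m + i} (λ eq → j≢i (sym (+-cancelˡ-≡ m i j eq)))) (trans (update-there f {i} (<⇒≢ (<-≤-trans i<m (m≤m+n m j)))) fmj)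

module Listing (𝒢 : TemporalGraph) (es : List (Arc 𝒢)) (es↭ : es ↭ edges 𝒢) where
  open TemporalGraph 𝒢
  open Intervals 𝒢
  open Codes n

  V A : Set
  V = Vertex 𝒢
  A = Arc 𝒢

  m : ℕ
  m = length es

  m≡#edges : m ≡ #edges 𝒢
  m≡#edges = ↭-length es↭

  _≟ᴬ_ : DecidableEquality A
  _≟ᴬ_ = ×-≡-dec Finₚ._≟_ Finₚ._≟_

  arcs : List A
  arcs = es ++ map swap es

  private
    edge? = λ ((u , v) : A) → (u Fin.<? v) ×-dec adj? u v
    pairs = cartesianProduct (allFin n) (allFin n)

  ∈es⁻ : ∀ {u v} → (u , v) ∈ₗ es → u Fin.< v × Adj u v
  ∈es⁻ e∈ = proj₂ (∈-filter⁻ edge? {xs = pairs} (∈-resp-↭ es↭ e∈))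

  ∈es⁺ : ∀ {u v} → u Fin.< v → Adj u v → (u , v) ∈ₗ es
  ∈es⁺ {u} {v} u<v uv = ∈-resp-↭ (↭-sym es↭)
    (∈-filter⁺ edge? (∈-cartesianProduct⁺ (∈-allFin u) (∈-allFin v)) (u<v , uv))

  es-unique : Unique es
  es-unique = Permₚ.AllPairs-resp-↭ (setoid A) ≢-sym (resp₂ _≢_) (↭⇒↭ₛ (↭-sym es↭))
    (Uniqueₚ.filter⁺ edge? (Uniqueₚ.cartesianProduct⁺ (Uniqueₚ.allFin⁺ n) (Uniqueₚ.allFin⁺ n)))

  ∈arcs⁻ : ∀ {x y} → (x , y) ∈ₗ arcs → Adj x y
  ∈arcs⁻ e∈ with ∈-++⁻ es e∈
  ... | inj₁ e∈es = proj₂ (∈es⁻ e∈es)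
  ... | inj₂ e∈ˢ with _ , ē∈ , refl ← ∈-map⁻ swap e∈ˢ = adj-sym (proj₂ (∈es⁻ ē∈))

  ∈arcs⁺ : ∀ {x y} → Adj x y → (x , y) ∈ₗ arcs
  ∈arcs⁺ {x} {y} xy with Finₚ.<-cmp x y
  ... | tri< x<y _ _ = ∈-++⁺ˡ (∈es⁺ x<y xy)
  ... | tri≈ _ refl _ = ⊥-elim (adj-irr refl xy)
  ... | tri> _ _ y<x = ∈-++⁺ʳ es (∈-map⁺ swap (∈es⁺ y<x (adj-sym xy)))

  arcs-unique : Unique arcs
  arcs-unique = Uniqueₚ.++⁺ es-unique (Uniqueₚ.map⁺ (λ { {_ , _} {_ , _} refl → refl }) es-unique)
    λ { {_ , _} (e∈ , e∈ˢ) → case ∈-map⁻ swap e∈ˢ of λ { (_ , ē∈ , refl) →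
      <-asym (proj₁ (∈es⁻ e∈)) (proj₁ (∈es⁻ ē∈)) } }

  length-arcs : length arcs ≡ m + m
  length-arcs = trans (Listₚ.length-++ es) (cong (m +_) (Listₚ.length-map swap es))

  αᴬ ωᴬ sourceᴬ targetᴬ : A → ℕ
  αᴬ (x , y) = α 𝒢 x y
  ωᴬ (x , y) = ω 𝒢 x y
  sourceᴬ (x , _) = toℕ x
  targetᴬ (_ , y) = toℕ y

  at-arcs : ∀ {f : ℕ → ℕ} {g h : A → ℕ} → (∀ e → h e ≡ g (swap e)) →
    (∀ j → j < m → f j ≡ at (map g es) j × f (m + j) ≡ at (map h es) j) →
    ∀ {pre e post} → arcs ≡ pre ++ e ∷ post → f (length pre) ≡ g e
  at-arcs {f} {g} {h} h≡ fm {pre} {e} {post} eq = trans (f-at (length pre) lt) (at-middle g pre eq)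
    where
    lt : length pre < m + m
    lt = subst (length pre <_) (trans (cong length (sym eq)) length-arcs)
      (subst (length pre <_) (sym (Listₚ.length-++-sucʳ pre e post)) (s≤s (Listₚ.length-++-≤ˡ pre)))
    swapped : ∀ xs → map h xs ≡ map g (map swap xs)
    swapped xs = trans (Listₚ.map-cong h≡ xs) (Listₚ.map-∘ xs)
    f-at : ∀ j → j < m + m → f j ≡ at (map g arcs) j
    f-at j j< with j ℕ.<? m
    ... | yes j<m = trans (proj₁ (fm j j<m)) (sym (trans (cong (λ ys → at ys j) (Listₚ.map-++ g es (map swap es)))
                      (at-++ˡ (map g es) (subst (j <_) (sym (Listₚ.length-map g es)) j<m))))
    ... | no  j≮m with k , refl ← m≤n⇒∃[o]m+o≡n (≮⇒≥ j≮m) =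
      trans (proj₂ (fm k (+-cancelˡ-< m k m j<)))
        (trans (cong (λ ys → at ys k) (swapped es))
        (sym (trans (cong₂ at (Listₚ.map-++ g es (map swap es)) (cong (_+ k) (sym (Listₚ.length-map g es)))) (at-++ʳ (map g es) k))))

  record Basic (s : State) : Set where
    field
      n≡  : regs s rn ≡ n
      m≡  : regs s rm ≡ m
      mm≡ : regs s rmm ≡ length arcs
      row : ∀ (x : V) → arrs s aR (toℕ x) ≡ n * toℕ x
      row₃ : ∀ (x : V) → arrs s aR₃ (toℕ x) ≡ n * n * toℕ x

    cell≡ : ∀ {i j} {x y : V} → i ≡ toℕ x → j ≡ toℕ y → arrs s aR i + j ≡ code x y
    cell≡ {x = x} refl refl = cong (_+ _) (row x)

    cell₃≡ : ∀ {i j k} {x y z : V} → i ≡ toℕ x → j ≡ toℕ y → k ≡ toℕ z →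
      arrs s aR₃ i + (arrs s aR j + k) ≡ code₃ x y z
    cell₃≡ {x = x} refl p q = cong₂ _+_ (row₃ x) (cell≡ p q)

  basic-keeps : ∀ {p s s′} → Keeps p s s′ → {AllRegs p (rn ∷ rm ∷ rmm ∷ [])} → {AllArrs p (aR ∷ aR₃ ∷ [])} → Basic s → Basic s′
  basic-keeps k {a , b , c , _} {d , e , _} bs = record
    { n≡ = trans (keep-reg k rn {a}) (Basic.n≡ bs) ; m≡ = trans (keep-reg k rm {b}) (Basic.m≡ bs)
    ; mm≡ = trans (keep-reg k rmm {c}) (Basic.mm≡ bs)
    ; row = λ x → trans (cong (λ f → f (toℕ x)) (keep-arr k aR {d})) (Basic.row bs x)
    ; row₃ = λ x → trans (cong (λ f → f (toℕ x)) (keep-arr k aR₃ {e})) (Basic.row₃ bs x) }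

  record Listed (s : State) : Set where
    field
      source : ∀ {pre e post} → arcs ≡ pre ++ e ∷ post → arrs s aX (length pre) ≡ sourceᴬ e
      target : ∀ {pre e post} → arcs ≡ pre ++ e ∷ post → arrs s aY (length pre) ≡ targetᴬ e

  listed-keeps : ∀ {p s s′} → Keeps p s s′ → {AllArrs p (aX ∷ aY ∷ [])} → Listed s → Listed s′
  listed-keeps k {a , b , _} l = record
    { source = λ eq → trans (cong (λ f → f _) (keep-arr k aX {a})) (Listed.source l eq)
    ; target = λ eq → trans (cong (λ f → f _) (keep-arr k aY {b})) (Listed.target l eq) }

  nb : V → List A → List V
  nb x es = map proj₂ (filter (λ e → proj₁ e Finₚ.≟ x) es)

  record Drawn (s : State) : Set where
    field
      α≡ : ∀ x y → arrs s aα (code x y) ≡ α 𝒢 x y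
      ω≡ : ∀ x y → arrs s aω (code x y) ≡ ω 𝒢 x y

  drawn-keeps : ∀ {p s s′} → Keeps p s s′ → {AllArrs p (aα ∷ aω ∷ [])} → Drawn s → Drawn s′
  drawn-keeps k {a , b , _} l = record
    { α≡ = λ x y → trans (cong (λ f → f _) (keep-arr k aα {a})) (Drawn.α≡ l x y)
    ; ω≡ = λ x y → trans (cong (λ f → f _) (keep-arr k aω {b})) (Drawn.ω≡ l x y) }

  record Neighbours (s : State) : Set where
    field
      deg≡ : ∀ x → arrs s aDeg (toℕ x) ≡ length (nb x arcs)
      nbr≡ : ∀ x k → k < length (nb x arcs) → arrs s aN (n * toℕ x + k) ≡ at (map toℕ (nb x arcs)) k

  neighbours-keeps : ∀ {p s s′} → Keeps p s s′ → {AllArrs p (aDeg ∷ aN ∷ [])} → Neighbours s → Neighbours s′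
  neighbours-keeps k {a , b , _} l = record
    { deg≡ = λ x → trans (cong (λ f → f _) (keep-arr k aDeg {a})) (Neighbours.deg≡ l x)
    ; nbr≡ = λ x i lt → trans (cong (λ f → f _) (keep-arr k aN {b})) (Neighbours.nbr≡ l x i lt) }

  s₀ : State
  s₀ = input 𝒢 es

  rows-cost : ℕ
  rows-cost = (n * (7 + 8) + 6) + (2 + (2 + ((n * (7 + 8) + 6) + 4)))

  rows-correct : ∀ {s} → regs s rn ≡ n → regs s rm ≡ m → regs s racc ≡ 0 → Does rows s (Within rows-cost Basic)
  rows-correct {s} n≡ m≡ acc≡ =
    for≤ 7 n≡ (λ i s → (∀ j → j < i → arrs s aR j ≡ n * j) × regs s racc ≡ n * i)
      (λ {i} {s} i<n ks ri≡ (rows , acc) → block (aR [ reg ri ]≔ reg racc ⨾ racc ≔ reg racc ⊕ n̂)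
        (≤-refl , extend n ri≡ acc rows ,
          trans (cong₂ _+_ acc (trans (keep-reg ks rn) n≡)) (trans (+-comm (n * i) n) (sym (*-suc n i)))))
      ((λ _ ()) , trans acc≡ (sym (*-zeroʳ n))) ▷ λ k₁ (rows , acc₁) →
    block (rnn ≔ reg racc) {Q = Within 2 (λ s′ → regs s′ rnn ≡ n * n × regs s′ rn ≡ n × regs s′ rm ≡ m × (∀ j → j < n → arrs s′ aR j ≡ n * j))}
      (≤-refl , acc₁ , trans (keep-reg k₁ rn) n≡ , trans (keep-reg k₁ rm) m≡ , rows) ▷ λ _ (nn≡ , n≡ , m≡ , rows) →
    block (racc ≔ lit 0) {Q = Within 2 (λ s′ → regs s′ racc ≡ 0 × regs s′ rnn ≡ n * n × regs s′ rn ≡ n × regs s′ rm ≡ m × (∀ j → j < n → arrs s′ aR j ≡ n * j))}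
      (≤-refl , refl , nn≡ , n≡ , m≡ , rows) ▷ λ { _ (acc , nn≡ , n≡ , m≡ , rows) →
    for≤ 7 n≡ (λ i s → (∀ j → j < i → arrs s aR₃ j ≡ n * n * j) × regs s racc ≡ n * n * i)
      (λ {i} {s} i<n ks ri≡ (rows , acc) → block (aR₃ [ reg ri ]≔ reg racc ⨾ racc ≔ reg racc ⊕ reg rnn)
        (≤-refl , extend (n * n) ri≡ acc rows ,
          trans (cong₂ _+_ acc (trans (keep-reg ks rnn) nn≡)) (trans (+-comm (n * n * i) (n * n)) (sym (*-suc (n * n) i)))))
      ((λ _ ()) , trans acc (sym (*-zeroʳ (n * n)))) ▷ λ k₂ (rows₃ , _) →
    block (rmm ≔ m̂ ⊕ m̂)
      (≤-refl , record
        { n≡ = trans (keep-reg k₂ rn) n≡ ; m≡ = trans (keep-reg k₂ rm) m≡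
        ; mm≡ = trans (cong (λ k → k + k) (trans (keep-reg k₂ rm) m≡)) (sym length-arcs)
        ; row = λ x → trans (cong (λ f → f (toℕ x)) (keep-arr k₂ aR)) (rows (toℕ x) (Finₚ.toℕ<n x))
        ; row₃ = λ x → rows₃ (toℕ x) (Finₚ.toℕ<n x) }) }
    where
    extend : ∀ {f : ℕ → ℕ} c {i a v} → a ≡ i → v ≡ c * i → (∀ j → j < i → f j ≡ c * j) →
      ∀ j → j < suc i → update f a v j ≡ c * j
    extend {f} _ {i = i} refl refl old j (s≤s j≤i) with i ℕ.≟ j
    ... | yes refl = refl
    ... | no i≢j = old j (≤∧≢⇒< j≤i (≢-sym i≢j))

  private
    lab : A → LabelSet
    lab (x , y) = label x y

  -- The offset of an edge is the total length of the label lists before it. Cutting the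
  -- concatenation there exposes the labels of this edge, of which the first and the last are read.
  label-extremes : ∀ {pre u v post} → es ≡ pre ++ (u , v) ∷ post →
    arrs s₀ aLab (arrs s₀ aOff (length pre)) + 1 ≡ α 𝒢 u v ×
    arrs s₀ aLab (arrs s₀ aOff (length pre + 1) ∸ 1) + 1 ≡ ω 𝒢 u v
  label-extremes {pre} {u} {v} {post} eq =
    trans (+-comm _ 1) (trans (cong suc first) (sym (α-adj uv))) ,
    trans (+-comm _ 1) (trans (cong suc final) (sym (ω-adj uv)))
    where
    uv : Adj u v
    uv = proj₂ (∈es⁻ (∈-middle pre eq))
    S = label u v
    P = concat (map lab pre)
    Q = concat (map lab post)
    ls = labelSets 𝒢 es
    ls≡ : ls ≡ map lab pre ++ S ∷ map lab post
    ls≡ = trans (cong (map lab) eq) (Listₚ.map-++ lab pre _)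
    concat≡ : concat ls ≡ P ++ (S ++ Q)
    concat≡ = trans (cong concat ls≡) (sym (Listₚ.concat-++ (map lab pre) (S ∷ map lab post)))
    take≡ : ∀ (xs : List A) {y zs} → take (length xs) (map lab xs ++ y ∷ zs) ≡ map lab xs
    take≡ []       = refl
    take≡ (_ ∷ xs) = cong (_ ∷_) (take≡ xs)
    take≡′ : ∀ (xs : List A) {y zs} → take (length xs + 1) (map lab xs ++ y ∷ zs) ≡ map lab xs ++ (y ∷ [])
    take≡′ []       = refl
    take≡′ (_ ∷ xs) = cong (_ ∷_) (take≡′ xs)
    off : length (concat (take (length pre) ls)) ≡ length P
    off = cong (length ∘ concat) (trans (cong (take (length pre)) ls≡) (take≡ pre))
    off′ : length (concat (take (length pre + 1) ls)) ≡ length P + length S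
    off′ = trans (cong (length ∘ concat) (trans (cong (take (length pre + 1)) ls≡) (take≡′ pre)))
      (trans (cong length (trans (sym (Listₚ.concat-++ (map lab pre) (S ∷ []))) (cong (P ++_) (Listₚ.++-identityʳ S)))) (Listₚ.length-++ P))
    first : at (concat ls) (length (concat (take (length pre) ls))) ≡ lo S
    first = trans (cong₂ at concat≡ (trans off (sym (+-identityʳ (length P))))) (trans (at-++ʳ P 0) (at-lo S (label-nonempty uv)))
    positive : ∀ T → T ≢ [] → 1 ≤ length T
    positive [] ne = ⊥-elim (ne refl)
    positive (_ ∷ _) _ = s≤s z≤n
    final : at (concat ls) (length (concat (take (length pre + 1) ls)) ∸ 1) ≡ hi S
    final = trans (cong₂ at concat≡ (trans (cong (_∸ 1) off′) (+-∸-assoc (length P) (positive S (label-nonempty uv)))))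
      (trans (at-++ʳ P (length S ∸ 1)) (at-hi S (label-nonempty uv)))

  private
    Both : (f : ℕ → ℕ) (g h : A → ℕ) → ℕ → Set
    Both f g h i = ∀ j → j < i → f j ≡ at (map g es) j × f (m + j) ≡ at (map h es) j

  record ArcData (s : State) : Set where
    field
      listed : Listed s
      earliest : ∀ {pre e post} → arcs ≡ pre ++ e ∷ post → arrs s aLo (length pre) ≡ αᴬ e
      latest : ∀ {pre e post} → arcs ≡ pre ++ e ∷ post → arrs s aHi (length pre) ≡ ωᴬ e

  record Input (s : State) : Set where
    field
      U≡ : arrs s aU ≡ arrs s₀ aU
      V≡ : arrs s aV ≡ arrs s₀ aV
      Off≡ : arrs s aOff ≡ arrs s₀ aOff
      Lab≡ : arrs s aLab ≡ arrs s₀ aLab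

  input-keeps : ∀ {p s s′} → Keeps p s s′ → {AllArrs p (aU ∷ aV ∷ aOff ∷ aLab ∷ [])} → Input s → Input s′
  input-keeps k {a , b , c , d , _} i = record
    { U≡ = trans (keep-arr k aU {a}) (Input.U≡ i) ; V≡ = trans (keep-arr k aV {b}) (Input.V≡ i)
    ; Off≡ = trans (keep-arr k aOff {c}) (Input.Off≡ i) ; Lab≡ = trans (keep-arr k aLab {d}) (Input.Lab≡ i) }

  listArcs-correct : ∀ {s} → Basic s → Input s → Does listArcs s (Within (m * (cost listArcsBody + 8) + 6) ArcData)
  listArcs-correct {s} bs inp = mapDoes (λ { _ (le , bX , bY , bLo , bHi) → le , record
      { listed = record { source = at-arcs (λ _ → refl) bX ; target = at-arcs (λ _ → refl) bY }
      ; earliest = at-arcs (λ (x , y) → α-sym x y) bLo ; latest = at-arcs (λ (x , y) → ω-sym x y) bHi } })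
    (for≤ (cost listArcsBody) (Basic.m≡ bs)
      (λ i s → Both (arrs s aX) sourceᴬ targetᴬ i × Both (arrs s aY) targetᴬ sourceᴬ i ×
               Both (arrs s aLo) αᴬ αᴬ i × Both (arrs s aHi) ωᴬ ωᴬ i)
      (λ {i} {s′} i<m ks ri≡ (bX , bY , bLo , bHi) → block listArcsBody
        (let open Entry ks i<m ri≡ in ≤-refl ,
          double-write i<m ri≡ mi≡ U≡ V≡ bX , double-write i<m ri≡ mi≡ V≡ U≡ bY ,
          double-write i<m ri≡ mi≡ lo≡ lo≡ bLo , double-write i<m ri≡ mi≡ hi≡ hi≡ bHi))
      ((λ _ ()) , (λ _ ()) , (λ _ ()) , (λ _ ())))
    where
    module Entry {i s′} (ks : Keeps listArcs s s′) (i<m : i < m) (ri≡ : regs s′ ri ≡ i) where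
      inp′ : Input s′
      inp′ = input-keeps ks inp
      mi≡ : regs s′ rm + regs s′ ri ≡ m + i
      mi≡ = cong₂ _+_ (trans (keep-reg ks rm) (Basic.m≡ bs)) ri≡
      U≡ : arrs s′ aU (regs s′ ri) ≡ at (map sourceᴬ es) i
      U≡ = cong₂ (λ f → f) (Input.U≡ inp′) ri≡
      V≡ : arrs s′ aV (regs s′ ri) ≡ at (map targetᴬ es) i
      V≡ = cong₂ (λ f → f) (Input.V≡ inp′) ri≡
      Off≡ : ∀ {k l} → k ≡ l → arrs s′ aOff k ≡ arrs s₀ aOff l
      Off≡ = cong₂ (λ f → f) (Input.Off≡ inp′)
      Lab≡ : ∀ {k l} → k ≡ l → arrs s′ aLab k ≡ arrs s₀ aLab l
      Lab≡ = cong₂ (λ f → f) (Input.Lab≡ inp′)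
      extremes : arrs s₀ aLab (arrs s₀ aOff i) + 1 ≡ at (map αᴬ es) i ×
                 arrs s₀ aLab (arrs s₀ aOff (i + 1) ∸ 1) + 1 ≡ at (map ωᴬ es) i
      extremes with split {pre} eq refl _ _ ← split-at es i<m =
        trans (proj₁ (label-extremes eq)) (sym (at-middle αᴬ pre eq)) ,
        trans (proj₂ (label-extremes eq)) (sym (at-middle ωᴬ pre eq))
      lo≡ : arrs s′ aLab (arrs s′ aOff (regs s′ ri)) + 1 ≡ at (map αᴬ es) i
      lo≡ = trans (cong (_+ 1) (Lab≡ (Off≡ ri≡))) (proj₁ extremes)
      hi≡ : arrs s′ aLab (arrs s′ aOff (regs s′ ri + 1) ∸ 1) + 1 ≡ at (map ωᴬ es) i
      hi≡ = trans (cong (_+ 1) (Lab≡ (cong (_∸ 1) (Off≡ (cong (_+ 1) ri≡))))) (proj₂ extremes)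

  fetched : ∀ {s pre e post} → Listed s → arcs ≡ pre ++ e ∷ post → regs s ri ≡ length pre →
    Does fetch s (Within 6 (λ s′ → regs s′ rx ≡ sourceᴬ e × regs s′ ry ≡ targetᴬ e))
  fetched {s} l eq ri≡ = block fetch (≤-refl ,
    trans (cong (arrs s aX) ri≡) (Listed.source l eq) , trans (cong (arrs s aY) ri≡) (Listed.target l eq))

  nb-∷ʳ-≡ : ∀ x pre {y} → nb x (pre ∷ʳ (x , y)) ≡ nb x pre ∷ʳ y
  nb-∷ʳ-≡ x [] with x Finₚ.≟ x
  ... | yes _ = refl
  ... | no ne = ⊥-elim (ne refl)
  nb-∷ʳ-≡ x ((u , v) ∷ pre) with u Finₚ.≟ x
  ... | yes _ = cong (v ∷_) (nb-∷ʳ-≡ x pre)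
  ... | no _  = nb-∷ʳ-≡ x pre

  nb-∷ʳ-≢ : ∀ x pre {u v} → u ≢ x → nb x (pre ∷ʳ (u , v)) ≡ nb x pre
  nb-∷ʳ-≢ x [] {u} u≢x with u Finₚ.≟ x
  ... | yes u≡x = ⊥-elim (u≢x u≡x)
  ... | no _ = refl
  nb-∷ʳ-≢ x ((u , v) ∷ pre) u≢x with u Finₚ.≟ x
  ... | yes _ = cong (v ∷_) (nb-∷ʳ-≢ x pre u≢x)
  ... | no _  = nb-∷ʳ-≢ x pre u≢x

  ∈nb⁺ : ∀ {x y xs} → (x , y) ∈ₗ xs → y ∈ₗ nb x xs
  ∈nb⁺ {x} e∈ = ∈-map⁺ proj₂ (∈-filter⁺ (λ e → proj₁ e Finₚ.≟ x) e∈ refl)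

  ∈nb⁻ : ∀ {x y xs} → y ∈ₗ nb x xs → (x , y) ∈ₗ xs
  ∈nb⁻ {x} {xs = xs} y∈ with (u , v) , e∈ , refl ← ∈-map⁻ proj₂ y∈
                        with e∈′ , refl ← ∈-filter⁻ (λ e → proj₁ e Finₚ.≟ x) {xs = xs} e∈ = e∈′

  nb-unique : ∀ x {xs} → Unique xs → Unique (nb x xs)
  nb-unique x [] = []
  nb-unique x {(u , v) ∷ xs} (v∉ ∷ un) with u Finₚ.≟ x
  ... | yes refl = All.tabulate (λ y∈ → λ { refl → All.lookup v∉ (∈nb⁻ y∈) refl }) ∷ nb-unique x un
  ... | no _     = nb-unique x un

  -- Neighbours in a list without repeated arcs are distinct. The bound keeps every neighbour list
  -- within its row of `aN`, so that writing one row leaves the others intact.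
  nb-length : ∀ x {pre} post → arcs ≡ pre ++ post → length (nb x pre) ≤ n
  nb-length x {pre} post eq = ≤-trans
    (unique-⊆-length (nb-unique x (prefix-unique pre (subst Unique eq arcs-unique))) (λ {y} _ → ∈-allFin y))
    (≤-reflexive (Listₚ.length-tabulate {n = n} (λ i → i)))
    where
    prefix-unique : ∀ xs {ys : List A} → Unique (xs ++ ys) → Unique xs
    prefix-unique [] _ = []
    prefix-unique (x ∷ xs) (x∉ ∷ un) = All.tabulate (λ y∈ → All.lookup x∉ (∈-++⁺ˡ y∈)) ∷ prefix-unique xs un

  deg-bound : ∀ x → length (nb x arcs) ≤ n
  deg-bound x = nb-length x [] (sym (Listₚ.++-identityʳ arcs))

  private
    -- An entry not yet written is 0. The pairs never written are the non-edges, for which 0 is the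
    -- correct value of `α` and `ω`; thus the zeroed memory serves as initialisation.
    Filled : (ℕ → ℕ) → (A → ℕ) → List A → Set
    Filled f g pre = ∀ x y → f (code x y) ≡ g (x , y) ⊎ (f (code x y) ≡ 0 × (x , y) ∉ₗ pre)

    filled-step : ∀ f {g pre i v e} → i ≡ code (proj₁ e) (proj₂ e) → v ≡ g e → Filled f g pre → Filled (update f i v) g (pre ∷ʳ e)
    filled-step f {g} {e = u , v} refl refl old x y with code u v ℕ.≟ code x y
    ... | yes eq with refl , refl ← code-injective eq = inj₁ refl
    ... | no ne with old x y
    ...   | inj₁ eq = inj₁ eq
    ...   | inj₂ (eq , ∉) = inj₂ (eq , λ e∈ → [ ∉ , (λ { refl → ne refl }) ]′ (∈-∷ʳ⁻ e∈))

    filled-arcs : ∀ f g → (∀ {x y} → ¬ Adj x y → g (x , y) ≡ 0) → Filled f g arcs → ∀ x y → f (code x y) ≡ g (x , y)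
    filled-arcs f g g≡0 fl x y with fl x y
    ... | inj₁ eq = eq
    ... | inj₂ (eq , ∉) = trans eq (sym (g≡0 (∉ ∘ ∈arcs⁺)))

    Adjacent : (f g : ℕ → ℕ) → List A → Set
    Adjacent f g pre = ∀ x → f (toℕ x) ≡ length (nb x pre) ×
      (∀ k → k < length (nb x pre) → g (n * toℕ x + k) ≡ at (map toℕ (nb x pre)) k)

    adjacent-step : ∀ f g {pre post u v i j d w} → arcs ≡ pre ++ (u , v) ∷ post →
      i ≡ toℕ u → j ≡ n * toℕ u + f (toℕ u) → w ≡ toℕ v → d ≡ suc (f (toℕ u)) → Adjacent f g pre →
      Adjacent (update f i d) (update g j w) (pre ∷ʳ (u , v))
    adjacent-step f g {pre} {post} {u} {v} eq refl refl refl refl old x with u Finₚ.≟ x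
    ... | yes refl rewrite nb-∷ʳ-≡ u pre {v} =
      trans (update-here f {toℕ u} refl) (trans (cong suc (proj₁ (old u))) (sym length-snoc)) , entries
      where
      l = length (nb u pre)
      length-snoc : length (nb u pre ∷ʳ v) ≡ suc l
      length-snoc = trans (Listₚ.length-++ (nb u pre)) (+-comm l 1)
      map-snoc : map toℕ (nb u pre ∷ʳ v) ≡ map toℕ (nb u pre) ++ toℕ v ∷ []
      map-snoc = Listₚ.map-++ toℕ (nb u pre) (v ∷ [])
      entries : ∀ k → k < length (nb u pre ∷ʳ v) → update g (n * toℕ u + f (toℕ u)) (toℕ v) (n * toℕ u + k) ≡ at (map toℕ (nb u pre ∷ʳ v)) k
      entries k k< with k ℕ.≟ l
      ... | yes refl = trans (update-here g (cong (n * toℕ u +_) (proj₁ (old u))))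
          (sym (trans (cong₂ at map-snoc (trans (sym (+-identityʳ l)) (cong (_+ 0) (sym (Listₚ.length-map toℕ (nb u pre))))))
            (at-++ʳ (map toℕ (nb u pre)) 0)))
      ... | no k≢l = trans (update-there g (λ eq → k≢l (trans (sym (+-cancelˡ-≡ (n * toℕ u) _ _ eq)) (proj₁ (old u)))))
          (trans (proj₂ (old u) k k<l) (sym (trans (cong (λ ys → at ys k) map-snoc)
            (at-++ˡ (map toℕ (nb u pre)) (subst (k <_) (sym (Listₚ.length-map toℕ (nb u pre))) k<l)))))
        where
        k<l : k < l
        k<l = ≤∧≢⇒< (s≤s⁻¹ (subst (k <_) length-snoc k<)) k≢l
    ... | no u≢x rewrite nb-∷ʳ-≢ x pre {u} {v} u≢x =
      trans (update-there f (u≢x ∘ Finₚ.toℕ-injective)) (proj₁ (old x)) ,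
      λ k k< → trans (update-there g (λ eq → u≢x (proj₁ (injective _ _ u-bound (<-≤-trans k< (nb-length x ((u , v) ∷ post) eq₀)) eq)))) (proj₂ (old x) k k<)
      where
      eq₀ = eq
      injective : ∀ {x y : V} i j → i < n → j < n → n * toℕ x + i ≡ n * toℕ y + j → x ≡ y × i ≡ j
      injective {x} {y} i j i<n j<n eq
        with p , q ← code-injective {x} {fromℕ< i<n} {y} {fromℕ< j<n}
                (subst₂ (λ k l → n * toℕ x + k ≡ n * toℕ y + l) (sym (Finₚ.toℕ-fromℕ< i<n)) (sym (Finₚ.toℕ-fromℕ< j<n)) eq)
        = p , trans (sym (Finₚ.toℕ-fromℕ< i<n)) (trans (cong toℕ q) (Finₚ.toℕ-fromℕ< j<n))
      u-bound : f (toℕ u) < n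
      u-bound = subst (_≤ n) (trans (cong length (nb-∷ʳ-≡ u pre {v})) (trans (Listₚ.length-++ (nb u pre)) (trans (+-comm _ 1) (cong suc (sym (proj₁ (old u)))))))
        (nb-length u post (trans eq (sym (Listₚ.++-assoc pre ((u , v) ∷ []) post))))

  record Empty (s : State) : Set where
    field
      α₀ : ∀ k → arrs s aα k ≡ 0
      ω₀ : ∀ k → arrs s aω k ≡ 0
      deg₀ : ∀ k → arrs s aDeg k ≡ 0

  matrices-correct : ∀ {s} → Basic s → ArcData s → Empty s →
    Does matrices s (Within (length arcs * (6 + cost matricesBody + 8) + 6) (λ s′ → Drawn s′ × Neighbours s′))
  matrices-correct {s} bs ad emp = mapDoes (λ { {s′} _ (le , fα , fω , adj) → le ,
      record { α≡ = filled-arcs (arrs s′ aα) αᴬ α-nonadj fα ; ω≡ = filled-arcs (arrs s′ aω) ωᴬ ω-nonadj fω } ,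
      record { deg≡ = λ x → proj₁ (adj x) ; nbr≡ = λ x → proj₂ (adj x) } })
    (forList≤ arcs (6 + cost matricesBody) (Basic.mm≡ bs)
      (λ pre s → Filled (arrs s aα) αᴬ pre × Filled (arrs s aω) ωᴬ pre × Adjacent (arrs s aDeg) (arrs s aN) pre)
      (λ {pre} {e} {post} {s′} eq ks ri≡ (fα , fω , adj) →
        fetched (listed-keeps ks (ArcData.listed ad)) eq ri≡ ▷ λ {s″} ks″ (x≡ , y≡) →
        let bs″ : Basic s″
            bs″ = basic-keeps ks″ (basic-keeps ks bs)
            ri″ : regs s″ ri ≡ length pre
            ri″ = trans (keep-reg ks″ ri) ri≡
            lo≡ : arrs s″ aLo (regs s″ ri) ≡ αᴬ e
            lo≡ = trans (cong₂ (λ f k → f k) (trans (keep-arr ks″ aLo) (keep-arr ks aLo)) ri″) (ArcData.earliest ad eq)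
            hi≡ : arrs s″ aHi (regs s″ ri) ≡ ωᴬ e
            hi≡ = trans (cong₂ (λ f k → f k) (trans (keep-arr ks″ aHi) (keep-arr ks aHi)) ri″) (ArcData.latest ad eq)
            fα″ : Filled (arrs s″ aα) αᴬ pre
            fα″ = subst (λ f → Filled f αᴬ pre) (sym (keep-arr ks″ aα)) fα
            fω″ : Filled (arrs s″ aω) ωᴬ pre
            fω″ = subst (λ f → Filled f ωᴬ pre) (sym (keep-arr ks″ aω)) fω
            adj″ : Adjacent (arrs s″ aDeg) (arrs s″ aN) pre
            adj″ = subst₂ (λ f g → Adjacent f g pre) (sym (keep-arr ks″ aDeg)) (sym (keep-arr ks″ aN)) adj
        in block matricesBody (≤-refl ,
          filled-step (arrs s″ aα) (Basic.cell≡ bs″ x≡ y≡) lo≡ fα″ ,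
          filled-step (arrs s″ aω) (Basic.cell≡ bs″ x≡ y≡) hi≡ fω″ ,
          adjacent-step (arrs s″ aDeg) (arrs s″ aN) eq x≡
            (cong₂ _+_ (trans (cong (arrs s″ aR) x≡) (Basic.row bs″ (proj₁ e))) (cong (arrs s″ aDeg) x≡))
            y≡ (trans (cong (λ k → arrs s″ aDeg k + 1) x≡) (+-comm _ 1)) adj″))
      ((λ x y → inj₂ (Empty.α₀ emp _ , λ ())) , (λ x y → inj₂ (Empty.ω₀ emp _ , λ ())) ,
       (λ x → Empty.deg₀ emp _ , λ _ ())))

-- The table of conflicts and the time to fill it.

sum-∷ʳ : ∀ {X : Set} (f : X → ℕ) xs x → sum (map f (xs ∷ʳ x)) ≡ sum (map f xs) + f x
sum-∷ʳ f [] x = +-identityʳ (f x)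
sum-∷ʳ f (y ∷ xs) x = trans (cong (f y +_) (sum-∷ʳ f xs x)) (sym (+-assoc (f y) _ _))

length-∷ʳ : ∀ {X : Set} (xs : List X) x → length (xs ∷ʳ x) ≡ suc (length xs)
length-∷ʳ xs x = trans (Listₚ.length-++ xs) (+-comm (length xs) 1)

private
  regroup-sum : ∀ L S w c u → (L * c + S * u) + (c + w * u) ≡ suc L * c + (S + w) * u
  regroup-sum = solve-∀

  shift : ∀ p q k → p + q + k ≡ (p + k) + q
  shift = solve-∀

  regroup : ∀ p q → 6 + (6 + (p + q + 6)) + 8 ≡ (p + 26) + q
  regroup p q = trans (cong (λ k → 6 + (6 + k) + 8) (shift p q 6))
    (trans (shift (12 + (p + 6)) q 8) (cong (_+ q) (trans (cong (_+ 8) (sym (+-assoc 12 p 6))) (trans (+-assoc (12 + p) 6 8) (trans (cong (_+ 14) (+-comm 12 p)) (+-assoc p 12 14))))))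

opaque
  reorder-arc : ∀ p q {t} → t ≤ 6 + (6 + (p + q + 6)) → t + 8 ≤ (p + 26) + q
  reorder-arc p q le = ≤-trans (+-monoˡ-≤ 8 le) (≤-reflexive (regroup p q))

  reorder-row : ∀ p q {t} → t ≤ p + q → t + 8 ≤ (p + 8) + q
  reorder-row p q le = ≤-trans (+-monoˡ-≤ 8 le) (≤-reflexive (shift p q 8))

-- Bookkeeping for loops whose rounds differ in cost: c units per element, and u units per unit of
-- the weight f. The weights are the numbers of scanned neighbours.
accumulate : ∀ {X : Set} (f : X → ℕ) pre x c u {τ t} →
  τ ≤ length pre * c + sum (map f pre) * u → t ≤ c + f x * u →
  τ + t ≤ length (pre ∷ʳ x) * c + sum (map f (pre ∷ʳ x)) * u
accumulate f pre x c u {τ} {t} le le′ = begin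
  τ + t                                       ≤⟨ +-mono-≤ le le′ ⟩
  (L * c + S * u) + (c + f x * u)             ≡⟨ regroup-sum L S (f x) c u ⟩
  suc L * c + (S + f x) * u                   ≡⟨ cong₂ (λ k l → k * c + l * u) (length-∷ʳ pre x) (sum-∷ʳ f pre x) ⟨
  length (pre ∷ʳ x) * c + sum (map f (pre ∷ʳ x)) * u ∎
  where
  open ≤-Reasoning
  L = length pre
  S = sum (map f pre)

Grows : (f g : ℕ → ℕ) → Set
Grows f g = ∀ k → f k ≢ 0 → g k ≢ 0

grows-update : ∀ f {i} → Grows f (update f i 1)
grows-update f {i} k ne with i ℕ.≟ k
... | yes _ = λ ()
... | no _  = ne

module ConflictTable (𝒢 : TemporalGraph) (es : List (Arc 𝒢)) (es↭ : es ↭ edges 𝒢) where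
  open TemporalGraph 𝒢
  open Intervals 𝒢
  open Codes n
  open Listing 𝒢 es es↭

  private
    a b : V → V → ℕ
    a = α 𝒢
    b = ω 𝒢

  allFin-middle : ∀ pre {z post} → allFin n ≡ pre ++ z ∷ post → toℕ z ≡ length pre
  allFin-middle pre {z} {post} eq = trans (sym (at-middle toℕ pre eq)) (tabulated id 0 (λ _ → refl) (length pre) lt)
    where
    lt : length pre < n
    lt = subst (length pre <_) (trans (cong length (sym eq)) (Listₚ.length-tabulate {n = n} (λ i → i)))
      (subst (length pre <_) (sym (Listₚ.length-++-sucʳ pre z post)) (s≤s (Listₚ.length-++-≤ˡ pre)))
    tabulated : ∀ {k} (f : Fin k → V) c → (∀ i → toℕ (f i) ≡ c + toℕ i) → ∀ j → j < k →
      at (map toℕ (tabulate f)) j ≡ c + j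
    tabulated {suc k} f c f≡ zero _ = f≡ Fin.zero
    tabulated {suc k} f c f≡ (suc j) (s≤s lt) = trans (tabulated (f ∘ Fin.suc) (suc c) (λ i → trans (f≡ (Fin.suc i)) (+-suc c (toℕ i))) j lt) (sym (+-suc c j))

  forVertices : ∀ {r p s₀} → regs s₀ rn ≡ n → {T (keepsReg (For r rn p) rn)} → {T (keepsReg p r)} →
    (I : List V → Post) →
    (∀ {pre z post s τ} → allFin n ≡ pre ++ z ∷ post → Keeps (For r rn p) s₀ s → regs s r ≡ toℕ z → I pre s τ →
      Does p s (λ s′ t → I (pre ∷ʳ z) (setReg s′ r (suc (length pre))) (τ + (t + 8)))) →
    I [] (setReg s₀ r 0) 0 → Does (For r rn p) s₀ (λ s′ t → ∃[ τ ] t ≡ τ + 6 × I (allFin n) s′ τ)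
  forVertices n≡ {k} {k′} I step = forList (allFin n) (trans n≡ (sym (Listₚ.length-tabulate {n = n} id))) {k} {k′} I
    λ {pre} eq ks r≡ → step eq ks (trans r≡ (sym (allFin-middle pre eq)))

  forVertices≤ : ∀ {r p s₀} B → regs s₀ rn ≡ n → {T (keepsReg (For r rn p) rn)} → {T (keepsReg p r)} →
    (I : List V → State → Set) →
    (∀ {pre z post s} → allFin n ≡ pre ++ z ∷ post → Keeps (For r rn p) s₀ s → regs s r ≡ toℕ z → I pre s →
      Does p s (Within B (λ s′ → I (pre ∷ʳ z) (setReg s′ r (suc (length pre)))))) →
    I [] (setReg s₀ r 0) → Does (For r rn p) s₀ (Within (n * (B + 8) + 6) (I (allFin n)))
  forVertices≤ {r} {p} {s₀} B n≡ {k} {k′} I step init =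
    subst (λ l → Does (For r rn p) s₀ (Within (l * (B + 8) + 6) (I (allFin n)))) (Listₚ.length-tabulate {n = n} id)
      (forList≤ (allFin n) B (trans n≡ (sym (Listₚ.length-tabulate {n = n} id))) {k} {k′} I
        (λ {pre} eq ks r≡ → step eq ks (trans r≡ (sym (allFin-middle pre eq)))) init)

  Sound : (ℕ → ℕ) → Set
  Sound f = ∀ x y z → f (code₃ x y z) ≢ 0 → Conflict x y z

  sound-update : ∀ f {i x y z} → i ≡ code₃ x y z → Conflict x y z → Sound f → Sound (update f i 1)
  sound-update f {x = x} {y} {z} refl c sound x′ y′ z′ with code₃ x y z ℕ.≟ code₃ x′ y′ z′
  ... | no _ = sound x′ y′ z′
  ... | yes eq with refl , refl , refl ← code₃-injective eq = λ _ → c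

  record Place (j x y : V) (s : State) : Set where
    constructor place
    field
      j≡ : regs s rj ≡ toℕ j
      x≡ : regs s rx ≡ toℕ x
      y≡ : regs s ry ≡ toℕ y
      t≡ : regs s rt ≡ a x y

  place-keeps : ∀ {p s s′ j x y} → Keeps p s s′ → {AllRegs p (rj ∷ rx ∷ ry ∷ rt ∷ [])} → Place j x y s → Place j x y s′
  place-keeps k {k₁ , k₂ , k₃ , k₄ , _} (place p q r t) = place (trans (keep-reg k rj {k₁}) p)
    (trans (keep-reg k rx {k₂}) q) (trans (keep-reg k ry {k₃}) r) (trans (keep-reg k rt {k₄}) t)

  α̂≡ : ∀ {s i k u v} → Basic s → Drawn s → i ≡ toℕ u → k ≡ toℕ v → arrs s aα (arrs s aR i + k) ≡ a u v
  α̂≡ {s} {u = u} {v} bs dr p q = trans (cong (arrs s aα) (Basic.cell≡ bs p q)) (Drawn.α≡ dr u v)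

  ω̂≡ : ∀ {s i k u v} → Basic s → Drawn s → i ≡ toℕ u → k ≡ toℕ v → arrs s aω (arrs s aR i + k) ≡ b u v
  ω̂≡ {s} {u = u} {v} bs dr p q = trans (cong (arrs s aω) (Basic.cell≡ bs p q)) (Drawn.ω≡ dr u v)

  defect : ℕ → V → V → ℕ
  defect t u v = ((a u v ∸ t) + (t ∸ a u v)) + ((b u v ∸ t) + (t ∸ b u v))

  defect≡ : ∀ {s i k u v t t′} → Basic s → Drawn s → i ≡ toℕ u → k ≡ toℕ v → t ≡ t′ →
    let α′ = arrs s aα (arrs s aR i + k) ; ω′ = arrs s aω (arrs s aR i + k) in
    ((α′ ∸ t) + (t ∸ α′)) + ((ω′ ∸ t) + (t ∸ ω′)) ≡ defect t′ u v
  defect≡ {t = t} bs dr p q refl = cong₂ _+_ (cong (λ v → (v ∸ t) + (t ∸ v)) (α̂≡ bs dr p q)) (cong (λ v → (v ∸ t) + (t ∸ v)) (ω̂≡ bs dr p q))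

  defect⇒mono : ∀ {t u v} → defect t u v ≡ 0 → Mono t u v
  defect⇒mono {t} {u} {v} eq = mono (≡-diff (m+n≡0⇒m≡0 _ eq)) (≡-diff (m+n≡0⇒n≡0 ((a u v ∸ t) + (t ∸ a u v)) eq))

  mono⇒defect : ∀ {t u v} → Mono t u v → defect t u v ≡ 0
  mono⇒defect (mono p q) = cong₂ _+_ (diff-≡ p) (diff-≡ q)

  private
    +≡0 : ∀ {i j k l} → i ≡ k → j ≡ l → k ≡ 0 → l ≡ 0 → i + j ≡ 0
    +≡0 refl refl refl refl = refl

  record Defect (j x y w : V) : Set where
    constructor defective
    field
      jw≤ : a j w ≤ a x y
      xw> : a x y < a x w
      yw< : a y w < a x y

  All-Mono : (j x y : V) → Set
  All-Mono j x y = Mono (a x y) j x × Mono (a x y) x y × Mono (a x y) j y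

  defective⇒conflict : ∀ {j x y w} → All-Mono j x y → Adj j w → Defect j x y w → Conflict j x y
  defective⇒conflict (jx , xy , jy) jw d = correlated record
    { xy = mono-sym jy ; yz = jx ; xz = mono-sym xy ; yw>0 = adj⇒α>0 jw
    ; yw≤ = Defect.jw≤ d ; zw> = Defect.xw> d ; xw< = Defect.yw< d }

  private
    Progress : (V → V → V → Set) → V → V → V → (ℕ → ℕ) → (ℕ → ℕ) → Set
    Progress P j x y f g = Sound g × Grows f g × (P j x y → g (code₃ j x y) ≢ 0)

  scanNeighbour-correct : ∀ {s j x y pre w post} → Basic s → Drawn s → Neighbours s → Place j x y s → All-Mono j x y →
    nb j arcs ≡ pre ++ w ∷ post → regs s rk ≡ length pre → Sound (arrs s aS) →
    Does scanNeighbour s (Within (cost scanNeighbour) (λ s′ → Progress (λ j x y → Defect j x y w) j x y (arrs s aS) (arrs s′ aS)))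
  scanNeighbour-correct {s} {j} {x} {y} {pre} {w} {post} bs dr ns pl monos eq k≡ sound =
    block (rz ≔ aN [ cell ĵ (reg rk) ]) {Q = Within (cost (rz ≔ aN [ cell ĵ (reg rk) ])) (λ s′ → regs s′ rz ≡ toℕ w × arrs s′ aS ≡ arrs s aS)}
      (≤-refl , z≡ , refl) ▷ λ {s′} ks (z≡ , S≡) →
    let bs′ = basic-keeps ks bs ; dr′ = drawn-keeps ks dr ; pl′ = place-keeps ks pl
        open Place pl′
        test = (α̂ ĵ ẑ ⊖ t̂) ⊕ ((t̂ ⊕ lit 1) ⊖ α̂ x̂ ẑ) ⊕ ((α̂ ŷ ẑ ⊕ lit 1) ⊖ t̂)
        e₁ : eval s′ (α̂ ĵ ẑ ⊖ t̂) ≡ a j w ∸ a x y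
        e₁ = cong₂ _∸_ (α̂≡ bs′ dr′ j≡ z≡) t≡
        e₂ : eval s′ ((t̂ ⊕ lit 1) ⊖ α̂ x̂ ẑ) ≡ suc (a x y) ∸ a x w
        e₂ = cong₂ _∸_ (trans (+-comm _ 1) (cong suc t≡)) (α̂≡ bs′ dr′ x≡ z≡)
        e₃ : eval s′ ((α̂ ŷ ẑ ⊕ lit 1) ⊖ t̂) ≡ suc (a y w) ∸ a x y
        e₃ = cong₂ _∸_ (trans (+-comm _ 1) (cong suc (α̂≡ bs′ dr′ y≡ z≡))) t≡
        to : eval s′ test ≡ 0 → Defect j x y w
        to z = defective (m∸n≡0⇒m≤n (trans (sym e₁) (m+n≡0⇒m≡0 (eval s′ (α̂ ĵ ẑ ⊖ t̂)) (m+n≡0⇒m≡0 _ z))))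
                (m∸n≡0⇒m≤n (trans (sym e₂) (m+n≡0⇒n≡0 (eval s′ (α̂ ĵ ẑ ⊖ t̂)) (m+n≡0⇒m≡0 _ z))))
                (m∸n≡0⇒m≤n (trans (sym e₃) (m+n≡0⇒n≡0 (eval s′ ((α̂ ĵ ẑ ⊖ t̂) ⊕ ((t̂ ⊕ lit 1) ⊖ α̂ x̂ ẑ))) z)))
        from : Defect j x y w → eval s′ test ≡ 0
        from (defective p q r) = +≡0 refl e₃ (+≡0 e₁ e₂ (m≤n⇒m∸n≡0 p) (m≤n⇒m∸n≡0 q)) (m≤n⇒m∸n≡0 r)
    in branch≤ {test}
      (λ ne → block skip (≤-refl , subst Sound (sym S≡) sound , (λ k → subst (λ f → f k ≢ 0) (sym S≡)) , λ d → ⊥-elim (ne (from d))))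
      (λ z → block (aS [ cell₃ ĵ x̂ ŷ ]≔ lit 1) (≤-refl ,
        sound-update (arrs s′ aS) (Basic.cell₃≡ bs′ j≡ x≡ y≡) (defective⇒conflict monos jw (to z)) (subst Sound (sym S≡) sound) ,
        (λ k ne → grows-update (arrs s′ aS) k (subst (λ f → f k ≢ 0) (sym S≡) ne)) ,
        λ _ → subst (_≢ 0) (sym (update-here (arrs s′ aS) (Basic.cell₃≡ bs′ j≡ x≡ y≡))) (λ ())))
    where
    jw : Adj j w
    jw = ∈arcs⁻ (∈nb⁻ (∈-middle pre eq))
    z≡ : arrs s aN (arrs s aR (regs s rj) + regs s rk) ≡ toℕ w
    z≡ = trans (cong (arrs s aN) (cong₂ _+_ (trans (cong (arrs s aR) (Place.j≡ pl)) (Basic.row bs j)) k≡))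
      (trans (Neighbours.nbr≡ ns j (length pre) (subst (length pre <_) (trans (sym (Listₚ.length-++-sucʳ pre w post)) (cong length (sym eq))) (s≤s (Listₚ.length-++-≤ˡ pre))))
        (at-middle toℕ pre eq))

  Conflict′ : (j x y : V) → Set
  Conflict′ j x y = ∃[ w ] Adj j w × Defect j x y w

  scanNeighbours-correct : ∀ {s j x y} → Basic s → Drawn s → Neighbours s → Place j x y s → All-Mono j x y → Sound (arrs s aS) →
    Does scanNeighbours s (Within (9 + length (nb j arcs) * (cost scanNeighbour + 8)) (λ s′ → Progress Conflict′ j x y (arrs s aS) (arrs s′ aS)))
  scanNeighbours-correct {s} {j} {x} {y} bs dr ns pl monos sound =
    mapDoes (λ { _ (le , p) → ≤-trans le (≤-reflexive (reorder (length (nb j arcs)) (cost scanNeighbour + 8))) , p }) (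
    block (rp ≔ aDeg [ ĵ ]) {Q = Within 3 (λ s′ → regs s′ rp ≡ length (nb j arcs) × arrs s′ aS ≡ arrs s aS)}
      (≤-refl , trans (cong (arrs s aDeg) (Place.j≡ pl)) (Neighbours.deg≡ ns j) , refl) ▷ λ {s₁} k₁ (p≡ , S≡) →
    mapDoes (λ { {s″} _ (le , sd , gr , done) → le , sd , gr ,
        λ { (w , jw , d) → done w (∈nb⁺ (∈arcs⁺ jw)) d } })
      (forList≤ (nb j arcs) (cost scanNeighbour) p≡
        (λ pre s′ → Sound (arrs s′ aS) × Grows (arrs s aS) (arrs s′ aS) ×
          (∀ w → w ∈ₗ pre → Defect j x y w → arrs s′ aS (code₃ j x y) ≢ 0))
        (λ {pre} {w} {post} {s′} eq ks k≡ (sd , gr , done) →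
          mapDoes (λ { _ (le , sd′ , gr′ , done′) → le , sd′ , (λ k → gr′ k ∘ gr k) ,
              λ w′ w′∈ d → [ (λ ∈pre → gr′ _ (done w′ ∈pre d)) , (λ { refl → done′ d }) ]′ (∈-∷ʳ⁻ w′∈) })
            (scanNeighbour-correct (basic-keeps ks (basic-keeps k₁ bs)) (drawn-keeps ks (drawn-keeps k₁ dr))
              (neighbours-keeps ks (neighbours-keeps k₁ ns)) (place-keeps ks (place-keeps k₁ pl)) monos eq k≡ sd))
        (subst Sound (sym S≡) sound , (λ k → subst (λ f → f k ≢ 0) (sym S≡)) , λ _ ())))
    where
    reorder : ∀ l c → 3 + (l * c + 6) ≡ 9 + l * c
    reorder l c = trans (cong (3 +_) (+-comm (l * c) 6)) refl

  All-Mono? : ∀ j x y → Dec (All-Mono j x y)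
  All-Mono? j x y = mono? j x ×-dec mono? x y ×-dec mono? j y
    where
    mono? : ∀ u v → Dec (Mono (a x y) u v)
    mono? u v with defect (a x y) u v ℕ.≟ 0
    ... | yes eq = yes (defect⇒mono eq)
    ... | no ne  = no (ne ∘ mono⇒defect)

  -- The number of vertices scanned for the triangle formed by j and an arc.
  opaque
   scanned : A → V → ℕ
   scanned (x , y) j with 0 ℕ.<? a j x | All-Mono? j x y
   ... | yes _ | yes _ = length (nb j arcs)
   ... | _     | _     = 0

   scanned-mono : ∀ {j x y} → 0 < a j x → All-Mono j x y → scanned (x , y) j ≡ length (nb j arcs)
   scanned-mono {j} {x} {y} p q with 0 ℕ.<? a j x | All-Mono? j x y
   ... | yes _ | yes _ = refl
   ... | no ¬p | _     = ⊥-elim (¬p p)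
   ... | yes _ | no ¬q = ⊥-elim (¬q q)

  opaque
    unit : ℕ
    unit = cost scanNeighbour + 8

    unit≡ : cost scanNeighbour + 8 ≡ unit
    unit≡ = refl

  opaque
    test-cost : ℕ
    test-cost = cost conflictTest + 9

    test-cost≡ : test-cost ≡ cost conflictTest + 9
    test-cost≡ = refl

    test-cost-bound : 9 + cost conflictTest ≤ test-cost
    test-cost-bound = ≤-reflexive (+-comm 9 _)

  conflictTest-correct : ∀ {s j x y} → Basic s → Drawn s → Neighbours s → Place j x y s → Adj x y → Sound (arrs s aS) →
    Does conflictTest s (Within (test-cost + scanned (x , y) j * unit) (λ s′ → Progress Conflict j x y (arrs s aS) (arrs s′ aS)))
  conflictTest-correct {s} {j} {x} {y} bs dr ns pl xy sound =
    within-mono {A = 1 + size c₁ + (1 + size c₂ + (1 + size c₃ + (1 + size c₄ + X)))} (+-monoˡ-≤ (scanned (x , y) j * unit) (≤-trans (≤ᵇ⇒≤ (1 + size c₁ + (1 + size c₂ + (1 + size c₃ + (1 + size c₄ + 9)))) (9 + cost conflictTest) tt) test-cost-bound))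
    (branchᶜ {c₁}
      (λ ne₁ → branchᶜ {c₂}
        (λ ne₂ → branchᶜ {c₃}
          (λ ne₃ → branchᶜ {c₄}
            (λ ne₄ → unchanged (s≤s z≤n) λ { (ordered _ _ p q) → ne₃ (from₃ p q)
                                 ; (correlated c) → ne₄ (from₄ (correlated⇒monos c)) })
            (λ z₄ → within-mono (+-monoʳ-≤ 9 (≤-reflexive (cong₂ _*_ (sym (scanned-mono (n≢0⇒n>0 (ne₁ ∘ trans e₁)) (to₄ z₄))) unit≡)))
              (mapDoes (λ { _ (le , sd , gr , done) → le , sd , gr ,
                λ { (ordered _ _ p q) → ⊥-elim (ne₃ (from₃ p q))
                  ; (correlated c) → done (correlated⇒conflict′ c) } })
                (scanNeighbours-correct bs dr ns pl (to₄ z₄) sound))))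
          (λ z₃ → block (aS [ cell₃ ĵ x̂ ŷ ]≔ lit 1) (m≤m+n 9 _ ,
            sound-update (arrs s aS) S≡ (ordered (ne₂ ∘ from₂) (n≢0⇒n>0 (ne₁ ∘ trans e₁)) (proj₁ (to₃ z₃)) (proj₂ (to₃ z₃))) sound ,
            grows-update (arrs s aS) ,
            λ _ → subst (_≢ 0) (sym (update-here (arrs s aS) S≡)) (λ ()))))
        (λ z₂ → unchanged (s≤s z≤n) λ c → conflict-≢ c (to₂ z₂)))
      (λ z₁ → unchanged (s≤s z≤n) λ c → n≮0 (subst (0 <_) (trans (sym e₁) z₁) (adj⇒α>0 (conflict-adjˡ c)))))
    where
    open Place pl
    X = 9 + scanned (x , y) j * unit
    c₁ = α̂ ĵ x̂
    c₂ = diff ĵ ŷ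
    c₃ = (α̂ ĵ x̂ ⊖ ω̂ x̂ ŷ) ⊕ ((α̂ ĵ ŷ ⊕ lit 1) ⊖ ω̂ x̂ ŷ)
    c₄ = monoDefect t̂ ĵ x̂ ⊕ monoDefect t̂ x̂ ŷ ⊕ monoDefect t̂ ĵ ŷ
    S≡ = Basic.cell₃≡ bs j≡ x≡ y≡
    e₁ : eval s c₁ ≡ a j x
    e₁ = α̂≡ bs dr j≡ x≡
    to₂ : eval s c₂ ≡ 0 → j ≡ y
    to₂ z = Finₚ.toℕ-injective (trans (sym j≡) (trans (≡-diff z) y≡))
    from₂ : j ≡ y → eval s c₂ ≡ 0
    from₂ refl = diff-≡ (trans j≡ (sym y≡))
    e₃ˡ : eval s (α̂ ĵ x̂ ⊖ ω̂ x̂ ŷ) ≡ a j x ∸ b x y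
    e₃ˡ = cong₂ _∸_ e₁ (ω̂≡ bs dr x≡ y≡)
    e₃ʳ : eval s ((α̂ ĵ ŷ ⊕ lit 1) ⊖ ω̂ x̂ ŷ) ≡ suc (a j y) ∸ b x y
    e₃ʳ = cong₂ _∸_ (trans (+-comm _ 1) (cong suc (α̂≡ bs dr j≡ y≡))) (ω̂≡ bs dr x≡ y≡)
    to₃ : eval s c₃ ≡ 0 → a j x ≤ b x y × a j y < b x y
    to₃ z = m∸n≡0⇒m≤n (trans (sym e₃ˡ) (m+n≡0⇒m≡0 _ z)) , m∸n≡0⇒m≤n (trans (sym e₃ʳ) (m+n≡0⇒n≡0 (eval s (α̂ ĵ x̂ ⊖ ω̂ x̂ ŷ)) z))
    from₃ : a j x ≤ b x y → a j y < b x y → eval s c₃ ≡ 0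
    from₃ p q = +≡0 e₃ˡ e₃ʳ (m≤n⇒m∸n≡0 p) (m≤n⇒m∸n≡0 q)
    e₄ : eval s c₄ ≡ defect (a x y) j x + defect (a x y) x y + defect (a x y) j y
    e₄ = cong₂ _+_ (cong₂ _+_ (defect≡ bs dr j≡ x≡ t≡) (defect≡ bs dr x≡ y≡ t≡)) (defect≡ bs dr j≡ y≡ t≡)
    to₄ : eval s c₄ ≡ 0 → All-Mono j x y
    to₄ z with z′ ← trans (sym e₄) z =
      defect⇒mono (m+n≡0⇒m≡0 _ (m+n≡0⇒m≡0 _ z′)) , defect⇒mono (m+n≡0⇒n≡0 (defect (a x y) j x) (m+n≡0⇒m≡0 _ z′)) ,
      defect⇒mono (m+n≡0⇒n≡0 (defect (a x y) j x + defect (a x y) x y) z′)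
    from₄ : All-Mono j x y → eval s c₄ ≡ 0
    from₄ (p , q , r) = trans e₄ (cong₂ _+_ (cong₂ _+_ (mono⇒defect p) (mono⇒defect q)) (mono⇒defect r))
    correlated⇒monos : ∀ {t w} → Correlated t y j x w → All-Mono j x y
    correlated⇒monos c with refl ← Mono.α≡ (mono-sym (Correlated.xz c)) = Correlated.yz c , mono-sym (Correlated.xz c) , mono-sym (Correlated.xy c)
    correlated⇒conflict′ : ∀ {t w} → Correlated t y j x w → Conflict′ j x y
    correlated⇒conflict′ {w = w} c with refl ← Mono.α≡ (mono-sym (Correlated.xz c)) =
      w , α>0⇒adj (Correlated.yw>0 c) , defective (Correlated.yw≤ c) (Correlated.zw> c) (Correlated.xw< c)
    conflict-≢ : Conflict j x y → j ≢ y
    conflict-≢ (ordered ne _ _ _) = ne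
    conflict-≢ (correlated c) refl = n≮0 (<-≤-trans (≤-trans (Correlated.yw>0 c) (Correlated.yw≤ c))
      (≤-reflexive (trans (sym (Mono.α≡ (Correlated.xy c))) (α-nonadj (adj-irr refl)))))
    unchanged : ∀ {B} → 1 ≤ B → ¬ Conflict j x y → Does skip s (Within B (λ s′ → Progress Conflict j x y (arrs s aS) (arrs s′ aS)))
    unchanged le ¬c = block skip (le , sound , (λ _ ne → ne) , λ c → ⊥-elim (¬c c))

  scans : A → ℕ
  scans e = sum (map (scanned e) (allFin n))

  record Table (s : State) : Set where
    field
      sound    : Sound (arrs s aS)
      complete : ∀ {x y z} → Conflict x y z → arrs s aS (code₃ x y z) ≢ 0

  table-keeps : ∀ {p s s′} → Keeps p s s′ → {AllArrs p (aS ∷ [])} → Table s → Table s′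
  table-keeps k {c , _} t = record
    { sound = subst Sound (sym (keep-arr k aS {c})) (Table.sound t)
    ; complete = λ {x} {y} {z} cf → subst (λ f → f (code₃ x y z) ≢ 0) (sym (keep-arr k aS {c})) (Table.complete t cf) }

  private
    Complete : (ℕ → ℕ) → List A → Set
    Complete f pre = ∀ j x y → (x , y) ∈ₗ pre → Conflict j x y → f (code₃ j x y) ≢ 0

  -- Here 26 is 6 for `fetch`, 6 for reading t, 6 for the frame of the inner loop and 8 for a round
  -- of the outer loop.
  arc-cost : ℕ
  arc-cost = n * (test-cost + 8) + 26

  rowTests : ∀ {s x y} → Basic s → Drawn s → Neighbours s → regs s rx ≡ toℕ x → regs s ry ≡ toℕ y → regs s rt ≡ a x y →
    Adj x y → Sound (arrs s aS) →
    Does (For rj rn conflictTest) s (Within (n * (test-cost + 8) + scans (x , y) * unit + 6)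
      (λ s′ → Sound (arrs s′ aS) × Grows (arrs s aS) (arrs s′ aS) × (∀ j → Conflict j x y → arrs s′ aS (code₃ j x y) ≢ 0)))
  rowTests {s} {x} {y} bs dr ns x≡ y≡ t≡ xy sound =
    mapDoes (λ { {s′} _ (τ , refl , le , sd , gr , done) →
        +-monoˡ-≤ 6 (subst (λ k → τ ≤ k * (test-cost + 8) + scans (x , y) * unit) (Listₚ.length-tabulate {n = n} id) le) ,
        sd , gr , λ j → done j (∈-allFin j) })
      (forVertices (Basic.n≡ bs)
        (λ pre s′ τ → τ ≤ length pre * (test-cost + 8) + sum (map (scanned (x , y)) pre) * unit ×
          Sound (arrs s′ aS) × Grows (arrs s aS) (arrs s′ aS) × (∀ j → j ∈ₗ pre → Conflict j x y → arrs s′ aS (code₃ j x y) ≢ 0))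
        (λ {pre} {j} {post} {s′} {τ} eq ks j≡ (le , sd , gr , done) →
          mapDoes (λ { {_} {t} _ (le′ , sd′ , gr′ , done′) → accumulate (scanned (x , y)) pre j (test-cost + 8) unit le (reorder-row test-cost (scanned (x , y) j * unit) le′) , sd′ , (λ k → gr′ k ∘ gr k) ,
              λ i i∈ c → [ (λ ∈pre → gr′ _ (done i ∈pre c)) , (λ { refl → done′ c }) ]′ (∈-∷ʳ⁻ i∈) })
            (conflictTest-correct (basic-keeps ks bs) (drawn-keeps ks dr) (neighbours-keeps ks ns)
              (place j≡ (trans (keep-reg ks rx) x≡) (trans (keep-reg ks ry) y≡) (trans (keep-reg ks rt) t≡)) xy sd))
        (z≤n , sound , (λ _ ne → ne) , λ _ ()))

  conflicts-cost : ℕ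
  conflicts-cost = length arcs * arc-cost + sum (map scans arcs) * unit + 6

  conflictsBody : Program
  conflictsBody = fetch ⨾ rt ≔ α̂ x̂ ŷ ⨾ For rj rn conflictTest

  arcTests : ∀ {s pre e post} → Basic s → Drawn s → Neighbours s → Listed s → arcs ≡ pre ++ e ∷ post → regs s ri ≡ length pre →
    Sound (arrs s aS) →
    Does conflictsBody s (Within (6 + (6 + (n * (test-cost + 8) + scans e * unit + 6))) (λ s′ →
      Sound (arrs s′ aS) × Grows (arrs s aS) (arrs s′ aS) × (∀ j → Conflict j (proj₁ e) (proj₂ e) → arrs s′ aS (code₃ j (proj₁ e) (proj₂ e)) ≢ 0)))
  arcTests {s} {pre} {x , y} bs dr ns ls eq i≡ sd =
    fetched ls eq i≡ ▷ λ {s₂} k₂ (x≡ , y≡) →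
    let bs₂ = basic-keeps k₂ bs ; dr₂ = drawn-keeps k₂ dr in
    block (rt ≔ α̂ x̂ ŷ) {Q = Within 6 (λ s′ → regs s′ rt ≡ a x y × regs s′ rx ≡ toℕ x × regs s′ ry ≡ toℕ y × arrs s′ aS ≡ arrs s₂ aS)}
      (≤-refl , α̂≡ bs₂ dr₂ x≡ y≡ , x≡ , y≡ , refl) ▷ λ {s₃} k₃ (t≡ , x≡ , y≡ , S≡) →
    subst (λ f → Does (For rj rn conflictTest) s₃ (Within (n * (test-cost + 8) + scans (x , y) * unit + 6) (λ s′ →
        Sound (arrs s′ aS) × Grows f (arrs s′ aS) × (∀ j → Conflict j x y → arrs s′ aS (code₃ j x y) ≢ 0))))
      (trans S≡ (keep-arr k₂ aS))
      (rowTests (basic-keeps k₃ bs₂) (drawn-keeps k₃ dr₂) (neighbours-keeps k₃ (neighbours-keeps k₂ ns))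
        x≡ y≡ t≡ (∈arcs⁻ (∈-middle pre eq)) (subst Sound (sym (trans S≡ (keep-arr k₂ aS))) sd))

  conflicts-correct : ∀ {s} → Basic s → Drawn s → Neighbours s → Listed s → (∀ k → arrs s aS k ≡ 0) →
    Does conflicts s (Within conflicts-cost Table)
  conflicts-correct {s} bs dr ns ls S₀ =
    mapDoes (λ { _ (τ , refl , le , sd , done) → +-monoˡ-≤ 6 le , record { sound = sd ; complete = λ c → done _ _ _ (∈arcs⁺ (conflict-adjʳ c)) c } })
      (forList arcs (Basic.mm≡ bs)
        (λ pre s′ τ → τ ≤ length pre * arc-cost + sum (map scans pre) * unit × Sound (arrs s′ aS) × Complete (arrs s′ aS) pre)
        (λ {pre} {e} {post} {s₁} {τ} eq ks ri≡ (le , sd , done) →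
          mapDoes (λ { _ (le′ , sd′ , gr , done′) →
              accumulate scans pre e arc-cost unit le (reorder-arc (n * (test-cost + 8)) (scans e * unit) le′) , sd′ ,
              λ j u v e∈ c → [ (λ ∈pre → gr _ (done j u v ∈pre c)) , (λ { refl → done′ j c }) ]′ (∈-∷ʳ⁻ e∈) })
            (arcTests (basic-keeps ks bs) (drawn-keeps ks dr) (neighbours-keeps ks ns) (listed-keeps ks ls) eq ri≡ sd))
        (z≤n , (λ x y z ne → ⊥-elim (ne (S₀ _))) , λ _ _ _ ()))

-- Queues and marks of a search.

pair-injective : ∀ {k l σ ρ} → σ < 2 → ρ < 2 → k + k + σ ≡ l + l + ρ → k ≡ l × σ ≡ ρ
pair-injective {zero}  {zero}  _ _ eq = refl , eq
pair-injective {zero}  {suc l} {ρ = ρ} (s≤s (s≤s z≤n)) _ eq with () ← trans eq (cong suc (cong (_+ ρ) (+-suc l l)))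
pair-injective {suc k} {zero}  {σ} _ (s≤s (s≤s z≤n)) eq with () ← trans (sym eq) (cong suc (cong (_+ σ) (+-suc k k)))
pair-injective {suc k} {suc l} {σ} {ρ} p q eq
  with k≡l , σ≡ρ ← pair-injective {k} {l} p q (suc-injective (suc-injective
         (trans (sym (cong suc (cong (_+ σ) (+-suc k k)))) (trans eq (cong suc (cong (_+ ρ) (+-suc l l)))))))
  = cong suc k≡l , σ≡ρ

module Searching (𝒢 : TemporalGraph) (es : List (Arc 𝒢)) (es↭ : es ↭ edges 𝒢) where
  open TemporalGraph 𝒢
  open Intervals 𝒢
  open Codes n
  open Listing 𝒢 es es↭
  open ConflictTable 𝒢 es es↭

  codeᴬ : A → ℕ
  codeᴬ (x , y) = code x y

  codeᴬ-injective : ∀ {e f} → codeᴬ e ≡ codeᴬ f → e ≡ f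
  codeᴬ-injective {_ , _} {_ , _} eq with refl , refl ← code-injective eq = refl

  Col : (ℕ → ℕ) → A → Set
  Col f e = f (codeᴬ e) ≢ 0

  Col? : ∀ f e → Dec (Col f e)
  Col? f e = ¬? (f (codeᴬ e) ℕ.≟ 0)

  -- The queue of a search is listed with its newest entry first.
  Queue : (qx qy : ℕ → ℕ) (σ : ℕ) → List A → Set
  Queue qx qy σ []            = ⊤
  Queue qx qy σ ((x , y) ∷ L) =
    (qx (length L + length L + σ) ≡ toℕ x × qy (length L + length L + σ) ≡ toℕ y) × Queue qx qy σ L

  mark : ℕ → A → ℕ
  mark σ e = codeᴬ e + codeᴬ e + σ

  -- `marked` and `unmarked` identify the arcs carrying the current stamp with the queue. `bounded`
  -- is what makes a new search possible: once the stamp is raised, no mark equals it.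
  record Search (col marks qx qy : ℕ → ℕ) (stamp σ : ℕ) (e₀ : A) (L : List A) : Set where
    field
      σ<2        : σ < 2
      bounded    : ∀ k → marks k ≤ stamp
      queue      : Queue qx qy σ L
      unique     : Unique L
      uncoloured : ∀ {e} → e ∈ₗ L → ¬ Col col e
      reached    : ∀ {e} → e ∈ₗ L → e₀ ⟶* e
      marked     : ∀ {e} → e ∈ₗ L → marks (mark σ e) ≡ stamp
      unmarked   : ∀ {e} → marks (mark σ e) ≡ stamp → e ∈ₗ L

  SearchAt : State → ℕ → A → List A → Set
  SearchAt s = Search (arrs s aCol) (arrs s aMark) (arrs s aQX) (arrs s aQY) (regs s rstamp)

  searchAt-keeps : ∀ {p s s′ σ e₀ L} → Keeps p s s′ → {AllRegs p (rstamp ∷ [])} → {AllArrs p (aCol ∷ aMark ∷ aQX ∷ aQY ∷ [])} →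
    SearchAt s σ e₀ L → SearchAt s′ σ e₀ L
  searchAt-keeps k {r , _} {c , m , x , y , _} se
    rewrite keep-reg k rstamp {r} | keep-arr k aCol {c} | keep-arr k aMark {m} | keep-arr k aQX {x} | keep-arr k aQY {y} = se

  queue-update : ∀ qx qy k {σ ρ u v} L → σ < 2 → ρ < 2 → (ρ ≢ σ ⊎ length L ≤ k) →
    Queue qx qy ρ L → Queue (update qx (k + k + σ) u) (update qy (k + k + σ) v) ρ L
  queue-update qx qy _ [] _ _ _ _ = tt
  queue-update qx qy k {σ} {ρ} (e ∷ L) p q apart ((x≡ , y≡) , Q) =
    (trans (update-there qx ne) x≡ , trans (update-there qy ne) y≡) ,
    queue-update qx qy k L p q ([ inj₁ , (λ le → inj₂ (≤-trans (n≤1+n _) le)) ]′ apart) Q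
    where
    ne : k + k + σ ≢ length L + length L + ρ
    ne eq with k≡ , σ≡ ← pair-injective p q eq = [ (λ d → d (sym σ≡)) , (λ le → <-irrefl (sym k≡) le) ]′ apart

  search-push : ∀ {col} marks qx qy {stamp σ e₀ L i k f u v} → Search col marks qx qy stamp σ e₀ L →
    ¬ Col col f → f ∉ₗ L → e₀ ⟶* f → i ≡ mark σ f → k ≡ length L + length L + σ → u ≡ toℕ (proj₁ f) → v ≡ toℕ (proj₂ f) →
    Search col (update marks i stamp) (update qx k u) (update qy k v) stamp σ e₀ (f ∷ L)
  search-push marks qx qy {stamp} {σ} {L = L} {f = f} se ¬cf f∉ e₀f refl refl refl refl = record
    { σ<2 = σ<2
    ; bounded = λ k → bound k
    ; queue = (update-here qx {l + l + σ} refl , update-here qy {l + l + σ} refl) , queue-update qx qy l L σ<2 σ<2 (inj₂ ≤-refl) queue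
    ; unique = All.tabulate (λ g∈ → λ { refl → f∉ g∈ }) ∷ unique
    ; uncoloured = λ { (here refl) → ¬cf ; (there e∈) → uncoloured e∈ }
    ; reached = λ { (here refl) → e₀f ; (there e∈) → reached e∈ }
    ; marked = λ { (here refl) → update-here marks {mark σ f} refl ; (there e∈) → keep-mark e∈ }
    ; unmarked = λ {e} → find e }
    where
    open Search se
    l = length L
    bound : ∀ k → update marks (mark σ f) stamp k ≤ stamp
    bound k with mark σ f ℕ.≟ k
    ... | yes _ = ≤-refl
    ... | no _  = bounded k
    keep-mark : ∀ {e} → e ∈ₗ L → update marks (mark σ f) stamp (mark σ e) ≡ stamp
    keep-mark {e} e∈ with mark σ f ℕ.≟ mark σ e
    ... | yes _ = refl
    ... | no _  = marked e∈
    find : ∀ e → update marks (mark σ f) stamp (mark σ e) ≡ stamp → e ∈ₗ f ∷ L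
    find e eq with mark σ f ℕ.≟ mark σ e
    ... | yes eq′ = here (sym (codeᴬ-injective (proj₁ (pair-injective {codeᴬ f} {codeᴬ e} σ<2 σ<2 eq′))))
    ... | no _    = there (unmarked eq)

  -- Both searches write to the same arrays, but at positions of different parity, so a write by one
  -- is invisible to the other.
  search-other : ∀ {col} marks qx qy j {stamp σ ρ e₀ L i k f u v} → Search col marks qx qy stamp ρ e₀ L →
    σ < 2 → ρ ≢ σ → i ≡ mark σ f → k ≡ j + j + σ →
    Search col (update marks i stamp) (update qx k u) (update qy k v) stamp ρ e₀ L
  search-other marks qx qy j {stamp} {σ} {ρ} {L = L} {f = f} se σ<2 ρ≢σ refl refl = record
    { σ<2 = ρ<2
    ; bounded = bound
    ; queue = queue-update qx qy j L σ<2 ρ<2 (inj₁ ρ≢σ) queue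
    ; unique = unique ; uncoloured = uncoloured ; reached = reached
    ; marked = λ e∈ → trans (same _) (marked e∈)
    ; unmarked = λ eq → unmarked (trans (sym (same _)) eq) }
    where
    open Search se renaming (σ<2 to ρ<2)
    same : ∀ e → update marks (mark σ f) stamp (mark ρ e) ≡ marks (mark ρ e)
    same e = update-there marks {mark σ f} λ eq → ρ≢σ (sym (proj₂ (pair-injective {codeᴬ f} {codeᴬ e} σ<2 ρ<2 eq)))
    bound : ∀ k → update marks (mark σ f) stamp k ≤ stamp
    bound k with mark σ f ℕ.≟ k
    ... | yes _ = ≤-refl
    ... | no _  = bounded k

  Undisturbed : ℕ → State → State → Set
  Undisturbed σ s s′ = ∀ ρ e L → ρ ≢ σ → SearchAt s ρ e L → SearchAt s′ ρ e L

  record Extended (σ : ℕ) (e₀ : A) (L : List A) (P : List A → Set) (s s′ : State) : Set where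
    constructor extended
    field
      new    : List A
      search : SearchAt s′ σ e₀ (new ++ L)
      tail≡  : regs s′ rl ≡ length (new ++ L)
      found  : P (new ++ L)
      others : Undisturbed σ s s′

  push-correct : ∀ {s σ e₀ L f} → Basic s → SearchAt s σ e₀ L → regs s rσ ≡ σ → regs s rl ≡ length L →
    regs s rp ≡ toℕ (proj₁ f) → regs s rq ≡ toℕ (proj₂ f) → e₀ ⟶* f →
    Does push s (Within (cost push) (Extended σ e₀ L (λ L′ → f ∈ₗ L′ ⊎ Col (arrs s aCol) f) s))
  push-correct {s} {σ} {e₀} {L} {f} bs se σ≡ l≡ p≡ q≡ e₀f = branch≤
    (λ ne → block skip (≤-refl , extended [] se l≡ (inj₂ (λ eq → ne (trans (cong (arrs s aCol) (Basic.cell≡ bs p≡ q≡)) eq))) (λ _ _ _ _ → id)))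
    (λ z → branch≤
      (λ ne → block action (≤-refl , extended (f ∷ [])
        (search-push (arrs s aMark) (arrs s aQX) (arrs s aQY) se (uncol z) (λ f∈ → ne (diff-≡ (trans (cong (arrs s aMark) mark≡) (Search.marked se f∈))))
          e₀f mark≡ pos≡ p≡ q≡)
        (trans (+-comm _ 1) (cong suc l≡)) (inj₁ (here refl))
        (λ _ _ _ ρ≢ se′ → search-other (arrs s aMark) (arrs s aQX) (arrs s aQY) (length L) {f = f} se′ (Search.σ<2 se) ρ≢ mark≡ pos≡)))
      (λ z′ → block skip (≤-refl , extended [] se l≡
        (inj₁ (Search.unmarked se (trans (cong (arrs s aMark) (sym mark≡)) (≡-diff z′)))) (λ _ _ _ _ → id))))
    where
    action = aMark [ markIndex (reg rp) (reg rq) ]≔ reg rstamp ⨾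
      aQX [ reg rl ⊕ reg rl ⊕ reg rσ ]≔ reg rp ⨾
      aQY [ reg rl ⊕ reg rl ⊕ reg rσ ]≔ reg rq ⨾
      rl ≔ reg rl ⊕ lit 1
    cell≡′ = Basic.cell≡ bs {x = proj₁ f} {proj₂ f} p≡ q≡
    mark≡ : eval s (markIndex (reg rp) (reg rq)) ≡ mark σ f
    mark≡ = cong₂ _+_ (cong₂ _+_ cell≡′ cell≡′) σ≡
    pos≡ : regs s rl + regs s rl + regs s rσ ≡ length L + length L + σ
    pos≡ = cong₂ _+_ (cong₂ _+_ l≡ l≡) σ≡
    uncol : eval s (aCol [ cell (reg rp) (reg rq) ]) ≡ 0 → ¬ Col (arrs s aCol) f
    uncol z ne = ne (trans (cong (arrs s aCol) (sym cell≡′)) z)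

  -- Arcs coloured earlier count as reached although they are never queued; since the coloured set
  -- is closed, paths through them stay in it.
  Reached : (ℕ → ℕ) → List A → A → Set
  Reached col L f = f ∈ₗ L ⊎ Col col f

  Visited : (ℕ → ℕ) → A → V → List A → Set
  Visited col (x , y) j L = (Conflict x y j → Reached col L (j , y)) × (Conflict j x y → Reached col L (x , j))

  record At (e : A) (σ : ℕ) (s : State) : Set where
    constructor at-arc
    field
      x≡ : regs s rx ≡ toℕ (proj₁ e)
      y≡ : regs s ry ≡ toℕ (proj₂ e)
      σ≡ : regs s rσ ≡ σ

  at-keeps : ∀ {p s s′ e σ} → Keeps p s s′ → {AllRegs p (rx ∷ ry ∷ rσ ∷ [])} → At e σ s → At e σ s′
  at-keeps k {a , b , c , _} (at-arc x y z) = at-arc (trans (keep-reg k rx {a}) x) (trans (keep-reg k ry {b}) y) (trans (keep-reg k rσ {c}) z)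

  visitInto-correct : ∀ {s σ e₀ L e j} → Basic s → Table s → SearchAt s σ e₀ L → At e σ s → regs s rl ≡ length L →
    regs s rj ≡ toℕ j → e ∈ₗ L →
    Does visitInto s (Within (cost visitInto) (Extended σ e₀ L (λ L′ → Conflict (proj₁ e) (proj₂ e) j → Reached (arrs s aCol) L′ (j , proj₂ e)) s))
  visitInto-correct {s} {σ} {e₀} {L} {e@(x , y)} {j} bs tb se (at-arc x≡ y≡ σ≡) l≡ j≡ e∈ = branch≤
    (λ ne →
      block (pass ĵ ŷ) {Q = Within 4 (λ s′ → s′ ≡ setReg (setReg s rp (regs s rj)) rq (regs s ry))} (≤-refl , refl) ▷ λ { k refl →
      mapDoes (λ { _ (le , extended new se′ t f o) → le , extended new se′ t (λ _ → f) o })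
        (push-correct {f = j , y} (basic-keeps k bs) se σ≡ l≡ j≡ y≡
          (Search.reached se e∈ ◅◅ (into (Table.sound tb x y j (λ z → ne (trans (cong (arrs s aS) S≡) z))) ◅ ε))) })
    (λ z → block skip (≤-refl , extended [] se l≡ (λ c → ⊥-elim (Table.complete tb c (trans (cong (arrs s aS) (sym S≡)) z))) (λ _ _ _ _ → id)))
    where
    S≡ = Basic.cell₃≡ bs x≡ y≡ j≡

  visitOut-correct : ∀ {s σ e₀ L e j} → Basic s → Table s → SearchAt s σ e₀ L → At e σ s → regs s rl ≡ length L →
    regs s rj ≡ toℕ j → e ∈ₗ L →
    Does visitOut s (Within (cost visitOut) (Extended σ e₀ L (λ L′ → Conflict j (proj₁ e) (proj₂ e) → Reached (arrs s aCol) L′ (proj₁ e , j)) s))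
  visitOut-correct {s} {σ} {e₀} {L} {e@(x , y)} {j} bs tb se (at-arc x≡ y≡ σ≡) l≡ j≡ e∈ = branch≤
    (λ ne →
      block (pass x̂ ĵ) {Q = Within 4 (λ s′ → s′ ≡ setReg (setReg s rp (regs s rx)) rq (regs s rj))} (≤-refl , refl) ▷ λ { k refl →
      mapDoes (λ { _ (le , extended new se′ t f o) → le , extended new se′ t (λ _ → f) o })
        (push-correct {f = x , j} (basic-keeps k bs) se σ≡ l≡ x≡ j≡
          (Search.reached se e∈ ◅◅ (out (Table.sound tb j x y (λ z → ne (trans (cong (arrs s aS) S≡) z))) ◅ ε))) })
    (λ z → block skip (≤-refl , extended [] se l≡ (λ c → ⊥-elim (Table.complete tb c (trans (cong (arrs s aS) (sym S≡)) z))) (λ _ _ _ _ → id)))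
    where
    S≡ = Basic.cell₃≡ bs j≡ x≡ y≡

  reached-++ : ∀ col {L f} new → Reached col L f → Reached col (new ++ L) f
  reached-++ _ new (inj₁ f∈) = inj₁ (∈-++⁺ʳ new f∈)
  reached-++ _ new (inj₂ c)  = inj₂ c

  visit-correct : ∀ {s σ e₀ L e j} → Basic s → Table s → SearchAt s σ e₀ L → At e σ s → regs s rl ≡ length L →
    regs s rj ≡ toℕ j → e ∈ₗ L →
    Does visit s (Within (cost visit) (Extended σ e₀ L (Visited (arrs s aCol) e j) s))
  visit-correct {s} {σ} {e₀} {L} {e} {j} bs tb se pl l≡ j≡ e∈ =
    visitInto-correct bs tb se pl l≡ j≡ e∈ ▷ λ { {s₁} k (extended new se₁ l≡₁ f o) →
    mapDoes (λ { {s₂} k₂ (le , extended new′ se₂ l≡₂ f′ o′) → le , extended (new′ ++ new)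
        (subst (SearchAt s₂ σ e₀) (sym (Listₚ.++-assoc new′ new L)) se₂)
        (trans l≡₂ (cong length (sym (Listₚ.++-assoc new′ new L))))
        (subst (Visited (arrs s aCol) e j) (sym (Listₚ.++-assoc new′ new L))
          ((λ c → reached-++ (arrs s aCol) new′ (f c)) , λ c → subst (λ g → Reached g (new′ ++ (new ++ L)) (proj₁ e , j)) (keep-arr k aCol) (f′ c)))
        (λ ρ f L ρ≢ se′ → o′ ρ f L ρ≢ (o ρ f L ρ≢ se′)) })
      (visitOut-correct (basic-keeps k bs) (table-keeps k tb) se₁ (at-keeps k pl) l≡₁ (trans (keep-reg k rj) j≡) (∈-++⁺ʳ new e∈)) }

  pop-loop-cost : ℕ
  pop-loop-cost = n * (cost visit + 8) + 6

  pop-loop : ∀ {s σ e₀ L e} → Basic s → Table s → SearchAt s σ e₀ L → At e σ s → regs s rl ≡ length L → e ∈ₗ L →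
    Does (For rj rn visit) s (Within pop-loop-cost (Extended σ e₀ L (λ L′ → ∀ j → Visited (arrs s aCol) e j L′) s))
  pop-loop {s} {σ} {e₀} {L} {e} bs tb se pl l≡ e∈ =
    mapDoes (λ { _ (le , extended new se′ l≡′ f o) → le , extended new se′ l≡′ (λ j → f j (∈-allFin j)) o })
      (forVertices≤ (cost visit) (Basic.n≡ bs)
        (λ pre → Extended σ e₀ L (λ L′ → ∀ j → j ∈ₗ pre → Visited (arrs s aCol) e j L′) s)
        (λ {pre} {j} {post} {s₁} eq k j≡ → λ { (extended new se₁ l≡₁ f o) →
          mapDoes (λ { {s₂} k₂ (le , extended new′ se₂ l≡₂ f′ o′) → le , extended (new′ ++ new)
              (subst (SearchAt s₂ σ e₀) (sym (Listₚ.++-assoc new′ new L)) se₂)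
              (trans l≡₂ (cong length (sym (Listₚ.++-assoc new′ new L))))
              (λ i i∈ → subst (Visited (arrs s aCol) e i) (sym (Listₚ.++-assoc new′ new L))
                ([ (λ ∈pre → let (p , q) = f i ∈pre in (λ c → reached-++ (arrs s aCol) new′ (p c)) , (λ c → reached-++ (arrs s aCol) new′ (q c)))
                 , (λ { refl → subst (λ g → Visited g e i (new′ ++ (new ++ L))) (keep-arr k aCol) f′ }) ]′ (∈-∷ʳ⁻ i∈)))
              (λ ρ f L ρ≢ se′ → o′ ρ f L ρ≢ (o ρ f L ρ≢ se′)) })
            (visit-correct (basic-keeps k bs) (table-keeps k tb) se₁ (at-keeps k pl) l≡₁ j≡ (∈-++⁺ʳ new e∈)) })
        (extended [] se l≡ (λ _ ()) (λ _ _ _ _ → id)))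

  -- The arcs of the queue P have been processed, those of W have not.
  record Running (e₀ : A) (s : State) (σ h l : ℕ) : Set where
    constructor running
    field
      {W P}  : List A
      search : SearchAt s σ e₀ (W ++ P)
      h≡     : h ≡ length P
      l≡     : l ≡ length (W ++ P)
      start∈ : e₀ ∈ₗ W ++ P
      closed : ∀ {e f} → e ∈ₗ P → Step e f → Reached (arrs s aCol) (W ++ P) f

  data Ends {X : Set} : List X → Set where
    none : Ends []
    last : ∀ xs x → Ends (xs ++ x ∷ [])

  ends : ∀ {X : Set} (xs : List X) → Ends xs
  ends [] = none
  ends (x ∷ xs) with ends xs
  ... | none = last [] x
  ... | last ys y = last (x ∷ ys) y

  queue-head : ∀ {qx qy σ} W {e P} → Queue qx qy σ (W ++ e ∷ P) →
    qx (length P + length P + σ) ≡ toℕ (proj₁ e) × qy (length P + length P + σ) ≡ toℕ (proj₂ e)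
  queue-head []      (q , _) = q
  queue-head (_ ∷ W) (_ , Q) = queue-head W Q

  popped : ∀ col {e L} → (∀ j → Visited col e j L) → ∀ {f} → Step e f → Reached col L f
  popped _ v (into c) = proj₁ (v _) c
  popped _ v (out c)  = proj₂ (v _) c

  pop-cost : ℕ
  pop-cost = cost popFetch + pop-loop-cost

  pop-correct : ∀ {s e₀} → Basic s → Table s → Running e₀ s (regs s rσ) (regs s rh) (regs s rl) → regs s rl ∸ regs s rh ≢ 0 →
    Does pop s (Within pop-cost (λ s′ → Running e₀ s′ (regs s rσ) (suc (regs s rh)) (regs s′ rl) × regs s′ rh ≡ suc (regs s rh) ×
      Undisturbed (regs s rσ) s s′))
  -- The queue is listed with its newest entry first, so the arc to be popped is the last one of W,
  -- stored at the position given by the number of processed arcs.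
  pop-correct {s} {e₀} bs tb (running {W} {P} se h≡ l≡ start∈ closed) h<l with ends W
  ... | none = ⊥-elim (h<l (trans (cong₂ _∸_ l≡ h≡) (n∸n≡0 (length P))))
  ... | last W′ e =
    block popFetch {Q = Within (cost popFetch) (λ s₁ → At e (regs s rσ) s₁ × regs s₁ rl ≡ regs s rl × regs s₁ rh ≡ suc (regs s rh) × s₁ ≡ run popFetch s)}
      (≤-refl , at-arc (trans (cong (arrs s aQX) pos≡) (proj₁ entry)) (trans (cong (arrs s aQY) pos≡) (proj₂ entry)) refl , refl , +-comm _ 1 , refl) ▷
    λ { {s₁} k₁ (pl , l≡₁ , h≡₁ , refl) →
    mapDoes (λ { {s₂} k₂ (le , extended new se₂ l≡₂ visited o) → le ,
        running {W = new ++ W′} {P = e ∷ P} (subst (SearchAt s₂ (regs s rσ) e₀) (assoc new) se₂) (cong suc h≡)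
          (trans l≡₂ (cong length (assoc new)))
          (subst (e₀ ∈ₗ_) (assoc new) (∈-++⁺ʳ new start∈))
          (λ e∈ st → subst₂ (λ g L → Reached g L _) (sym (keep-arr k₂ aCol)) (assoc new) (reach new visited e∈ st)) ,
        trans (keep-reg k₂ rh) h≡₁ , o })
      (pop-loop (basic-keeps k₁ bs) (table-keeps k₁ tb) se pl (trans l≡₁ l≡) (∈-++⁺ˡ (∈-++⁺ʳ W′ (here refl)))) }
    where
    L = (W′ ++ e ∷ []) ++ P
    assoc : ∀ new → new ++ L ≡ (new ++ W′) ++ e ∷ P
    assoc new = trans (cong (new ++_) (Listₚ.++-assoc W′ (e ∷ []) P)) (sym (Listₚ.++-assoc new W′ (e ∷ P)))
    entry : arrs s aQX (length P + length P + regs s rσ) ≡ toℕ (proj₁ e) × arrs s aQY (length P + length P + regs s rσ) ≡ toℕ (proj₂ e)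
    entry = queue-head W′ (subst (Queue (arrs s aQX) (arrs s aQY) (regs s rσ)) (assoc []) (Search.queue se))
    pos≡ : regs s rh + regs s rh + regs s rσ ≡ length P + length P + regs s rσ
    pos≡ = cong (_+ regs s rσ) (cong₂ _+_ h≡ h≡)
    reach : ∀ new → (∀ j → Visited (arrs s aCol) e j (new ++ L)) → ∀ {g f} → g ∈ₗ e ∷ P → Step g f → Reached (arrs s aCol) (new ++ L) f
    reach new v (here refl) st = popped (arrs s aCol) v st
    reach new v (there g∈) st  = reached-++ (arrs s aCol) new (closed g∈ st)

-- Complete searches, searches in lockstep, and adoption.

module SearchLoops (𝒢 : TemporalGraph) (es : List (Arc 𝒢)) (es↭ : es ↭ edges 𝒢) where
  open TemporalGraph 𝒢
  open Intervals 𝒢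
  open Codes n
  open Listing 𝒢 es es↭
  open ConflictTable 𝒢 es es↭
  open Searching 𝒢 es es↭

  running-keeps : ∀ {p s s′ e₀ σ h l} → Keeps p s s′ → {AllRegs p (rstamp ∷ [])} → {AllArrs p (aCol ∷ aMark ∷ aQX ∷ aQY ∷ [])} →
    Running e₀ s σ h l → Running e₀ s′ σ h l
  running-keeps k {r} {as@(c , _)} (running {W} {P} se h≡ l≡ st cl) = running {W = W} {P} (searchAt-keeps k {r} {as} se) h≡ l≡ st
    λ {e} {f} e∈ s → subst (λ g → Reached g (W ++ P) f) (sym (keep-arr k aCol {c})) (cl e∈ s)

  running-other : ∀ {s s′ e₀ σ ρ h l} → Undisturbed σ s s′ → arrs s′ aCol ≡ arrs s aCol → ρ ≢ σ →
    Running e₀ s ρ h l → Running e₀ s′ ρ h l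
  running-other o col≡ ρ≢ (running {W} {P} se h≡ l≡ st cl) = running {W = W} {P} (o _ _ _ ρ≢ se) h≡ l≡ st
    λ {e} {f} e∈ s → subst (λ g → Reached g (W ++ P) f) (sym col≡) (cl e∈ s)

  found-bound : ∀ {s σ e₀ L} → e₀ ∈ₗ arcs → SearchAt s σ e₀ L → length L ≤ length arcs
  found-bound {e₀ = e₀} e₀∈ se = unique-⊆-length (Search.unique se)
    λ {f} f∈ → ∈arcs⁺ (AP-⟶* {e₀} {f} (∈arcs⁻ e₀∈) (Search.reached se f∈))

  running-bound : ∀ {s e₀ σ h l} → e₀ ∈ₗ arcs → Running e₀ s σ h l → h ≤ length arcs
  running-bound {s} e₀∈ (running {W} {P} se refl refl _ _) =
    ≤-trans (≤-trans (m≤n+m (length P) (length W)) (≤-reflexive (sym (Listₚ.length-++ W)))) (found-bound {s} e₀∈ se)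

  Now : A → State → Set
  Now e s = Running e s (regs s rσ) (regs s rh) (regs s rl)

  pop-now : ∀ {s e₀} → Basic s → Table s → Now e₀ s → regs s rl ∸ regs s rh ≢ 0 →
    Does pop s (Within pop-cost (λ s′ → Now e₀ s′ × regs s′ rh ≡ suc (regs s rh) × Undisturbed (regs s rσ) s s′))
  pop-now {e₀ = e₀} bs tb now ne = mapDoes (λ { {s′} k (le , now′ , h≡ , o) → le ,
      subst₂ (λ σ h → Running e₀ s′ σ h (regs s′ rl)) (sym (keep-reg k rσ)) (sym h≡) now′ , h≡ , o })
    (pop-correct bs tb now ne)

  record Finished (e₀ : A) (s : State) : Set where
    field
      L       : List A
      search  : SearchAt s (regs s rσ) e₀ L
      length≡ : regs s rh ≡ length L
      start∈  : e₀ ∈ₗ L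
      closed  : ∀ {e f} → e ∈ₗ L → Step e f → Reached (arrs s aCol) L f

  finish : ∀ {e₀ s} → Now e₀ s → regs s rl ∸ regs s rh ≡ 0 → Finished e₀ s
  finish (running {[]} {P} se h≡ l≡ st cl) _ = record { L = P ; search = se ; length≡ = h≡ ; start∈ = st ; closed = cl }
  finish (running {w ∷ W} {P} se h≡ l≡ st cl) z = ⊥-elim (<⇒≱ (s≤s (≤-trans (m≤n+m (length P) (length W)) (≤-reflexive (sym (Listₚ.length-++ W)))))
    (subst₂ _≤_ l≡ h≡ (m∸n≡0⇒m≤n z)))

  private
    shorter : ∀ {B h} → suc h ≤ B → B ∸ suc h < B ∸ h
    shorter {B} {h} lt = ∸-monoʳ-< (n<1+n h) lt

  close-cost : ℕ
  close-cost = 4 + pop-cost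

  close-correct : ∀ {s e₀} → e₀ ∈ₗ arcs → Basic s → Table s → Now e₀ s → regs s rh ≡ 0 →
    Does close s (λ s′ t → t ≤ regs s′ rh * close-cost + 4 × Finished e₀ s′)
  close-correct {s} {e₀} e₀∈ bs tb now h≡0 =
    mapDoes (λ { _ (τ , refl , (now′ , le) , z) → +-monoˡ-≤ 4 le , finish now′ z })
      (while (λ s′ τ → Now e₀ s′ × τ ≤ regs s′ rh * close-cost) (λ s′ → length arcs ∸ regs s′ rh)
        (λ {s₁} {τ} k (now₁ , le) ne → mapDoes
          (λ { {s₂} {t} k₂ (le′ , now₂ , h≡ , _) →
            (now₂ , (begin
              τ + (4 + t)                      ≤⟨ +-mono-≤ le (+-monoʳ-≤ 4 le′) ⟩
              regs s₁ rh * close-cost + close-cost ≡⟨ +-comm _ close-cost ⟩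
              suc (regs s₁ rh) * close-cost    ≡⟨ cong (_* close-cost) (sym h≡) ⟩
              regs s₂ rh * close-cost          ∎)) ,
            subst (λ h → length arcs ∸ h < length arcs ∸ regs s₁ rh) (sym h≡)
              (shorter (subst (_≤ length arcs) h≡ (running-bound e₀∈ now₂))) })
          (pop-now (basic-keeps k bs) (table-keeps k tb) now₁ ne))
        (now , z≤n))
    where open ≤-Reasoning

  -- The search from e is about to move, the one from f is waiting. The mover is never ahead and at
  -- most one step behind: `h≤h′` shows that a search which is completed has found no more than the
  -- other one, and `h′≤h` bounds the work spent on that other search.
  record Lockstep (e₀ : A) (s : State) : Set where
    constructor lockstepped
    field
      {e f} : A
      origin : e ≡ e₀ ⊎ e ≡ swap e₀
      f≡    : f ≡ swap e
      e∈    : e ∈ₗ arcs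
      f∈    : f ∈ₗ arcs
      this  : Now e s
      other : Running f s (regs s rσ′) (regs s rh′) (regs s rl′)
      apart : regs s rσ ≢ regs s rσ′
      h≤h′  : regs s rh ≤ regs s rh′
      h′≤h  : regs s rh′ ≤ suc (regs s rh)

  lockstep-cost : ℕ
  lockstep-cost = 4 + (pop-cost + cost exchange)

  lockstep-correct : ∀ {s e₀} → Basic s → Table s → Lockstep e₀ s → regs s rh ≡ 0 → regs s rh′ ≡ 0 →
    Does lockstep s (λ s′ t → t ≤ (regs s′ rh + regs s′ rh′) * lockstep-cost + 4 × Lockstep e₀ s′ × regs s′ rl ∸ regs s′ rh ≡ 0)
  lockstep-correct {s} {e₀} bs tb lk h≡0 h′≡0 =
    mapDoes (λ { _ (τ , refl , (lk′ , le) , z) → +-monoˡ-≤ 4 le , lk′ , z })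
      (while (λ s′ τ → Lockstep e₀ s′ × τ ≤ (regs s′ rh + regs s′ rh′) * lockstep-cost)
        (λ s′ → (length arcs ∸ regs s′ rh) + (length arcs ∸ regs s′ rh′))
        (λ {s₁} {τ} k (lk₁ , le) ne → step (basic-keeps k bs) (table-keeps k tb) lk₁ le ne)
        (lk , z≤n))
    where
    open ≤-Reasoning
    step : ∀ {s₁ τ} → Basic s₁ → Table s₁ → Lockstep e₀ s₁ → τ ≤ (regs s₁ rh + regs s₁ rh′) * lockstep-cost → regs s₁ rl ∸ regs s₁ rh ≢ 0 →
      Does (pop ⨾ exchange) s₁ (λ s′ t → (Lockstep e₀ s′ × τ + (4 + t) ≤ (regs s′ rh + regs s′ rh′) * lockstep-cost) ×
        (length arcs ∸ regs s′ rh) + (length arcs ∸ regs s′ rh′) < (length arcs ∸ regs s₁ rh) + (length arcs ∸ regs s₁ rh′))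
    step {s₁} {τ} bs tb (lockstepped {e} {f} origin refl e∈ f∈ this other apart h≤ ≤h) le ne =
      mapDoes (λ { {s₂} {t} k (le′ , lk , h≡ , h′≡) → (lk , (begin
            τ + (4 + t)                    ≤⟨ +-mono-≤ le (+-monoʳ-≤ 4 le′) ⟩
            (h + h′) * c + c               ≡⟨ +-comm ((h + h′) * c) c ⟩
            suc (h + h′) * c               ≡⟨ cong (_* c) (trans (+-comm (suc h) h′) (sym (cong₂ _+_ h≡ h′≡))) ⟩
            (regs s₂ rh + regs s₂ rh′) * c ∎)) ,
            subst₂ (λ i j → (N ∸ i) + (N ∸ j) < (N ∸ h) + (N ∸ h′)) (sym h≡) (sym h′≡)
              (subst (_< (N ∸ h) + (N ∸ h′)) (+-comm (N ∸ suc h) (N ∸ h′))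
                (+-monoˡ-< (N ∸ h′) (shorter (subst (_≤ N) h′≡ (running-bound (Lockstep.f∈ lk) (Lockstep.other lk)))))) })
        moved
      where
      N = length arcs
      h = regs s₁ rh
      h′ = regs s₁ rh′
      c = lockstep-cost
      moved : Does (pop ⨾ exchange) s₁ (Within (pop-cost + cost exchange) (λ s′ →
        Lockstep e₀ s′ × regs s′ rh ≡ h′ × regs s′ rh′ ≡ suc h))
      moved = pop-now bs tb this ne ▷ λ {s₂} k (this₂ , h≡ , o) →
        let other₂ : Running f s₂ (regs s₂ rσ′) (regs s₂ rh′) (regs s₂ rl′)
            other₂ = subst₂ (λ σ h → Running f s₂ σ h (regs s₂ rl′)) (sym (keep-reg k rσ′)) (sym (keep-reg k rh′))
              (subst (Running f s₂ (regs s₁ rσ′) (regs s₁ rh′)) (sym (keep-reg k rl′))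
                (running-other o (keep-arr k aCol) (≢-sym apart) other))
        in mapDoes (λ { k₃ (le , refl) → le ,
          lockstepped ([ (λ { refl → inj₂ refl }) , (λ { refl → inj₁ refl }) ]′ origin) refl f∈ e∈ (running-keeps k₃ other₂) (running-keeps k₃ this₂)
            (λ eq → apart (trans (sym (keep-reg k rσ)) (trans (sym eq) (keep-reg k rσ′))))
            (subst₂ _≤_ (sym (keep-reg k rh′)) (sym h≡) ≤h)
            (subst₂ _≤_ (sym h≡) (cong suc (sym (keep-reg k rh′))) (s≤s h≤)) ,
          keep-reg k rh′ , h≡ })
          (block exchange {Q = Within (cost exchange) (λ s′ → s′ ≡ run exchange s₂)} (≤-refl , refl))

  -- The search that finishes first found no more arcs than the other one.
  finished-contradiction : ∀ {s e₀} → (lk : Lockstep e₀ s) → (fin : Finished (Lockstep.e lk) s) →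
    swap (Lockstep.e lk) ∈ₗ Finished.L fin → (∀ {f g} → Col (arrs s aCol) f → Step f g → Col (arrs s aCol) g) → Contradictory
  finished-contradiction {s} (lockstepped {e} _ refl e∈ f∈ this (running {W} {P} se h≡ l≡ st cl) apart h≤h′ _) fin ē∈ col-closed =
    e , ∈arcs⁻ e∈ , Search.reached search ē∈ , Search.reached se
      (unique-⊆-⊇ _≟ᴬ_ (Search.unique se) sub shorter′ start∈)
    where
    open Finished fin
    chase : ∀ {f g} → Reached (arrs s aCol) L f → f ⟶* g → Reached (arrs s aCol) L g
    chase r ε = r
    chase (inj₁ f∈) (st ◅ sts) = chase (closed f∈ st) sts
    chase (inj₂ c)  (st ◅ sts) = chase (inj₂ (col-closed c st)) sts
    sub : ∀ {g} → g ∈ₗ W ++ P → g ∈ₗ L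
    -- The other search starts at the reverse of e, which lies in the completed set L. Closure puts
    -- all arcs it found into L, since none of them is coloured. As L is no longer than that list,
    -- both have the same arcs, and e itself has been reached from its reverse.
    sub g∈ with chase (inj₁ ē∈) (Search.reached se g∈)
    ... | inj₁ g∈L = g∈L
    ... | inj₂ c   = ⊥-elim (Search.uncoloured se g∈ c)
    shorter′ : length L ≤ length (W ++ P)
    shorter′ = ≤-trans (≤-reflexive (sym length≡)) (≤-trans h≤h′ (≤-trans (≤-reflexive h≡)
      (≤-trans (m≤n+m (length P) (length W)) (≤-reflexive (sym (Listₚ.length-++ W))))))

  -- A rounded upper bound for one round of `adopt`; the comparison with the actual cost is done by
  -- evaluation in `adopt-correct`.
  adopt-cost : ℕ
  adopt-cost = 40

  record Adopted (col col′ : ℕ → ℕ) (L : List A) : Set where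
    field
      sound : ∀ f → Col col′ f → Col col f ⊎ f ∈ₗ L
      grows : Grows col col′
      done  : ∀ {f} → f ∈ₗ L → Col col′ f

  adopt-correct : ∀ {s} L → Basic s → Queue (arrs s aQX) (arrs s aQY) (regs s rσ) L → regs s rh ≡ length L →
    Does adopt s (λ s′ t → t ≤ length L * adopt-cost + 2 × Adopted (arrs s aCol) (arrs s′ aCol) L)
  adopt-correct [] bs _ h≡ = while-stop h≡ (≤-refl , record { sound = λ _ → inj₁ ; grows = λ _ → id ; done = λ () })
  adopt-correct {s} (e ∷ L) bs ((x≡ , y≡) , Q) h≡ = while-go (λ z → case trans (sym h≡) z of λ ())
    (block (rh ≔ reg rh ⊖ lit 1 ⨾ write) {Q = λ s′ t → s′ ≡ run (rh ≔ reg rh ⊖ lit 1 ⨾ write) s × t ≡ cost (rh ≔ reg rh ⊖ lit 1 ⨾ write)} (refl , refl))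
    λ { {s′} k (refl , refl) → mapDoes
      (λ { _ (le , ad) → ≤-trans (+-monoʳ-≤ _ le) (≤-trans (≤-reflexive (sym (+-assoc (2 + cost (rh ≔ reg rh ⊖ lit 1 ⨾ write)) _ 2))) (+-monoˡ-≤ 2 (+-monoˡ-≤ (length L * adopt-cost) (≤ᵇ⇒≤ (2 + cost (rh ≔ reg rh ⊖ lit 1 ⨾ write)) adopt-cost tt)))) ,
        extend-adopted ad })
      (adopt-correct L (basic-keeps k bs) Q h′≡) }
    where
    write = aCol [ cell (aQX [ reg rh ⊕ reg rh ⊕ reg rσ ]) (aQY [ reg rh ⊕ reg rh ⊕ reg rσ ]) ]≔ lit 1
    h′≡ : regs s rh ∸ 1 ≡ length L
    h′≡ = cong (_∸ 1) h≡
    pos≡ : (regs s rh ∸ 1) + (regs s rh ∸ 1) + regs s rσ ≡ length L + length L + regs s rσ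
    pos≡ = cong (λ h → h + h + regs s rσ) h′≡
    i = arrs s aR (arrs s aQX ((regs s rh ∸ 1) + (regs s rh ∸ 1) + regs s rσ)) + arrs s aQY ((regs s rh ∸ 1) + (regs s rh ∸ 1) + regs s rσ)
    i≡ : i ≡ codeᴬ e
    i≡ = Basic.cell≡ bs (trans (cong (arrs s aQX) pos≡) x≡) (trans (cong (arrs s aQY) pos≡) y≡)
    extend-adopted : ∀ {col′} → Adopted (update (arrs s aCol) i 1) col′ L → Adopted (arrs s aCol) col′ (e ∷ L)
    extend-adopted {col′} ad = record
      { sound = λ f c → [ from f , inj₂ ∘ there ]′ (Adopted.sound ad f c)
      ; grows = λ k ne → Adopted.grows ad k (grows-update (arrs s aCol) k ne)
      ; done = λ { (here refl) → Adopted.grows ad _ (subst (_≢ 0) (sym (update-here (arrs s aCol) i≡)) λ ())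
                 ; (there f∈) → Adopted.done ad f∈ } }
      where
      from : ∀ f → Col (update (arrs s aCol) i 1) f → Col (arrs s aCol) f ⊎ f ∈ₗ e ∷ L
      from f c with i ℕ.≟ codeᴬ f
      ... | yes eq = inj₂ (here (sym (codeᴬ-injective (trans (sym i≡) eq))))
      ... | no _   = inj₁ c

  Fresh : State → Set
  Fresh s = ∀ k → arrs s aMark k ≤ regs s rstamp

  blank : ∀ {col marks qx qy stamp σ e₀} → σ < 2 → (∀ k → marks k < stamp) → Search col marks qx qy stamp σ e₀ []
  blank σ<2 lt = record { σ<2 = σ<2 ; bounded = λ k → <⇒≤ (lt k) ; queue = tt ; unique = [] ; uncoloured = λ ()
    ; reached = λ () ; marked = λ () ; unmarked = λ eq → ⊥-elim (<-irrefl eq (lt _)) }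

  record Ends-at (e : A) (s : State) : Set where
    constructor ends-at
    field
      x≡ : regs s rsx ≡ toℕ (proj₁ e)
      y≡ : regs s rsy ≡ toℕ (proj₂ e)

  ends-keeps : ∀ {p s s′ e} → Keeps p s s′ → {AllRegs p (rsx ∷ rsy ∷ [])} → Ends-at e s → Ends-at e s′
  ends-keeps k {a , b , _} (ends-at x y) = ends-at (trans (keep-reg k rsx {a}) x) (trans (keep-reg k rsy {b}) y)

  start-correct : ∀ {s e} → Basic s → Fresh s → Ends-at e s → ¬ Col (arrs s aCol) e →
    Does start s (Within (cost start) (λ s₁ → Now e s₁ × regs s₁ rh ≡ 0 × regs s₁ rσ ≡ 0 × (∀ f → SearchAt s₁ 1 f [])))
  start-correct {s} {e} bs fr (ends-at x≡ y≡) ¬c = block start (≤-refl ,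
    running {W = e ∷ []} {P = []} (search-push (arrs s aMark) (arrs s aQX) (arrs s aQY) (blank (s≤s z≤n) lt) ¬c (λ ()) ε mark≡ refl x≡ y≡)
      refl refl (here refl) (λ ()) , refl , refl ,
    λ f → search-other (arrs s aMark) (arrs s aQX) (arrs s aQY) 0 {f = e} (blank (s≤s (s≤s z≤n)) lt) (s≤s z≤n) (λ ()) mark≡ refl)
    where
    lt : ∀ k → arrs s aMark k < regs s rstamp + 1
    lt k = subst (arrs s aMark k <_) (+-comm 1 _) (s≤s (fr k))
    cell≡′ = Basic.cell≡ bs {x = proj₁ e} {proj₂ e} x≡ y≡
    mark≡ : arrs s aR (regs s rsx) + regs s rsy + (arrs s aR (regs s rsx) + regs s rsy) + 0 ≡ mark 0 e
    mark≡ = cong (_+ 0) (cong₂ _+_ cell≡′ cell≡′)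

  start′-correct : ∀ {s e} → Basic s → Ends-at e s → e ∈ₗ arcs → swap e ∈ₗ arcs → ¬ Col (arrs s aCol) (swap e) →
    Now e s → regs s rh ≡ 0 → regs s rσ ≡ 0 → SearchAt s 1 (swap e) [] →
    Does start′ s (Within (cost start′) (λ s₂ → Lockstep e s₂ × regs s₂ rh ≡ 0 × regs s₂ rh′ ≡ 0))
  start′-correct {s} {e} bs (ends-at x≡ y≡) e∈ ē∈ ¬c now h≡0 σ≡0 se =
    mapDoes (λ { k (le , refl) → le , lockstepped (inj₁ refl) refl e∈ ē∈
        (running-other undisturbed refl (λ eq → case trans (sym σ≡0) eq of λ ()) now)
        (running {W = swap e ∷ []} {P = []} (search-push (arrs s aMark) (arrs s aQX) (arrs s aQY) se ¬c (λ ()) ε mark≡ refl y≡ x≡)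
          refl refl (here refl) (λ ()))
        (λ eq → case trans (sym σ≡0) eq of λ ()) (≤-reflexive h≡0) z≤n , h≡0 , refl })
      (block start′ {Q = Within (cost start′) (λ s′ → s′ ≡ run start′ s)} (≤-refl , refl))
    where
    cell≡′ = Basic.cell≡ bs {x = proj₂ e} {proj₁ e} y≡ x≡
    mark≡ : arrs s aR (regs s rsy) + regs s rsx + (arrs s aR (regs s rsy) + regs s rsx) + 1 ≡ mark 1 (swap e)
    mark≡ = cong (_+ 1) (cong₂ _+_ cell≡′ cell≡′)
    undisturbed : Undisturbed 1 s (run start′ s)
    undisturbed ρ f L ρ≢ se′ = search-other (arrs s aMark) (arrs s aQX) (arrs s aQY) 0 {f = swap e} se′ (s≤s (s≤s z≤n)) ρ≢ mark≡ refl

  -- A partial AMTTO: consistent and closed under forcing, but possibly leaving edges undecided.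
  record Colouring (col : ℕ → ℕ) : Set where
    field
      within : ∀ {e} → Col col e → e ∈ₗ arcs
      asym   : ∀ {x y} → Col col (x , y) → ¬ Col col (y , x)
      closed : ∀ {e f} → Col col e → Step e f → Col col f

    closed* : ∀ {e f} → Col col e → e ⟶* f → Col col f
    closed* c ε        = c
    closed* c (s ◅ ss) = closed* (closed c s) ss

  free : (ℕ → ℕ) → ℕ
  free col = length (filter (λ e → col (codeᴬ e) ℕ.≟ 0) arcs)

  free-bound : ∀ col → free col ≤ length arcs
  free-bound col = Listₚ.length-filter (λ e → col (codeᴬ e) ℕ.≟ 0) arcs

  -- `counted` feeds the amortisation: the l arcs found leave the pool of uncoloured arcs. `new`
  -- remembers that each of them is forced by the arc chosen, which later supplies the leaders for
  -- `led⇒¬cyclic`.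
  record Gained (e : A) (col col′ : ℕ → ℕ) (l : ℕ) : Set where
    field
      colouring : Colouring col′
      grows     : Grows col col′
      coloured  : Col col′ e
      new       : ∀ f → Col col′ f → Col col f ⊎ (¬ Col col f × ¬ Col col (swap f) × e ⟶* f)
      counted   : l + free col′ ≤ free col

  -- By skew-symmetry, if e forces both f and its reverse, then it forces its own reverse; so the
  -- found set is consistent as soon as the reverse of e is missing. Likewise, a found arc whose
  -- reverse was coloured before would have had the reverse of e coloured.
  gained : ∀ {s e col′} → e ∈ₗ arcs → Colouring (arrs s aCol) → ¬ Col (arrs s aCol) (swap e) → (fin : Finished e s) →
    ¬ swap e ∈ₗ Finished.L fin → Adopted (arrs s aCol) col′ (Finished.L fin) → Gained e (arrs s aCol) col′ (length (Finished.L fin))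
  gained {s} {e} {col′} e∈ colr ¬cē fin ē∉ ad = record
    { colouring = record
      { within = λ {f} c → [ C.within , found⊆ ]′ (sound f c)
      ; asym = λ {x} {y} p q → asym (sound (x , y) p) (sound (y , x) q)
      ; closed = λ {f} c st → [ (λ c₀ → grows _ (C.closed c₀ st)) , (λ f∈ → [ done , grows _ ]′ (closed f∈ st)) ]′ (sound f c) }
    ; grows = grows
    ; coloured = done start∈
    ; new = λ f c → [ inj₁ , (λ f∈ → inj₂ (uncoloured f∈ , ¬swapped f∈ , reached f∈)) ]′ (sound f c)
    ; counted = subst (_≤ free col) (Listₚ.length-++ L) (unique-⊆-length disjoint-union sub) }
    where
    module C = Colouring colr
    open Finished fin
    open Search search
    open Adopted ad
    col = arrs s aCol
    found⊆ : ∀ {f} → f ∈ₗ L → f ∈ₗ arcs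
    found⊆ f∈ = ∈arcs⁺ (AP-⟶* {e} (∈arcs⁻ e∈) (reached f∈))
    chase : ∀ {f g} → Reached col L f → f ⟶* g → Reached col L g
    chase r ε = r
    chase (inj₁ f∈) (st ◅ sts) = chase (closed f∈ st) sts
    chase (inj₂ c)  sts = inj₂ (C.closed* c sts)
    ē-unreached : ¬ Reached col L (swap e)
    ē-unreached = [ ē∉ , ¬cē ]′
    ¬swapped : ∀ {f} → f ∈ₗ L → ¬ Col col (swap f)
    ¬swapped f∈ c = ¬cē (C.closed* c (⟶*-swap (reached f∈)))
    asym : ∀ {x y} → Col col (x , y) ⊎ (x , y) ∈ₗ L → Col col (y , x) ⊎ (y , x) ∈ₗ L → ⊥
    asym (inj₁ p) (inj₁ q) = C.asym p q
    asym (inj₁ p) (inj₂ q) = ¬swapped q p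
    asym (inj₂ p) (inj₁ q) = ¬swapped p q
    asym (inj₂ p) (inj₂ q) = ē-unreached (chase (inj₁ p) (⟶*-swap (reached q)))
    isFree = λ e → col (codeᴬ e) ℕ.≟ 0
    isFree′ = λ e → col′ (codeᴬ e) ℕ.≟ 0
    disjoint-union : Unique (L ++ filter isFree′ arcs)
    disjoint-union = Uniqueₚ.++⁺ unique (Uniqueₚ.filter⁺ isFree′ arcs-unique)
      λ { {f} (f∈L , f∈) → done f∈L (proj₂ (∈-filter⁻ isFree′ {xs = arcs} f∈)) }
    uncol : ∀ {f} → ¬ Col col f → col (codeᴬ f) ≡ 0
    uncol {f} ¬c with col (codeᴬ f) ℕ.≟ 0
    ... | yes eq = eq
    ... | no ne  = ⊥-elim (¬c ne)
    sub : ∀ {f} → f ∈ₗ L ++ filter isFree′ arcs → f ∈ₗ filter isFree arcs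
    sub f∈ with ∈-++⁻ L f∈
    ... | inj₁ f∈L = ∈-filter⁺ isFree (found⊆ f∈L) (uncol (uncoloured f∈L))
    ... | inj₂ f∈′ with f∈arcs , z ← ∈-filter⁻ isFree′ {xs = arcs} f∈′ = ∈-filter⁺ isFree f∈arcs (uncol λ c → grows _ c z)

-- Amortised cost of the searches.

private
  ring₁ : ∀ a b l c A k → a + (b + (((k + (k + 1)) * l + 4) + (c + (k * A + 2)))) ≡ ((a + b + c) + (4 + 2)) + (k * (l + l + A) + l)
  ring₁ = solve-∀

  ring₂ : ∀ p c x y → (p * c + x) + (c + y) ≡ (c + p * c) + (x + y)
  ring₂ = solve-∀

  ring₃ : ∀ τ u w → (τ + u) + w ≡ (τ + w) + u
  ring₃ = solve-∀

opaque
  -- Together the searches make at most k + (k + 1) steps. As k ≥ 1, the odd step is absorbed by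
  -- counting l a third time, and apart from a constant the whole cost is proportional to the number
  -- k of arcs found.
  lockstep-time : ∀ a b l c A {k h h′} → h ≡ k → h′ ≤ suc h → 1 ≤ k →
    a + (b + (((h + h′) * l + 4) + (c + (k * A + 2)))) ≤ ((a + b + c) + 6) + k * (l + l + l + A)
  lockstep-time a b l c A {k} {h} {h′} refl h′≤ 1≤k = begin
    a + (b + (((k + h′) * l + 4) + (c + (k * A + 2))))
      ≤⟨ +-monoʳ-≤ a (+-monoʳ-≤ b (+-monoˡ-≤ (c + (k * A + 2)) (+-monoˡ-≤ 4 (*-monoˡ-≤ l (+-monoʳ-≤ k (≤-trans h′≤ (≤-reflexive (+-comm 1 k)))))))) ⟩
    a + (b + (((k + (k + 1)) * l + 4) + (c + (k * A + 2)))) ≡⟨ ring₁ a b l c A k ⟩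
    ((a + b + c) + (4 + 2)) + (k * (l + l + A) + l) ≤⟨ +-monoʳ-≤ ((a + b + c) + 6) (+-monoʳ-≤ (k * (l + l + A)) (≤-trans (≤-reflexive (sym (*-identityˡ l))) (*-monoˡ-≤ l 1≤k))) ⟩
    ((a + b + c) + 6) + (k * (l + l + A) + k * l) ≡⟨ cong (((a + b + c) + 6) +_) (trans (sym (*-distribˡ-+ k (l + l + A) l)) (cong (k *_) (ring₃ (l + l) A l))) ⟩
    ((a + b + c) + 6) + k * (l + l + l + A) ∎
    where open ≤-Reasoning

  -- A potential argument: each of the f uncoloured arcs holds K units, and a search that colours k
  -- of them is paid for by the units released. Only the constant c remains to be charged to the
  -- current element.
  amortize : ∀ K c {τ t p f f′ k N} → τ + f * K ≤ p * c + N → t ≤ c + k * K → k + f′ ≤ f →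
    (τ + t) + f′ * K ≤ suc p * c + N
  amortize K c {τ} {t} {p} {f} {f′} {k} {N} le le′ kf = begin
    (τ + t) + f′ * K            ≤⟨ +-monoˡ-≤ (f′ * K) (+-monoʳ-≤ τ le′) ⟩
    (τ + (c + k * K)) + f′ * K  ≡⟨ trans (+-assoc τ _ _) (cong (τ +_) (trans (+-assoc c _ _) (cong (c +_) (sym (*-distribʳ-+ K k f′))))) ⟩
    τ + (c + (k + f′) * K)      ≤⟨ +-monoʳ-≤ τ (+-monoʳ-≤ c (*-monoˡ-≤ K kf)) ⟩
    τ + (c + f * K)             ≡⟨ trans (cong (τ +_) (+-comm c _)) (sym (+-assoc τ _ c)) ⟩
    (τ + f * K) + c             ≤⟨ +-monoˡ-≤ c le ⟩
    (p * c + N) + c             ≡⟨ trans (ring₃ (p * c) N c) (cong (_+ N) (+-comm (p * c) c)) ⟩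
    suc p * c + N               ∎
    where open ≤-Reasoning

  -- The search that detects a contradiction colours nothing and thus releases no potential. It gets
  -- N K units of its own, which is affordable because no search follows it.
  overrun : ∀ K c {τ t p f k N} → τ + f * K ≤ p * c + N * K → t ≤ c + k * K → k ≤ N →
    τ + t ≤ suc p * c + (N + N) * K
  overrun K c {τ} {t} {p} {f} {k} {N} le le′ k≤ = begin
    τ + t                         ≤⟨ +-mono-≤ (≤-trans (m≤m+n τ (f * K)) le) (≤-trans le′ (+-monoʳ-≤ c (*-monoˡ-≤ K k≤))) ⟩
    (p * c + N * K) + (c + N * K) ≡⟨ ring₂ p c (N * K) (N * K) ⟩
    (c + p * c) + (N * K + N * K) ≡⟨ cong (c + p * c +_) (sym (*-distribʳ-+ K N N)) ⟩
    suc p * c + (N + N) * K       ∎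
    where open ≤-Reasoning

  idle : ∀ c {τ t p X} → τ ≤ p * c + X → t ≤ c → τ + t ≤ suc p * c + X
  idle c {τ} {t} {p} {X} le le′ = ≤-trans (+-mono-≤ le le′)
    (≤-reflexive (trans (ring₃ (p * c) X c) (cong (_+ X) (+-comm (p * c) c))))

-- Deciding all edges: the 2-SAT phase.

module TwoSAT (𝒢 : TemporalGraph) (es : List (Arc 𝒢)) (es↭ : es ↭ edges 𝒢) where
  open TemporalGraph 𝒢
  open Intervals 𝒢
  open Codes n
  open Listing 𝒢 es es↭
  open ConflictTable 𝒢 es es↭
  open Searching 𝒢 es es↭
  open SearchLoops 𝒢 es es↭

  opaque
    search-cost : ℕ
    search-cost = lockstep-cost + lockstep-cost + lockstep-cost + adopt-cost

    search-cost≡ : search-cost ≡ lockstep-cost + lockstep-cost + lockstep-cost + adopt-cost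
    search-cost≡ = refl

    base-cost : ℕ
    base-cost = (cost start + cost start′ + (1 + size unmarkedEnds)) + 6

    base-cost≡ : base-cost ≡ (cost start + cost start′ + (1 + size unmarkedEnds)) + 6
    base-cost≡ = refl

  adopt-finished : ∀ {s e} → Basic s → e ∈ₗ arcs → Colouring (arrs s aCol) → ¬ Col (arrs s aCol) (swap e) →
    (fin : Finished e s) → ¬ swap e ∈ₗ Finished.L fin →
    Does adopt s (λ s′ t → t ≤ length (Finished.L fin) * adopt-cost + 2 × Gained e (arrs s aCol) (arrs s′ aCol) (length (Finished.L fin)))
  adopt-finished bs e∈ colr ¬cē fin ē∉ =
    mapDoes (λ { _ (le , ad) → le , gained e∈ colr ¬cē fin ē∉ ad })
      (adopt-correct L bs (Search.queue search) length≡)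
    where open Finished fin

  -- Which direction is adopted depends on which search is completed first, hence e′. On failure k
  -- arcs have been paid for without being coloured, so their number is bounded explicitly.
  data Decided (e : A) (s s′ : State) (k : ℕ) : Set where
    solved : ∀ {e′} → e′ ≡ e ⊎ e′ ≡ swap e → regs s′ rans ≡ regs s rans → Fresh s′ → Gained e′ (arrs s aCol) (arrs s′ aCol) k → Decided e s s′ k
    failed : regs s′ rans ≡ 0 → Contradictory → k ≤ length arcs → Decided e s s′ k

  doubleSearch : Program
  doubleSearch = start ⨾ start′ ⨾ lockstep ⨾ decide

  finished-bound : ∀ {s e} → e ∈ₗ arcs → (fin : Finished e s) → length (Finished.L fin) ≤ length arcs
  finished-bound {s} e∈ fin = found-bound {s} e∈ (Finished.search fin)

  nonempty : ∀ {e : A} {L} → e ∈ₗ L → 1 ≤ length L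
  nonempty (here _)  = s≤s z≤n
  nonempty (there _) = s≤s z≤n

  mark-eval : ∀ {s e} → Basic s → Ends-at e s →
    eval s (markIndex (reg rsx) (reg rsy)) ≡ mark (regs s rσ) e × eval s (markIndex (reg rsy) (reg rsx)) ≡ mark (regs s rσ) (swap e)
  mark-eval {s} {e} bs (ends-at x≡ y≡) = cong (_+ regs s rσ) (cong₂ _+_ c c) , cong (_+ regs s rσ) (cong₂ _+_ c′ c′)
    where
    c = Basic.cell≡ bs {x = proj₁ e} {proj₂ e} x≡ y≡
    c′ = Basic.cell≡ bs {x = proj₂ e} {proj₁ e} y≡ x≡

  decide-correct : ∀ {s e₀} → Basic s → Ends-at e₀ s → (lk : Lockstep e₀ s) → (fin : Finished (Lockstep.e lk) s) → Colouring (arrs s aCol) →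
    ¬ Col (arrs s aCol) e₀ → ¬ Col (arrs s aCol) (swap e₀) →
    Does decide s (λ s′ t → t ≤ (1 + size unmarkedEnds) + (length (Finished.L fin) * adopt-cost + 2) × Decided e₀ s s′ (length (Finished.L fin)))
  decide-correct {s} {e₀} bs en lk fin colr ¬c ¬c̄ = branch
    (λ ne → mapDoes (λ { {s′} k (le , g) → +-monoʳ-≤ (1 + size unmarkedEnds) le ,
        solved (Lockstep.origin lk) (keep-reg k rans)
          (λ i → subst₂ (λ f st → f i ≤ st) (sym (keep-arr k aMark)) (sym (keep-reg k rstamp)) (Search.bounded search i)) g })
      (adopt-finished bs (Lockstep.e∈ lk) colr (¬ē (Lockstep.origin lk)) fin (λ ē∈ → ne (both (Lockstep.origin lk) start∈ ē∈))))
    (λ z → block (rans ≔ lit 0) (+-monoʳ-≤ (1 + size unmarkedEnds) (m≤n+m 2 (length L * adopt-cost)) ,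
        failed refl (finished-contradiction lk fin (unboth (Lockstep.origin lk) z) (Colouring.closed colr))
          (finished-bound (Lockstep.e∈ lk) fin)))
    where
    open Finished fin
    st = regs s rstamp
    m₁ = proj₁ (mark-eval bs en)
    m₂ = proj₂ (mark-eval bs en)
    ¬ē : ∀ {e} → e ≡ e₀ ⊎ e ≡ swap e₀ → ¬ Col (arrs s aCol) (swap e)
    ¬ē (inj₁ refl) = ¬c̄
    ¬ē (inj₂ refl) = ¬c
    unmarked₂ : e₀ ∈ₗ L → swap e₀ ∈ₗ L → eval s unmarkedEnds ≡ 0
    unmarked₂ p q = cong₂ _+_ (diff-≡ (trans (cong (arrs s aMark) m₁) (Search.marked search p))) (diff-≡ (trans (cong (arrs s aMark) m₂) (Search.marked search q)))
    both : ∀ {e} → e ≡ e₀ ⊎ e ≡ swap e₀ → e ∈ₗ L → swap e ∈ₗ L → eval s unmarkedEnds ≡ 0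
    both (inj₁ refl) p q = unmarked₂ p q
    both (inj₂ refl) p q = unmarked₂ q p
    e₀∈ : eval s unmarkedEnds ≡ 0 → e₀ ∈ₗ L
    e₀∈ z = Search.unmarked search (trans (cong (arrs s aMark) (sym m₁)) (≡-diff (m+n≡0⇒m≡0 _ z)))
    ē₀∈ : eval s unmarkedEnds ≡ 0 → swap e₀ ∈ₗ L
    ē₀∈ z = Search.unmarked search (trans (cong (arrs s aMark) (sym m₂))
      (≡-diff (m+n≡0⇒n≡0 (eval s (diff (aMark [ markIndex (reg rsx) (reg rsy) ]) (reg rstamp))) z)))
    unboth : ∀ {e} → e ≡ e₀ ⊎ e ≡ swap e₀ → eval s unmarkedEnds ≡ 0 → swap e ∈ₗ L
    unboth (inj₁ refl) = ē₀∈
    unboth (inj₂ refl) = e₀∈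

  doubleSearch-correct : ∀ {s e} → Basic s → Table s → Fresh s → Ends-at e s → e ∈ₗ arcs → swap e ∈ₗ arcs → Colouring (arrs s aCol) →
    ¬ Col (arrs s aCol) e → ¬ Col (arrs s aCol) (swap e) →
    Does doubleSearch s (λ s′ t → ∃[ k ] t ≤ base-cost + k * search-cost × Decided e s s′ k)
  doubleSearch-correct {s} {e} bs tb fr en e∈ ē∈ colr ¬c ¬c̄ =
    start-correct bs fr en ¬c ► λ { {s₁} {t₁} k₁ (le₁ , now , h≡ , σ≡ , bl) →
    start′-correct (basic-keeps k₁ bs) (ends-keeps k₁ en) e∈ ē∈ (subst (λ f → ¬ Col f (swap e)) (sym (keep-arr k₁ aCol)) ¬c̄) now h≡ σ≡ (bl (swap e)) ► λ { {s₂} {t₂} k₂ (le₂ , lk , h≡ , h′≡) →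
    lockstep-correct (basic-keeps k₂ (basic-keeps k₁ bs)) (table-keeps k₂ (table-keeps k₁ tb)) lk h≡ h′≡ ► λ { {s₃} {t₃} k₃ (le₃ , lk , z) →
    let fin = finish (Lockstep.this lk) z
        col≡ : arrs s₃ aCol ≡ arrs s aCol
        col≡ = trans (keep-arr k₃ aCol) (trans (keep-arr k₂ aCol) (keep-arr k₁ aCol))
        k = length (Finished.L fin)
    in mapDoes (λ { {s₄} {t₄} _ (le₄ , dec) → k ,
          ≤-trans (+-mono-≤ le₁ (+-mono-≤ le₂ (+-mono-≤ le₃ le₄)))
            (≤-trans (lockstep-time (cost start) (cost start′) lockstep-cost (1 + size unmarkedEnds) adopt-cost {k} {regs s₃ rh} {regs s₃ rh′}
                (Finished.length≡ fin) (Lockstep.h′≤h lk) (nonempty (Finished.start∈ fin)))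
              (≤-reflexive (costs k))) ,
          result {s₄} {k} col≡ (trans (keep-reg k₃ rans) (trans (keep-reg k₂ rans) (keep-reg k₁ rans))) dec })
      (decide-correct (basic-keeps k₃ (basic-keeps k₂ (basic-keeps k₁ bs))) (ends-keeps k₃ (ends-keeps k₂ (ends-keeps k₁ en)))
        lk fin (subst Colouring (sym col≡) colr) (subst (λ f → ¬ Col f e) (sym col≡) ¬c) (subst (λ f → ¬ Col f (swap e)) (sym col≡) ¬c̄)) } } }
    where
    costs : ∀ k → ((cost start + cost start′ + (1 + size unmarkedEnds)) + 6) + k * (lockstep-cost + lockstep-cost + lockstep-cost + adopt-cost) ≡
      base-cost + k * search-cost
    costs k rewrite base-cost≡ | search-cost≡ = refl
    result : ∀ {s₄ k s₃} → arrs s₃ aCol ≡ arrs s aCol → regs s₃ rans ≡ regs s rans → Decided e s₃ s₄ k → Decided e s s₄ k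
    result {s₄} {k} col≡ ans≡ (solved {e′} o a f g) = solved o (trans a ans≡) f (subst (λ c → Gained e′ c (arrs s₄ aCol) k) col≡ g)
    result _ _ (failed a c le) = failed a c le

  opaque
    edge-cost : ℕ
    edge-cost = (2 + (cost edgeEnds + (1 + size fresh + (base-cost + 1)))) + 8

    edge-cost≡ : edge-cost ≡ (2 + (cost edgeEnds + (1 + size fresh + (base-cost + 1)))) + 8
    edge-cost≡ = refl

    edge-time : ∀ {x t} → t ≤ base-cost + x → 2 + (cost edgeEnds + (1 + size fresh + t)) + 8 ≤ edge-cost + x
    edge-time {x} {t} le = ≤-trans (+-monoˡ-≤ 8 (+-monoʳ-≤ (2 + (cost edgeEnds + (1 + size fresh)))
        (≤-trans le (+-monoˡ-≤ x (m≤m+n base-cost 1)))))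
      (≤-reflexive (trans (cong (_+ 8) (sym (+-assoc (2 + (cost edgeEnds + (1 + size fresh))) (base-cost + 1) x)))
        (ring₃ (2 + (cost edgeEnds + (1 + size fresh) + (base-cost + 1))) x 8)))

    edge-time₀ : 2 + (cost edgeEnds + (1 + size fresh + 1)) + 8 ≤ edge-cost
    edge-time₀ = +-monoˡ-≤ 8 (+-monoʳ-≤ 2 (+-monoʳ-≤ (cost edgeEnds) (+-monoʳ-≤ (1 + size fresh) (m≤n+m 1 base-cost))))

    edge-time₁ : 2 + 1 + 8 ≤ edge-cost
    edge-time₁ = +-monoˡ-≤ 8 {3} {2 + (cost edgeEnds + (1 + size fresh + (base-cost + 1)))} (s≤s (s≤s (s≤s z≤n)))

  Total : (ℕ → ℕ) → List A → Set
  Total col pre = ∀ {e} → e ∈ₗ pre → Col col e ⊎ Col col (swap e)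

  record Progressing (pre : List A) (s : State) (τ : ℕ) : Set where
    field
      ans≡1     : regs s rans ≡ 1
      unstamped : Fresh s
      colouring : Colouring (arrs s aCol)
      total     : Total (arrs s aCol) pre
      time      : τ + free (arrs s aCol) * search-cost ≤ length pre * edge-cost + length arcs * search-cost

  record Refuted (pre : List A) (s : State) (τ : ℕ) : Set where
    field
      ans≡0   : regs s rans ≡ 0
      absurd  : Contradictory
      time    : τ ≤ length pre * edge-cost + (length arcs + length arcs) * search-cost

  edgeEnds-correct : ∀ {s pre e post} → Input s → es ≡ pre ++ e ∷ post → regs s ri ≡ length pre →
    Does edgeEnds s (Within (cost edgeEnds) (Ends-at e))
  edgeEnds-correct {s} {pre} inp eq i≡ = block edgeEnds (≤-refl , ends-at
    (trans (cong₂ (λ f k → f k) (Input.U≡ inp) i≡) (at-middle sourceᴬ pre eq))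
    (trans (cong₂ (λ f k → f k) (Input.V≡ inp) i≡) (at-middle targetᴬ pre eq)))

  fresh-eval : ∀ {s e} → Basic s → Ends-at e s →
    eval s fresh ≡ arrs s aCol (codeᴬ e) + arrs s aCol (codeᴬ (swap e))
  fresh-eval {s} {x , y} bs (ends-at x≡ y≡) = cong₂ _+_ (cong (arrs s aCol) (Basic.cell≡ bs {x = x} {y} x≡ y≡)) (cong (arrs s aCol) (Basic.cell≡ bs {x = y} {x} y≡ x≡))

  fresh≢0 : ∀ {s e} → Basic s → Ends-at e s → eval s fresh ≢ 0 → Col (arrs s aCol) e ⊎ Col (arrs s aCol) (swap e)
  fresh≢0 {s} {e} bs en ne with Col? (arrs s aCol) e | Col? (arrs s aCol) (swap e)
  ... | yes c | _     = inj₁ c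
  ... | no _  | yes c = inj₂ c
  ... | no ¬c | no ¬c̄ = ⊥-elim (¬c λ z → ¬c̄ λ z̄ → ne (trans (fresh-eval bs en) (cong₂ _+_ z z̄)))

  fresh≡0 : ∀ {s e} → Basic s → Ends-at e s → eval s fresh ≡ 0 → ¬ Col (arrs s aCol) e × ¬ Col (arrs s aCol) (swap e)
  fresh≡0 {s} {e} bs en z with z′ ← trans (sym (fresh-eval bs en)) z =
    (λ c → c (m+n≡0⇒m≡0 _ z′)) , (λ c → c (m+n≡0⇒n≡0 (arrs s aCol (codeᴬ e)) z′))

  snoc≤ : ∀ (pre : List A) e X {t} → t ≤ suc (length pre) * edge-cost + X → t ≤ length (pre ∷ʳ e) * edge-cost + X
  snoc≤ pre e X le = subst (λ k → _ ≤ k * edge-cost + X) (sym (length-∷ʳ pre e)) le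

  Outcome : List A → State → ℕ → Set
  Outcome pre s τ = Progressing pre s τ ⊎ Refuted pre s τ

  assignEdge-correct : ∀ {s pre e post τ} → Basic s → Table s → Input s → es ≡ pre ++ e ∷ post → regs s ri ≡ length pre →
    Outcome pre s τ → Does assignEdge s (λ s′ t → Outcome (pre ∷ʳ e) s′ (τ + (t + 8)))
  assignEdge-correct {s} {pre} {e} {post} {τ} bs tb inp eq i≡ (inj₂ ref) = branch (λ ne → ⊥-elim (ne (Refuted.ans≡0 ref)))
    (λ _ → block skip (inj₂ (record { ans≡0 = Refuted.ans≡0 ref ; absurd = Refuted.absurd ref
      -- 11 is 2 for the failing test, 1 for `skip` and 8 for the round.
      ; time = snoc≤ pre e _ (idle edge-cost {τ} {11} {length pre} (Refuted.time ref) edge-time₁) })))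
  assignEdge-correct {s} {pre} {e} {post} {τ} bs tb inp eq i≡ (inj₁ prog) = branch
    (λ _ → edgeEnds-correct inp eq i≡ ► λ { {s₁} {t₁} k₁ (le₁ , en) →
      let bs₁ = basic-keeps k₁ bs
          col≡ : arrs s₁ aCol ≡ arrs s aCol
          col≡ = keep-arr k₁ aCol
          colr₁ : Colouring (arrs s₁ aCol)
          colr₁ = subst Colouring (sym col≡) colouring
          fr₁ : Fresh s₁
          fr₁ = λ i → subst₂ (λ f st → f i ≤ st) (sym (keep-arr k₁ aMark)) (sym (keep-reg k₁ rstamp)) (P.unstamped i)
          ans₁ : regs s₁ rans ≡ 1
          ans₁ = trans (keep-reg k₁ rans) ans≡1
          tot₁ : Total (arrs s₁ aCol) pre
          tot₁ = λ f∈ → subst (λ c → Col c _ ⊎ Col c _) (sym col≡) (total f∈)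
          time₁ : τ + free (arrs s₁ aCol) * search-cost ≤ length pre * edge-cost + length arcs * search-cost
          time₁ = subst (λ c → τ + free c * search-cost ≤ _) (sym col≡) time
      in branch
        (λ ne → block skip (inj₁ (record { ans≡1 = ans₁ ; unstamped = fr₁ ; colouring = colr₁
          ; total = λ f∈ → [ tot₁ , (λ { refl → fresh≢0 bs₁ en ne }) ]′ (∈-∷ʳ⁻ f∈)
          ; time = snoc≤ pre e _ (amortize search-cost edge-cost {τ} {_} {length pre} {free (arrs s₁ aCol)} {free (arrs s₁ aCol)} {0} time₁
              (≤-trans (+-monoˡ-≤ 8 (+-monoʳ-≤ 2 (+-monoˡ-≤ (1 + size fresh + 1) le₁))) (≤-trans edge-time₀ (m≤m+n edge-cost 0))) ≤-refl) })))
        (λ z → mapDoes (λ { {s₂} {t₂} k₂ (k , le₂ , dec) → decided {s₁} {s₂} {k} tot₁ time₁ ans₁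
              (≤-trans (+-monoˡ-≤ 8 (+-monoʳ-≤ 2 (+-monoˡ-≤ (1 + size fresh + t₂) le₁))) (edge-time le₂)) dec })
          (doubleSearch-correct bs₁ (table-keeps k₁ tb) fr₁ en e∈ (∈arcs⁺ (adj-sym (∈arcs⁻ e∈))) colr₁
            (proj₁ (fresh≡0 bs₁ en z)) (proj₂ (fresh≡0 bs₁ en z)))) })
    (λ z → case trans (sym ans≡1) z of λ ())
    where
    module P = Progressing prog
    open P
    e∈ : e ∈ₗ arcs
    e∈ = ∈-++⁺ˡ (∈-middle pre eq)
    decided : ∀ {s₁ s₂ k t} → Total (arrs s₁ aCol) pre →
      τ + free (arrs s₁ aCol) * search-cost ≤ length pre * edge-cost + length arcs * search-cost → regs s₁ rans ≡ 1 →
      t ≤ edge-cost + k * search-cost → Decided e s₁ s₂ k → Outcome (pre ∷ʳ e) s₂ (τ + t)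
    decided {s₁} {s₂} {k} {t} tot time₁ ans₁ le (solved {e′} o a fr g) = inj₁ (record
      { ans≡1 = trans a ans₁ ; unstamped = fr ; colouring = Gained.colouring g
      ; total = λ f∈ → [ (λ f∈ → [ inj₁ ∘ Gained.grows g _ , inj₂ ∘ Gained.grows g _ ]′ (tot f∈))
                       , (λ { refl → [ (λ { refl → inj₁ (Gained.coloured g) }) , (λ { refl → inj₂ (Gained.coloured g) }) ]′ o }) ]′ (∈-∷ʳ⁻ f∈)
      ; time = snoc≤ pre e _ (amortize search-cost edge-cost {τ} {t} {length pre} {free (arrs s₁ aCol)} {free (arrs s₂ aCol)} {k} time₁ le (Gained.counted g)) })
    decided {s₁} {k = k} {t} tot time₁ ans₁ le (failed a c k≤) = inj₂ (record { ans≡0 = a ; absurd = c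
      ; time = snoc≤ pre e _ (overrun search-cost edge-cost {τ} {t} {length pre} {free (arrs s₁ aCol)} {k} time₁ le k≤) })

  sat-cost : ℕ
  sat-cost = m * edge-cost + (length arcs + length arcs) * search-cost + 6

  assign2SAT-correct : ∀ {s} → Basic s → Table s → Input s → regs s rans ≡ 1 → Fresh s → (∀ k → arrs s aCol k ≡ 0) →
    Does assign2SAT s (Within sat-cost (λ s′ →
      (regs s′ rans ≡ 1 × Fresh s′ × Colouring (arrs s′ aCol) × (∀ {x y} → Adj x y → Col (arrs s′ aCol) (x , y) ⊎ Col (arrs s′ aCol) (y , x)))
      ⊎ (regs s′ rans ≡ 0 × Contradictory)))
  assign2SAT-correct {s} bs tb inp ans fr col₀ =
    mapDoes (λ { {s′} _ (τ , refl , inj₁ p) → +-monoˡ-≤ 6 (≤-trans (m≤m+n τ _) (≤-trans (Progressing.time p) (+-monoʳ-≤ (m * edge-cost) (*-monoˡ-≤ search-cost (m≤m+n (length arcs) (length arcs)))))) ,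
                   inj₁ (Progressing.ans≡1 p , Progressing.unstamped p , Progressing.colouring p , λ {x} {y} → both {arrs s′ aCol} (Progressing.total p) {x} {y})
               ; _ (τ , refl , inj₂ r) → +-monoˡ-≤ 6 (Refuted.time r) , inj₂ (Refuted.ans≡0 r , Refuted.absurd r) })
      (forList es (Basic.m≡ bs) Outcome
        (λ eq k i≡ o → mapDoes (λ _ → counted-on) (assignEdge-correct (basic-keeps k bs) (table-keeps k tb) (input-keeps k inp) eq i≡ o))
        (inj₁ (record { ans≡1 = ans ; unstamped = fr
          ; colouring = record { within = λ c → ⊥-elim (c (col₀ _)) ; asym = λ c → ⊥-elim (c (col₀ _)) ; closed = λ c → ⊥-elim (c (col₀ _)) }
          ; total = λ () ; time = *-monoˡ-≤ search-cost (free-bound (arrs s aCol)) })))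
    where
    counted-on : ∀ {pre s τ v} → Outcome pre s τ → Outcome pre (setReg s ri v) τ
    counted-on (inj₁ p) = inj₁ (record { ans≡1 = ans≡1 ; unstamped = unstamped ; colouring = colouring ; total = total ; time = time })
      where open Progressing p
    counted-on (inj₂ r) = inj₂ (record { ans≡0 = ans≡0 ; absurd = absurd ; time = time })
      where open Refuted r
    both : ∀ {col} → Total col es → ∀ {x y} → Adj x y → Col col (x , y) ⊎ Col col (y , x)
    both tot xy with ∈-++⁻ es (∈arcs⁺ xy)
    ... | inj₁ e∈ = tot e∈
    ... | inj₂ e∈ with _ , ē∈ , refl ← ∈-map⁻ swap e∈ = [ inj₂ , inj₁ ]′ (tot ē∈)

opaque
  single-time : ∀ a l A {k h} → h ≡ k → a + ((h * l + 4) + (k * A + 2)) ≤ (a + 6) + k * (l + A)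
  single-time a l A {k} refl = ≤-reflexive (trans (cong (a +_) (regroup-single (k * l) (k * A)))
    (trans (sym (+-assoc a 6 (k * l + k * A))) (cong ((a + 6) +_) (sym (*-distribˡ-+ k l A)))))
    where
    regroup-single : ∀ p q → (p + 4) + (q + 2) ≡ 6 + (p + q)
    regroup-single p q = trans (+-assoc p 4 (q + 2)) (trans (cong (p +_) (trans (sym (+-assoc 4 q 2)) (+-comm (4 + q) 2)))
      (trans (sym (+-assoc p 6 q)) (cong (_+ q) (+-comm p 6))))

-- Single searches, and the core of the first orientation.

module Cores (𝒢 : TemporalGraph) (es : List (Arc 𝒢)) (es↭ : es ↭ edges 𝒢) where
  open TemporalGraph 𝒢
  open Intervals 𝒢
  open Codes n
  open Listing 𝒢 es es↭
  open ConflictTable 𝒢 es es↭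
  open Searching 𝒢 es es↭
  open SearchLoops 𝒢 es es↭
  open TwoSAT 𝒢 es es↭

  singleSearch : Program
  singleSearch = start ⨾ close ⨾ adopt

  opaque
    single-base single-unit : ℕ
    single-base = cost start + 6
    single-unit = close-cost + adopt-cost

    single-base≡ : single-base ≡ cost start + 6
    single-base≡ = refl

    single-unit≡ : single-unit ≡ close-cost + adopt-cost
    single-unit≡ = refl

  -- When e is known not to force its reverse, the closure of e is consistent and can be adopted in
  -- full. No choice between directions depends on the size of the search, so one search is enough.
  singleSearch-correct : ∀ {s e} → Basic s → Table s → Fresh s → Ends-at e s → e ∈ₗ arcs → Colouring (arrs s aCol) →
    ¬ Col (arrs s aCol) e → ¬ Col (arrs s aCol) (swap e) → ¬ (e ⟶* swap e) →
    Does singleSearch s (λ s′ t → ∃[ k ] t ≤ single-base + k * single-unit × Fresh s′ × Gained e (arrs s aCol) (arrs s′ aCol) k)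
  singleSearch-correct {s} {e} bs tb fr en e∈ colr ¬c ¬c̄ ¬r =
    start-correct bs fr en ¬c ► λ { {s₁} {t₁} k₁ (le₁ , now , h≡ , _ , _) →
    close-correct e∈ (basic-keeps k₁ bs) (table-keeps k₁ tb) now h≡ ► λ { {s₂} {t₂} k₂ (le₂ , fin) →
    let open Finished fin
        col≡ : arrs s₂ aCol ≡ arrs s aCol
        col≡ = trans (keep-arr k₂ aCol) (keep-arr k₁ aCol)
    in mapDoes (λ { {s₃} {t₃} k₃ (le₃ , g) → length L ,
        ≤-trans (+-mono-≤ le₁ (+-mono-≤ le₂ le₃)) (≤-trans (single-time (cost start) close-cost adopt-cost {length L} {regs s₂ rh} length≡)
          (≤-reflexive (costs (length L)))) ,
        (λ i → subst₂ (λ f st → f i ≤ st) (sym (keep-arr k₃ aMark)) (sym (keep-reg k₃ rstamp)) (Search.bounded search i)) ,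
        subst (λ c → Gained e c (arrs s₃ aCol) (length L)) col≡ g })
      (adopt-finished (basic-keeps k₂ (basic-keeps k₁ bs)) e∈ (subst Colouring (sym col≡) colr)
        (subst (λ f → ¬ Col f (swap e)) (sym col≡) ¬c̄) fin (λ ē∈ → ¬r (Search.reached search ē∈))) } }
    where
    costs : ∀ k → (cost start + 6) + k * (close-cost + adopt-cost) ≡ single-base + k * single-unit
    costs k rewrite single-base≡ | single-unit≡ = refl

  module Core-phase {col : ℕ → ℕ} (colr : Colouring col) (tot : ∀ {x y} → Adj x y → Col col (x , y) ⊎ Col col (y , x)) where

    almost : Almost (Col col)
    almost = record { within = λ { {_ , _} c → ∈arcs⁻ (Colouring.within colr c) } ; total = tot
      ; asym = λ {x} {y} → Colouring.asym colr {x} {y} ; closed = λ {e} {f} → Colouring.closed colr {e} {f} }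

    open AlmostProperties almost

    CyclicWith : V → V → V → Set
    CyclicWith x y j = ∃[ t ] Cyclic t x y j

    Kept : (x y : V) → List V → ℕ → Set
    Kept x y pre v = (v ≢ 0 → Col col (x , y) × (∀ j → j ∈ₗ pre → ¬ CyclicWith x y j)) ×
                     (Col col (x , y) → (∀ j → j ∈ₗ pre → ¬ CyclicWith x y j) → v ≢ 0)

    1∸≡0 : ∀ k → 1 ∸ k ≡ 0 → k ≢ 0
    1∸≡0 (suc _) _ ()

    ≢0⇒1∸ : ∀ k → k ≢ 0 → 1 ∸ k ≡ 0
    ≢0⇒1∸ zero ne = ⊥-elim (ne refl)
    ≢0⇒1∸ (suc k) _ = 0∸n≡0 k

    coreTest-correct : ∀ {s x y j pre} → Basic s → Drawn s → arrs s aCol ≡ col → regs s rx ≡ toℕ x → regs s ry ≡ toℕ y →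
      regs s rj ≡ toℕ j → regs s rz ≡ α 𝒢 x y → Kept x y pre (regs s rt) →
      Does coreTest s (Within (cost coreTest) (λ s′ → Kept x y (pre ∷ʳ j) (regs s′ rt)))
    coreTest-correct {s} {x} {y} {j} {pre} bs dr refl x≡ y≡ j≡ z≡ (kept , lost) = branch≤
      (λ ne → block skip (≤-refl ,
        (λ v≢ → proj₁ (kept v≢) , λ i i∈ → [ proj₂ (kept v≢) i , (λ { refl (_ , c) → ne (from c) }) ]′ (∈-∷ʳ⁻ i∈)) ,
        λ c none → lost c (λ i i∈ → none i (∈-++⁺ˡ i∈))))
      (λ z → block (rt ≔ lit 0) (≤-refl , (λ ne → ⊥-elim (ne refl)) , λ c none → ⊥-elim (none j (∈-++⁺ʳ pre (here refl)) (_ , to c z))))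
      where
      ĉ : V → V → ℕ
      ĉ u v = arrs s aCol (code u v)
      value≡ : eval s acyclicity ≡ ((1 ∸ ĉ y j) + (1 ∸ ĉ j x)) + (defect (α 𝒢 x y) x y + (defect (α 𝒢 x y) y j + defect (α 𝒢 x y) j x))
      value≡ = cong₂ _+_ (cong₂ (λ k l → (1 ∸ k) + (1 ∸ l)) (cong (arrs s aCol) (Basic.cell≡ bs y≡ j≡)) (cong (arrs s aCol) (Basic.cell≡ bs j≡ x≡)))
        (cong₂ _+_ (defect≡ bs dr x≡ y≡ z≡) (cong₂ _+_ (defect≡ bs dr y≡ j≡ z≡) (defect≡ bs dr j≡ x≡ z≡)))
      from : ∀ {t} → Cyclic t x y j → eval s acyclicity ≡ 0
      from c with refl ← Mono.α≡ (Cyclic.mxy c) = trans value≡ (cong₂ _+_ (cong₂ _+_ (≢0⇒1∸ _ (Cyclic.yz c)) (≢0⇒1∸ _ (Cyclic.zx c)))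
        (cong₂ _+_ (mono⇒defect (Cyclic.mxy c)) (cong₂ _+_ (mono⇒defect (Cyclic.myz c)) (mono⇒defect (Cyclic.mzx c)))))
      to : Col (arrs s aCol) (x , y) → eval s acyclicity ≡ 0 → Cyclic (α 𝒢 x y) x y j
      to c z with z′ ← trans (sym value≡) z
             with p ← m+n≡0⇒m≡0 ((1 ∸ ĉ y j) + (1 ∸ ĉ j x)) z′ | q ← m+n≡0⇒n≡0 ((1 ∸ ĉ y j) + (1 ∸ ĉ j x)) z′
             with r ← m+n≡0⇒n≡0 (defect (α 𝒢 x y) x y) q = cyclic c
        (1∸≡0 _ (m+n≡0⇒m≡0 _ p)) (1∸≡0 _ (m+n≡0⇒n≡0 (1 ∸ ĉ y j) p))
        (defect⇒mono (m+n≡0⇒m≡0 _ q)) (defect⇒mono (m+n≡0⇒m≡0 _ r)) (defect⇒mono (m+n≡0⇒n≡0 (defect (α 𝒢 x y) y j) r))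

    Tabulated : (ℕ → ℕ) → List A → Set
    Tabulated f pre = (∀ e → f (codeᴬ e) ≢ 0 → Core e) × (∀ e → e ∈ₗ pre → Core e → f (codeᴬ e) ≢ 0)

    core-arc-cost : ℕ
    core-arc-cost = 6 + (cost coreInit + ((n * (cost coreTest + 8) + 6) + cost (aCore [ cell x̂ ŷ ]≔ t̂)))

    coreArc-correct : ∀ {s pre e post} → Basic s → Drawn s → Listed s → arrs s aCol ≡ col → arcs ≡ pre ++ e ∷ post → regs s ri ≡ length pre →
      Tabulated (arrs s aCore) pre →
      Does (fetch ⨾ coreInit ⨾ For rj rn coreTest ⨾ aCore [ cell x̂ ŷ ]≔ t̂) s
        (Within core-arc-cost (λ s′ → Tabulated (arrs s′ aCore) (pre ∷ʳ e)))
    coreArc-correct {s} {pre} {e@(x , y)} bs dr ls refl eq i≡ (sound , complete) =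
      fetched ls eq i≡ ▷ λ { {s₁} k₁ (x≡ , y≡) →
      let bs₁ = basic-keeps k₁ bs ; dr₁ = drawn-keeps k₁ dr in
      block coreInit {Q = Within (cost coreInit) (λ s₂ → regs s₂ rt ≡ col (code x y) × regs s₂ rz ≡ α 𝒢 x y × s₂ ≡ run coreInit s₁)}
        (≤-refl , trans (cong₂ (λ f k → f k) (keep-arr k₁ aCol) (Basic.cell≡ bs₁ x≡ y≡)) refl , α̂≡ bs₁ dr₁ x≡ y≡ , refl) ▷ λ { {s₂} k₂ (t≡ , z≡ , refl) →
      forVertices≤ (cost coreTest) (Basic.n≡ (basic-keeps k₂ bs₁))
        (λ vs s′ → Kept x y vs (regs s′ rt))
        (λ {vs} {j} {ws} {s₃} _ k₃ j≡ kept → coreTest-correct (basic-keeps k₃ (basic-keeps k₂ bs₁)) (drawn-keeps k₃ (drawn-keeps k₂ dr₁))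
          (trans (keep-arr k₃ aCol) (keep-arr k₁ aCol)) (trans (keep-reg k₃ rx) x≡) (trans (keep-reg k₃ ry) y≡) j≡ (trans (keep-reg k₃ rz) z≡) kept)
        ((λ ne → subst (_≢ 0) t≡ ne , λ _ ()) , λ c _ → subst (_≢ 0) (sym t≡) c) ▷ λ { {s₄} k₄ kept →
      let i = arrs s₄ aR (regs s₄ rx) + regs s₄ ry
          i≡ : i ≡ codeᴬ e
          i≡ = Basic.cell≡ (basic-keeps k₄ (basic-keeps k₂ bs₁)) (trans (keep-reg k₄ rx) x≡) (trans (keep-reg k₄ ry) y≡)
          core≡ : arrs s₄ aCore ≡ arrs s aCore
          core≡ = trans (keep-arr k₄ aCore) (keep-arr k₁ aCore)
      in block (aCore [ cell x̂ ŷ ]≔ t̂) (≤-refl , written i≡ core≡ kept) } } }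
      where
      written : ∀ {f i v} → i ≡ codeᴬ e → f ≡ arrs s aCore → Kept x y (allFin n) v → Tabulated (update f i v) (pre ∷ʳ e)
      written {i = i} {v} refl refl (kept , lost) =
        (λ f ne → stored f ne) ,
        (λ f f∈ c → recall f f∈ c)
        where
        core⇒ : Core e → v ≢ 0
        core⇒ (c , ¬cyc) = lost c (λ j _ (t , cy) → ¬cyc (t , j , cy))
        stored : ∀ f → update (arrs s aCore) (codeᴬ e) v (codeᴬ f) ≢ 0 → Core f
        stored f with codeᴬ e ℕ.≟ codeᴬ f
        ... | no _ = sound f
        ... | yes eq with refl ← codeᴬ-injective {e} {f} eq = λ ne → proj₁ (kept ne) , λ (t , j , cy) → proj₂ (kept ne) j (∈-allFin j) (t , cy)
        recall : ∀ f → f ∈ₗ pre ∷ʳ e → Core f → update (arrs s aCore) (codeᴬ e) v (codeᴬ f) ≢ 0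
        recall f f∈ c with codeᴬ e ℕ.≟ codeᴬ f
        ... | yes eq with refl ← codeᴬ-injective {e} {f} eq = core⇒ c
        ... | no ne = complete f ([ id , (λ { refl → ⊥-elim (ne refl) }) ]′ (∈-∷ʳ⁻ f∈)) c

  -- All that is remembered of the first orientation, whose colours are erased before the second
  -- pass: an acyclic set of arcs that contains the necessary ones.
  record CoreFacts (d : ℕ → ℕ) : Set where
    field
      within    : ∀ {e} → Col d e → e ∈ₗ arcs
      acyclic   : ∀ x → ¬ TransClosure (λ u v → Col d (u , v)) x x
      necessary : ∀ {x y} → Adj x y → (y , x) ⟶* (x , y) → Col d (x , y)

  core-cost : ℕ
  core-cost = length arcs * ((6 + (cost coreInit + ((n * (cost coreTest + 8) + 6) + cost (aCore [ cell x̂ ŷ ]≔ t̂)))) + 8) + 6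

  core-correct : ∀ {s} → Basic s → Drawn s → Listed s → Colouring (arrs s aCol) →
    (∀ {x y} → Adj x y → Col (arrs s aCol) (x , y) ⊎ Col (arrs s aCol) (y , x)) → (∀ k → arrs s aCore k ≡ 0) →
    Does core s (Within core-cost (λ s′ → CoreFacts (arrs s′ aCore)))
  core-correct {s} bs dr ls colr tot core₀ =
    mapDoes (λ { {s′} _ (le , sound , complete) → le , record
      { within = λ {e} c → Colouring.within colr (proj₁ (sound e c))
      ; acyclic = λ x cyc → core-acyclic x (cores (arrs s′ aCore) sound cyc)
      ; necessary = λ {x} {y} xy r → complete (x , y) (∈arcs⁺ xy) (forced xy r) } })
    (forList≤ arcs core-arc-cost (Basic.mm≡ bs) (λ pre s′ → Tabulated (arrs s′ aCore) pre)
      (λ eq k i≡ tab → coreArc-correct (basic-keeps k bs) (drawn-keeps k dr) (listed-keeps k ls) (keep-arr k aCol) eq i≡ tab)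
      ((λ e ne → ⊥-elim (ne (core₀ _))) , λ _ ()))
    where
    open Core-phase colr tot
    open AlmostProperties almost
    cores : ∀ d → (∀ e → d (codeᴬ e) ≢ 0 → Core e) → ∀ {x y} → TransClosure (λ u v → Col d (u , v)) x y → TransClosure (λ u v → Core (u , v)) x y
    cores _ sound Plus.[ e ] = Plus.[ sound _ e ]
    cores d sound (e ∷ es) = sound _ e ∷ cores d sound es
    forced : ∀ {x y} → Adj x y → (y , x) ⟶* (x , y) → Core (x , y)
    forced xy r = Ness⊆Core (xy , ⟶*⇒forces r)

  reset-cost : ℕ
  reset-cost = length arcs * ((6 + cost (aCol [ cell x̂ ŷ ]≔ lit 0)) + 8) + 6

  reset-correct : ∀ {s} → Basic s → Listed s → Colouring (arrs s aCol) →
    Does reset s (Within reset-cost (λ s′ → ∀ e → ¬ Col (arrs s′ aCol) e))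
  reset-correct {s} bs ls colr =
    mapDoes (λ { _ (le , left) → le , λ e c → proj₂ (left e c) (proj₁ (left e c)) })
    (forList≤ arcs (6 + cost (aCol [ cell x̂ ŷ ]≔ lit 0)) (Basic.mm≡ bs) (λ pre s′ → ∀ e → Col (arrs s′ aCol) e → e ∈ₗ arcs × e ∉ₗ pre)
      (λ {pre} {e} {post} {s₁} eq k i≡ left →
        fetched (listed-keeps k ls) eq i≡ ▷ λ { {s₂} k₂ (x≡ , y≡) →
        block (aCol [ cell x̂ ŷ ]≔ lit 0) (≤-refl ,
          cleared pre e (arrs s₂ aCol) (Basic.cell≡ (basic-keeps k₂ (basic-keeps k bs)) x≡ y≡)
            (subst (λ f → ∀ e → Col f e → e ∈ₗ arcs × e ∉ₗ pre) (sym (keep-arr k₂ aCol)) left)) })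
      (λ e c → Colouring.within colr c , λ ()))
    where
    cleared : ∀ pre e f {i} → i ≡ codeᴬ e → (∀ g → Col f g → g ∈ₗ arcs × g ∉ₗ pre) →
      ∀ g → Col (update f i 0) g → g ∈ₗ arcs × g ∉ₗ pre ∷ʳ e
    cleared pre e f refl left g with codeᴬ e ℕ.≟ codeᴬ g
    ... | yes _ = λ ne → ⊥-elim (ne refl)
    ... | no ne = λ c → proj₁ (left g c) , λ g∈ → [ proj₂ (left g c) , (λ { refl → ne refl }) ]′ (∈-∷ʳ⁻ g∈)

opaque
  expand-time : ∀ a b c d f B {t X} → t ≤ B + X → a + (b + (c + (d + t))) + f ≤ (a + b + c + d + B + f) + X
  expand-time a b c d f B {t} {X} le = begin
    a + (b + (c + (d + t))) + f ≡⟨ cong (_+ f) (trans (sym (+-assoc a b _)) (trans (sym (+-assoc (a + b) c _)) (sym (+-assoc (a + b + c) d t)))) ⟩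
    a + b + c + d + t + f       ≤⟨ +-monoˡ-≤ f (+-monoʳ-≤ (a + b + c + d) le) ⟩
    a + b + c + d + (B + X) + f ≡⟨ cong (_+ f) (sym (+-assoc (a + b + c + d) B X)) ⟩
    a + b + c + d + B + X + f   ≡⟨ trans (+-assoc (a + b + c + d + B) X f) (trans (cong (a + b + c + d + B +_) (+-comm X f)) (sym (+-assoc (a + b + c + d + B) f X))) ⟩
    a + b + c + d + B + f + X   ∎
    where open ≤-Reasoning

  expand-total : ∀ {τ fk lc N} r → τ + fk ≤ lc + N → r + (τ + 6) + fk ≤ (r + (lc + 6)) + N
  expand-total {τ} {fk} {lc} {N} r le = begin
    r + (τ + 6) + fk   ≡⟨ trans (+-assoc r (τ + 6) fk) (cong (r +_) (trans (+-assoc τ 6 fk) (trans (cong (τ +_) (+-comm 6 fk)) (sym (+-assoc τ fk 6))))) ⟩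
    r + (τ + fk + 6)   ≤⟨ +-monoʳ-≤ r (+-monoˡ-≤ 6 le) ⟩
    r + (lc + N + 6)   ≡⟨ trans (cong (r +_) (trans (+-assoc lc N 6) (trans (cong (lc +_) (+-comm N 6)) (sym (+-assoc lc 6 N))))) (sym (+-assoc r (lc + 6) N)) ⟩
    r + (lc + 6) + N   ∎
    where open ≤-Reasoning

  round-total : ∀ {a b c e x fk fk′ A B C E} → a ≤ A → b ≤ B → c ≤ C → e + fk′ ≤ E + fk →
    a + (b + (c + (x + e))) + fk′ ≤ (A + (B + (C + (x + E)))) + fk
  round-total {a} {b} {c} {e} {x} {fk} {fk′} {A} {B} {C} {E} p q r le = begin
    a + (b + (c + (x + e))) + fk′ ≡⟨ assoc₄ a b c x e fk′ ⟩
    a + (b + (c + (x + (e + fk′)))) ≤⟨ +-mono-≤ p (+-mono-≤ q (+-mono-≤ r (+-monoʳ-≤ x le))) ⟩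
    A + (B + (C + (x + (E + fk)))) ≡⟨ sym (assoc₄ A B C x E fk) ⟩
    A + (B + (C + (x + E))) + fk ∎
    where
    open ≤-Reasoning
    assoc₄ : ∀ a b c x e f → a + (b + (c + (x + e))) + f ≡ a + (b + (c + (x + (e + f))))
    assoc₄ a b c x e f = trans (+-assoc a _ f) (cong (a +_) (trans (+-assoc b _ f) (cong (b +_) (trans (+-assoc c _ f) (cong (c +_) (+-assoc x e f))))))

  rounds-total : ∀ c {τ t fk fk′ q q′ M} → τ + fk + q * (2 + c) ≤ M → t + fk′ ≤ c + fk → q′ < q →
    τ + (2 + t) + fk′ + q′ * (2 + c) ≤ M
  rounds-total c {τ} {t} {fk} {fk′} {q} {q′} {M} le le′ lt = begin
    τ + (2 + t) + fk′ + q′ * (2 + c) ≡⟨ cong (_+ q′ * (2 + c)) (trans (+-assoc τ (2 + t) fk′) (cong (τ +_) (+-assoc 2 t fk′))) ⟩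
    τ + (2 + (t + fk′)) + q′ * (2 + c) ≤⟨ +-monoˡ-≤ (q′ * (2 + c)) (+-monoʳ-≤ τ (+-monoʳ-≤ 2 le′)) ⟩
    τ + (2 + (c + fk)) + q′ * (2 + c) ≡⟨ cong (_+ q′ * (2 + c)) (trans (cong (τ +_) (trans (sym (+-assoc 2 c fk)) (+-comm (2 + c) fk))) (sym (+-assoc τ fk (2 + c)))) ⟩
    τ + fk + (2 + c) + q′ * (2 + c) ≡⟨ +-assoc (τ + fk) (2 + c) (q′ * (2 + c)) ⟩
    τ + fk + suc q′ * (2 + c) ≤⟨ +-monoʳ-≤ (τ + fk) (*-monoˡ-≤ (2 + c) lt) ⟩
    τ + fk + q * (2 + c) ≤⟨ le ⟩
    M ∎
    where open ≤-Reasoning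

-- Ranking the vertices along the core and orienting outwards.

module Rounds (𝒢 : TemporalGraph) (es : List (Arc 𝒢)) (es↭ : es ↭ edges 𝒢) where
  open TemporalGraph 𝒢
  open Intervals 𝒢
  open Codes n
  open Listing 𝒢 es es↭
  open ConflictTable 𝒢 es es↭
  open Searching 𝒢 es es↭
  open SearchLoops 𝒢 es es↭
  open TwoSAT 𝒢 es es↭
  open Cores 𝒢 es es↭

  Blocking : (d r : ℕ → ℕ) (round : ℕ) (f : ℕ → ℕ) → List A → Set
  Blocking d r round f pre =
    (∀ (v : V) → f (toℕ v) ≤ round) ×
    (∀ (v : V) → f (toℕ v) ≡ round → ∃[ u ] Col d (u , v) × r (toℕ u) ≡ 0) ×
    (∀ (u v : V) → (u , v) ∈ₗ pre → Col d (u , v) → r (toℕ u) ≡ 0 → f (toℕ v) ≡ round)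

  blockHeads-cost : ℕ
  blockHeads-cost = length arcs * ((6 + cost blockBody) + 8) + 6

  blockHeads-correct : ∀ {s} → Basic s → Listed s → (∀ (v : V) → arrs s aBlk (toℕ v) < regs s rround) →
    Does blockHeads s (Within blockHeads-cost (λ s′ → Blocking (arrs s aCore) (arrs s aRank) (regs s rround) (arrs s′ aBlk) arcs))
  blockHeads-correct {s} bs ls lt =
    forList≤ arcs (6 + cost blockBody) (Basic.mm≡ bs)
      (λ pre s′ → Blocking d r (regs s rround) (arrs s′ aBlk) pre)
      (λ {pre} {e} {post} {s₁} eq k i≡ blk →
        fetched (listed-keeps k ls) eq i≡ ▷ λ { {s₂} k₂ (x≡ , y≡) →
        let bs₂ = basic-keeps k₂ (basic-keeps k bs)
            core≡ : eval s₂ (aCore [ cell x̂ ŷ ]) ≡ d (codeᴬ e)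
            core≡ = cong₂ (λ f k → f k) (trans (keep-arr k₂ aCore) (keep-arr k aCore)) (Basic.cell≡ bs₂ x≡ y≡)
            rank≡ : eval s₂ (aRank [ x̂ ]) ≡ r (sourceᴬ e)
            rank≡ = cong₂ (λ f k → f k) (trans (keep-arr k₂ aRank) (keep-arr k aRank)) x≡
            blk₂ : Blocking d r (regs s rround) (arrs s₂ aBlk) pre
            blk₂ = subst (λ f → Blocking d r (regs s rround) f pre) (sym (keep-arr k₂ aBlk)) blk
        in branch≤
          (λ c → branch≤
            (λ ne → block skip (≤-refl , unblocked (arrs s₂ aBlk) e blk₂ λ _ z → ne (trans rank≡ z)))
            (λ z → block (aBlk [ ŷ ]≔ reg rround) (≤-refl ,
              blocked (arrs s₂ aBlk) e y≡ (trans (keep-reg k₂ rround) (keep-reg k rround)) (λ q → c (trans core≡ q)) (trans (sym rank≡) z) blk₂)))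
          (λ z → block skip (≤-refl , unblocked (arrs s₂ aBlk) e blk₂ λ c _ → c (trans (sym core≡) z))) })
      ((λ v → <⇒≤ (lt v)) , (λ v eq → ⊥-elim (<-irrefl eq (lt v))) , λ _ _ ())
    where
    d = arrs s aCore
    r = arrs s aRank
    unblocked : ∀ f {pre} e → Blocking d r (regs s rround) f pre → (Col d e → ¬ r (sourceᴬ e) ≡ 0) → Blocking d r (regs s rround) f (pre ∷ʳ e)
    unblocked f e (b , p , q) no-arc = b , p , λ u v e∈ c z → [ (λ e∈ → q u v e∈ c z) , (λ { refl → ⊥-elim (no-arc c z) }) ]′ (∈-∷ʳ⁻ e∈)
    blocked : ∀ f {pre i w} e → i ≡ targetᴬ e → w ≡ regs s rround → Col d e → r (sourceᴬ e) ≡ 0 →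
      Blocking d r (regs s rround) f pre → Blocking d r (regs s rround) (update f i w) (pre ∷ʳ e)
    blocked f {pre} (x , y) refl refl c z (b , p , q) = b′ , p′ , q′
      where
      b′ : ∀ v → update f (toℕ y) (regs s rround) (toℕ v) ≤ regs s rround
      b′ v with toℕ y ℕ.≟ toℕ v
      ... | yes _ = ≤-refl
      ... | no _  = b v
      p′ : ∀ v → update f (toℕ y) (regs s rround) (toℕ v) ≡ regs s rround → ∃[ u ] Col d (u , v) × r (toℕ u) ≡ 0
      p′ v with toℕ y ℕ.≟ toℕ v
      ... | no _ = p v
      ... | yes eq with refl ← Finₚ.toℕ-injective eq = λ _ → x , c , z
      q′ : ∀ u v → (u , v) ∈ₗ pre ∷ʳ (x , y) → Col d (u , v) → r (toℕ u) ≡ 0 → update f (toℕ y) (regs s rround) (toℕ v) ≡ regs s rround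
      q′ u v e∈ c z with toℕ y ℕ.≟ toℕ v
      ... | yes _ = refl
      ... | no ne = q u v ([ id , (λ { refl → ⊥-elim (ne refl) }) ]′ (∈-∷ʳ⁻ e∈)) c z

  Choice : (r b : ℕ → ℕ) (round found w : ℕ) → List A → Set
  Choice r b round found w pre =
    (found ≡ 0 × (∀ {x y} → (x , y) ∈ₗ pre → r (toℕ x) ≢ 0 ⊎ b (toℕ x) ≡ round)) ⊎
    (found ≡ 1 × ∃[ v ] w ≡ toℕ {n} v × r (toℕ v) ≡ 0 × b (toℕ v) ≢ round)

  pick-cost : ℕ
  pick-cost = length arcs * ((6 + cost pickBody) + 8) + 6

  pick-correct : ∀ {s} → Basic s → Listed s → regs s rfound ≡ 0 →
    Does pick s (Within pick-cost (λ s′ → Choice (arrs s aRank) (arrs s aBlk) (regs s rround) (regs s′ rfound) (regs s′ rw) arcs))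
  pick-correct {s} bs ls found≡ =
    forList≤ arcs (6 + cost pickBody) (Basic.mm≡ bs)
      (λ pre s′ → Choice r b (regs s rround) (regs s′ rfound) (regs s′ rw) pre)
      (λ {pre} {e} {post} {s₁} eq k i≡ ch →
        fetched (listed-keeps k ls) eq i≡ ▷ λ { {s₂} k₂ (x≡ , y≡) →
        let rank≡ : eval s₂ (aRank [ x̂ ]) ≡ r (sourceᴬ e)
            rank≡ = cong₂ (λ f k → f k) (trans (keep-arr k₂ aRank) (keep-arr k aRank)) x≡
            blk≡ : eval s₂ (aBlk [ x̂ ]) ≡ b (sourceᴬ e)
            blk≡ = cong₂ (λ f k → f k) (trans (keep-arr k₂ aBlk) (keep-arr k aBlk)) x≡
            round≡ : regs s₂ rround ≡ regs s rround
            round≡ = trans (keep-reg k₂ rround) (keep-reg k rround)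
            ch₂ : Choice r b (regs s rround) (regs s₂ rfound) (regs s₂ rw) pre
            ch₂ = subst₂ (λ f w → Choice r b (regs s rround) f w pre) (sym (keep-reg k₂ rfound)) (sym (keep-reg k₂ rw)) ch
        in branch≤
          (λ ne → block skip (≤-refl , passed e ch₂ (inj₁ (λ z → ne (trans rank≡ z)))))
          (λ z → branch≤
            (λ ne → block (rfound ≔ lit 1 ⨾ rw ≔ x̂) (≤-refl , inj₂ (refl , proj₁ e , x≡ , trans (sym rank≡) z ,
              λ q → ne (diff-≡ (trans blk≡ (trans q (sym round≡)))))))
            (λ q → block skip (≤-refl , passed e ch₂ (inj₂ (trans (sym blk≡) (trans (≡-diff q) round≡)))))) })
      (inj₁ (found≡ , λ ()))
    where
    r = arrs s aRank
    b = arrs s aBlk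
    passed : ∀ {f w pre} e → Choice r b (regs s rround) f w pre → r (sourceᴬ e) ≢ 0 ⊎ b (sourceᴬ e) ≡ regs s rround →
      Choice r b (regs s rround) f w (pre ∷ʳ e)
    passed e (inj₁ (f≡ , q)) p = inj₁ (f≡ , λ e∈ → [ q , (λ { refl → p }) ]′ (∈-∷ʳ⁻ e∈))
    passed e (inj₂ q) _ = inj₂ q

  -- Rank 0 means not yet ranked and counts as later than every rank. When all ends of edges are
  -- ranked, this alternative disappears for the heads of arcs, and the hypothesis of `led⇒¬cyclic`
  -- is left.
  Later : (r : ℕ → ℕ) → V → V → Set
  Later r x w = w ≡ x ⊎ (r (toℕ w) ≡ 0 ⊎ r (toℕ x) < r (toℕ w))

  Led : (r col : ℕ → ℕ) → Set
  Led r col = ∀ {f} → Col col f → ∃₂ λ x y → Col col (x , y) × (x , y) ⟶* f × r (toℕ x) ≢ 0 × Later r x (proj₂ f)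

  Settled : (ℕ → ℕ) → V → V → Set
  Settled col u v = Col col (u , v) ⊎ Col col (v , u)

  record Expanding (x : V) (r col : ℕ → ℕ) (pre : List A) : Set where
    field
      colouring : Colouring col
      done      : ∀ {u v} → Adj u v → r (toℕ u) ≢ 0 → u ≢ x → Settled col u v
      here-done : ∀ {y} → (x , y) ∈ₗ pre → Settled col x y
      led       : Led r col

  -- The new arcs are led by (x , y). Were the head v of a new arc ranked and different from x, then
  -- all edges at v would have been settled before, whereas neither direction of this one was
  -- coloured.
  expand-gained : ∀ {x y r col col′ pre k} → r (toℕ x) ≢ 0 → Expanding x r col pre → Gained (x , y) col col′ k →
    Expanding x r col′ (pre ∷ʳ (x , y))
  expand-gained {x} {y} {r} {col} {col′} rx≢0 ex g = record
    { colouring = Gained.colouring g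
    ; done = λ uv ru ne → grow (done uv ru ne)
    ; here-done = λ e∈ → [ (λ e∈ → grow (here-done e∈)) , (λ { refl → inj₁ (Gained.coloured g) }) ]′ (∈-∷ʳ⁻ e∈)
    ; led = λ {f} c → led′ f (Gained.new g f c) }
    where
    open Expanding ex
    grow : ∀ {u v} → Settled col u v → Settled col′ u v
    grow = [ inj₁ ∘ Gained.grows g _ , inj₂ ∘ Gained.grows g _ ]′
    led′ : ∀ f → Col col f ⊎ (¬ Col col f × ¬ Col col (swap f) × (x , y) ⟶* f) →
      ∃₂ λ x y → Col col′ (x , y) × (x , y) ⟶* f × r (toℕ x) ≢ 0 × Later r x (proj₂ f)
    led′ f (inj₁ c) with u , v , cuv , re , nz , la ← led c = u , v , Gained.grows g _ cuv , re , nz , la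
    led′ (u , v) (inj₂ (¬c , ¬c̄ , re)) = x , y , Gained.coloured g , re , rx≢0 , later
      where
      later : Later r x v
      later with v Finₚ.≟ x | r (toℕ v) ℕ.≟ 0
      ... | yes eq | _ = inj₁ eq
      ... | no _ | yes z = inj₂ (inj₁ z)
      ... | no ne | no nz = ⊥-elim ([ ¬c̄ , ¬c ]′ (done (adj-sym (∈arcs⁻ (Colouring.within (Gained.colouring g) c′))) nz ne))
        where
        c′ : Col col′ (u , v)
        c′ = Colouring.closed* (Gained.colouring g) (Gained.coloured g) re

  expand-settled : ∀ {x r col pre e} → Expanding x r col pre → (proj₁ e ≡ x → Settled col (proj₁ e) (proj₂ e)) → Expanding x r col (pre ∷ʳ e)
  expand-settled {x} {r} {col} ex se = record
    { colouring = Expanding.colouring ex ; done = Expanding.done ex ; led = Expanding.led ex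
    ; here-done = λ e∈ → [ Expanding.here-done ex , (λ { refl → se refl }) ]′ (∈-∷ʳ⁻ e∈) }

  opaque
    expand-arc-cost : ℕ
    expand-arc-cost = 6 + (1 + size (diff x̂ (reg rw))) + cost arcEnds + (1 + size fresh) + (single-base + 1) + 8

    expand-arc-cost≡ : expand-arc-cost ≡ 6 + (1 + size (diff x̂ (reg rw))) + cost arcEnds + (1 + size fresh) + (single-base + 1) + 8
    expand-arc-cost≡ = refl

    expand-arc-time : ∀ {t X} → t ≤ single-base + X →
      6 + ((1 + size (diff x̂ (reg rw))) + (cost arcEnds + ((1 + size fresh) + t))) + 8 ≤ expand-arc-cost + X
    expand-arc-time {t} {X} le = expand-time 6 (1 + size (diff x̂ (reg rw))) (cost arcEnds) (1 + size fresh) 8 (single-base + 1)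
      (≤-trans le (+-monoˡ-≤ X (m≤m+n single-base 1)))

    expand-arc-time₀ : 6 + ((1 + size (diff x̂ (reg rw))) + (cost arcEnds + ((1 + size fresh) + 1))) + 8 ≤ expand-arc-cost + 0 * single-unit
    expand-arc-time₀ = expand-time 6 (1 + size (diff x̂ (reg rw))) (cost arcEnds) (1 + size fresh) 8 (single-base + 1) {1} {0}
      (≤-trans (m≤n+m 1 single-base) (≤-reflexive (sym (+-identityʳ _))))

    expand-arc-time₁ : 6 + ((1 + size (diff x̂ (reg rw))) + 1) + 8 ≤ expand-arc-cost + 0 * single-unit
    expand-arc-time₁ = ≤-trans (+-monoˡ-≤ 8 {6 + ((1 + size (diff x̂ (reg rw))) + 1)} {6 + ((1 + size (diff x̂ (reg rw))) + (cost arcEnds + ((1 + size fresh) + 1)))}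
      (+-monoʳ-≤ 6 (+-monoʳ-≤ (1 + size (diff x̂ (reg rw))) (s≤s z≤n)))) expand-arc-time₀

  module _ {x : V} {r d : ℕ → ℕ} (rx≢0 : r (toℕ x) ≢ 0) (facts : CoreFacts d)
           (preceded : ∀ {y} → Col d (y , x) → r (toℕ y) ≢ 0 × y ≢ x) where

    expandArc-correct : ∀ {s pre e post N τ} → Basic s → Table s → Listed s → regs s rw ≡ toℕ x →
      arcs ≡ pre ++ e ∷ post → regs s ri ≡ length pre → Fresh s → Expanding x r (arrs s aCol) pre →
      τ + free (arrs s aCol) * single-unit ≤ length pre * expand-arc-cost + N →
      Does expandArc s (λ s′ t → Fresh s′ × Expanding x r (arrs s′ aCol) (pre ∷ʳ e) ×
        τ + (t + 8) + free (arrs s′ aCol) * single-unit ≤ length (pre ∷ʳ e) * expand-arc-cost + N)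
    expandArc-correct {s} {pre} {e} {post} {N} {τ} bs tb ls w≡ eq i≡ fr ex le =
      fetched ls eq i≡ ► λ { {s₁} {t₁} k₁ (le₁ , x≡ , y≡) →
      let bs₁ = basic-keeps k₁ bs
          ex₁ : Expanding x r (arrs s₁ aCol) pre
          ex₁ = subst (λ f → Expanding x r f pre) (sym (keep-arr k₁ aCol)) ex
          fr₁ : Fresh s₁
          fr₁ = λ i → subst₂ (λ f st → f i ≤ st) (sym (keep-arr k₁ aMark)) (sym (keep-reg k₁ rstamp)) (fr i)
          w₁ : regs s₁ rw ≡ toℕ x
          w₁ = trans (keep-reg k₁ rw) w≡
          le′ : τ + free (arrs s₁ aCol) * single-unit ≤ length pre * expand-arc-cost + N
          le′ = subst (λ f → τ + free f * single-unit ≤ length pre * expand-arc-cost + N) (sym (keep-arr k₁ aCol)) le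
      in branch
        (λ ne → block skip (fr₁ , expand-settled ex₁ (λ eq → ⊥-elim (ne (diff-≡ (trans x≡ (trans (cong toℕ eq) (sym w₁)))))) ,
          advance (arrs s₁ aCol) (arrs s₁ aCol) 0 le′ (≤-trans (+-monoˡ-≤ 8 (+-monoˡ-≤ ((1 + size (diff x̂ (reg rw))) + 1) le₁)) expand-arc-time₁) ≤-refl))
        (λ z → block arcEnds {Q = λ s₂ t → t ≡ cost arcEnds × Ends-at e s₂ × s₂ ≡ run arcEnds s₁} (refl , ends-at x≡ y≡ , refl) ► λ { {s₂} {t₂} k₂ (refl , en , refl) →
          let bs₂ = basic-keeps k₂ bs₁
              u≡x : proj₁ e ≡ x
              u≡x = Finₚ.toℕ-injective (trans (sym x≡) (trans (≡-diff z) w₁))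
          in branch
          (λ ne → block skip (fr₁ , expand-settled ex₁ (λ _ → fresh≢0 bs₂ en ne) ,
            advance (arrs s₁ aCol) (arrs s₁ aCol) 0 le′ (≤-trans (+-monoˡ-≤ 8 (+-monoˡ-≤ ((1 + size (diff x̂ (reg rw))) + (cost arcEnds + ((1 + size fresh) + 1))) le₁)) expand-arc-time₀) ≤-refl))
          (λ z′ → mapDoes (λ { {s₃} {t₃} k₃ (k , le₃ , fr₃ , g) → fr₃ , gain u≡x ex₁ g ,
              advance (arrs s₁ aCol) (arrs s₃ aCol) k le′
                (≤-trans (+-monoˡ-≤ 8 (+-monoˡ-≤ ((1 + size (diff x̂ (reg rw))) + (cost arcEnds + ((1 + size fresh) + t₃))) le₁)) (expand-arc-time le₃)) (Gained.counted g) })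
            (singleSearch-correct bs₂ (table-keeps k₂ (table-keeps k₁ tb)) fr₁ en (∈-middle pre eq) (Expanding.colouring ex₁)
              (proj₁ (fresh≡0 bs₂ en z′)) (proj₂ (fresh≡0 bs₂ en z′))
              (unforced u≡x ex₁ (proj₁ (fresh≡0 bs₂ en z′)) (proj₂ (fresh≡0 bs₂ en z′))))) }) }
      where
      advance : ∀ col col′ k {t} → τ + free col * single-unit ≤ length pre * expand-arc-cost + N → t ≤ expand-arc-cost + k * single-unit →
        k + free col′ ≤ free col → τ + t + free col′ * single-unit ≤ length (pre ∷ʳ e) * expand-arc-cost + N
      advance col col′ k {t} p q c = subst (λ l → τ + t + free col′ * single-unit ≤ l * expand-arc-cost + N) (sym (length-∷ʳ pre e))
        (amortize single-unit expand-arc-cost {τ} {t} {length pre} {free col} {free col′} {k} p q c)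
      gain : ∀ {col col′ k} → proj₁ e ≡ x → Expanding x r col pre → Gained e col col′ k → Expanding x r col′ (pre ∷ʳ e)
      gain refl = expand-gained rx≢0
      unforced : ∀ {col} → proj₁ e ≡ x → Expanding x r col pre → ¬ Col col e → ¬ Col col (swap e) → ¬ (e ⟶* swap e)
      -- If x → y forced y → x, then (y , x) would be necessary and hence a core arc. So y would be
      -- ranked before x, and the edge xy would be settled already.
      unforced refl ex ¬c ¬c̄ re = [ ¬c̄ , ¬c ]′ (Expanding.done ex yx (proj₁ (preceded d-yx)) (proj₂ (preceded d-yx)))
        where
        yx : Adj (proj₂ e) (proj₁ e)
        yx = adj-sym (∈arcs⁻ (∈-middle pre eq))
        d-yx : Col d (swap e)
        d-yx = CoreFacts.necessary facts yx re

    expandLoop-correct : ∀ {s} → Basic s → Table s → Listed s → regs s rw ≡ toℕ x → Fresh s → Expanding x r (arrs s aCol) [] →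
      Does (For ri rmm expandArc) s (λ s′ t → Fresh s′ × Expanding x r (arrs s′ aCol) arcs ×
        ∃[ τ ] t ≡ τ + 6 × τ + free (arrs s′ aCol) * single-unit ≤ length arcs * expand-arc-cost + free (arrs s aCol) * single-unit)
    expandLoop-correct {s} bs tb ls w≡ fr ex =
      mapDoes (λ { _ (τ , eq , fr′ , ex′ , le) → fr′ , ex′ , τ , eq , le })
        (forList arcs (Basic.mm≡ bs)
          (λ pre s′ τ → (∀ i → arrs s′ aMark i ≤ regs s′ rstamp) × Expanding x r (arrs s′ aCol) pre ×
            τ + free (arrs s′ aCol) * single-unit ≤ length pre * expand-arc-cost + free (arrs s aCol) * single-unit)
          (λ eq k i≡ (fr , ex , le) → expandArc-correct (basic-keeps k bs) (table-keeps k tb) (listed-keeps k ls) (trans (keep-reg k rw) w≡) eq i≡ fr ex le)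
          (fr , ex , ≤-refl))

  undone : (ℕ → ℕ) → ℕ
  undone r = length (filter (λ v → r (toℕ v) ℕ.≟ 0) (allFin n))

  undone-bound : ∀ r → undone r ≤ n
  undone-bound r = ≤-trans (Listₚ.length-filter (λ v → r (toℕ v) ℕ.≟ 0) (allFin n)) (≤-reflexive (Listₚ.length-tabulate {n = n} id))

  record Ranked (r col : ℕ → ℕ) (rd : ℕ) : Set where
    field
      rank<     : ∀ (v : V) → r (toℕ v) < rd
      colouring : Colouring col
      done      : ∀ {u v} → Adj u v → r (toℕ u) ≢ 0 → Settled col u v
      led       : Led r col

  AllRanked : (ℕ → ℕ) → Set
  AllRanked r = ∀ {x y} → Adj x y → r (toℕ x) ≢ 0

  -- If no candidate remains, every unranked vertex with an edge has an unranked core predecessor,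
  -- which again has an edge. In a finite acyclic digraph such a descent ends, so there is no
  -- unranked vertex with an edge.
  none-chosen : ∀ {d r b round} → CoreFacts d → Blocking d r round b arcs →
    (∀ {x y} → (x , y) ∈ₗ arcs → r (toℕ x) ≢ 0 ⊎ b (toℕ x) ≡ round) → AllRanked r
  none-chosen {d} {r} {b} {round} facts (_ , blocker , _) stuck {x} {y} xy = go (wf x) (∈arcs⁺ xy)
    where
    open CoreFacts facts
    wf : WellFounded (TransClosure (λ u v → Col d (u , v)))
    wf = spo-wellFounded record
      { isEquivalence = isEquivalence
      ; irrefl = λ { refl → acyclic _ } ; trans = Plus._++_ ; <-resp-≈ = resp₂ _ }
    go : ∀ {x y} → Acc (TransClosure (λ u v → Col d (u , v))) x → (x , y) ∈ₗ arcs → r (toℕ x) ≢ 0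
    go {x} (WF.acc rec) xy∈ z with stuck xy∈
    ... | inj₁ nz = nz z
    ... | inj₂ b≡ with u , c , z′ ← blocker x b≡ = go (rec Plus.[ c ]) (within c) z′

  module Choose {d r col : ℕ → ℕ} {rd : ℕ} {x : V} (facts : CoreFacts d) (rnk : Ranked r col rd)
                (r≡0 : r (toℕ x) ≡ 0) (unblocked : ∀ u → Col d (u , x) → r (toℕ u) ≢ 0) where
    open Ranked rnk

    r′ : ℕ → ℕ
    r′ = update r (toℕ x) rd

    rd≢0 : rd ≢ 0
    rd≢0 refl = n≮0 (rank< x)

    r′-x : r′ (toℕ x) ≡ rd
    r′-x = update-here r {toℕ x} refl

    r′-≢ : ∀ {v} → v ≢ x → r′ (toℕ v) ≡ r (toℕ v)
    r′-≢ ne = update-there r {toℕ x} (λ eq → ne (sym (Finₚ.toℕ-injective eq)))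

    ranked⇒≢ : ∀ {v} → r (toℕ v) ≢ 0 → v ≢ x
    ranked⇒≢ nz refl = nz r≡0

    preceded : ∀ {y} → Col d (y , x) → r′ (toℕ y) ≢ 0 × y ≢ x
    preceded {y} c = subst (_≢ 0) (sym (r′-≢ ne)) nz , ne
      where
      nz = unblocked y c
      ne = ranked⇒≢ nz

    expanding : Expanding x r′ col []
    expanding = record
      { colouring = colouring
      ; done = λ uv nz ne → done uv (subst (_≢ 0) (r′-≢ ne) nz)
      ; here-done = λ ()
      ; led = λ c → let (p , q , cpq , re , nz , la) = led c ; ne = ranked⇒≢ nz in
          p , q , cpq , re , subst (_≢ 0) (sym (r′-≢ ne)) nz , later ne la }
      where
      later : ∀ {p w} → p ≢ x → Later r p w → Later r′ p w
      later {p} {w} ne (inj₁ eq) = inj₁ eq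
      later {p} {w} ne (inj₂ q) with w Finₚ.≟ x
      ... | yes refl = inj₂ (inj₂ (subst₂ _<_ (sym (r′-≢ ne)) (sym r′-x) (rank< p)))
      ... | no ne′ = inj₂ ([ (λ z → inj₁ (trans (r′-≢ ne′) z)) , (λ lt → inj₂ (subst₂ _<_ (sym (r′-≢ ne)) (sym (r′-≢ ne′)) lt)) ]′ q)

    undone< : undone r′ < undone r
    undone< = filter-length-strict (λ v → r′ (toℕ v) ℕ.≟ 0) (λ v → r (toℕ v) ℕ.≟ 0) {allFin n}
      (λ {v} _ z → old v z) (∈-allFin x) (λ z → rd≢0 (trans (sym r′-x) z)) r≡0
      where
      old : ∀ v → r′ (toℕ v) ≡ 0 → r (toℕ v) ≡ 0
      old v z with v Finₚ.≟ x
      ... | yes refl = r≡0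
      ... | no ne = trans (sym (r′-≢ ne)) z

    ranked : ∀ {col′} → Expanding x r′ col′ arcs → Ranked r′ col′ (suc rd)
    ranked {col′} ex = record
      { rank< = λ v → rank′ v
      ; colouring = Expanding.colouring ex
      ; done = λ {u} uv nz → settled uv nz (u Finₚ.≟ x)
      ; led = Expanding.led ex }
      where
      rank′ : ∀ v → r′ (toℕ v) < suc rd
      rank′ v with v Finₚ.≟ x
      ... | yes refl = s≤s (≤-reflexive r′-x)
      ... | no ne = subst (_< suc rd) (sym (r′-≢ ne)) (m≤n⇒m≤1+n (rank< v))
      settled : ∀ {u v} → Adj u v → r′ (toℕ u) ≢ 0 → Dec (u ≡ x) → Settled col′ u v
      settled uv nz (yes refl) = Expanding.here-done ex (∈arcs⁺ uv)
      settled uv nz (no ne) = Expanding.done ex uv nz ne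

  RankedAt : State → Set
  RankedAt s = Ranked (arrs s aRank) (arrs s aCol) (regs s rround)

  expand-cost : ℕ
  expand-cost = cost rankChosen + (length arcs * expand-arc-cost + 6)

  Work : State → ℕ
  Work s = free (arrs s aCol) * single-unit

  expand-correct : ∀ {s x d} → Basic s → Table s → Listed s → CoreFacts d → Fresh s → RankedAt s → regs s rw ≡ toℕ x →
    arrs s aRank (toℕ x) ≡ 0 → (∀ u → Col d (u , x) → arrs s aRank (toℕ u) ≢ 0) →
    Does expand s (λ s′ t → t + Work s′ ≤ expand-cost + Work s × Fresh s′ × RankedAt s′ × regs s′ rround ≡ suc (regs s rround) × undone (arrs s′ aRank) < undone (arrs s aRank))
  expand-correct {s} {x} {d} bs tb ls facts fr rnk w≡ r≡0 unbl =
    block rankChosen {Q = λ s₁ t → t ≡ cost rankChosen × arrs s₁ aRank ≡ r′ × regs s₁ rround ≡ suc (regs s rround) × s₁ ≡ run rankChosen s}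
      (refl , cong (λ i → update (arrs s aRank) i (regs s rround)) w≡ , +-comm _ 1 , refl) ► λ { {s₁} k₁ (refl , r≡ , rd≡ , refl) →
    mapDoes (λ { {s₂} {t₂} k₂ (fr₂ , ex , τ , refl , le) →
        expand-total {τ} {Work s₂} {length arcs * expand-arc-cost} {Work s} (cost rankChosen) le , fr₂ ,
        subst₂ (λ r rd → Ranked r (arrs s₂ aCol) rd) (sym (trans (keep-arr k₂ aRank) r≡)) (sym (trans (keep-reg k₂ rround) rd≡))
          (ranked ex) ,
        trans (keep-reg k₂ rround) rd≡ ,
        subst (λ r → undone r < undone (arrs s aRank)) (sym (trans (keep-arr k₂ aRank) r≡)) undone< })
      (expandLoop-correct (subst (_≢ 0) (sym r′-x) rd≢0) facts preceded
        (basic-keeps k₁ bs) (table-keeps k₁ tb) (listed-keeps k₁ ls) w≡ fr expanding) }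
    where
    open Choose facts rnk r≡0 unbl

  record Round (s : State) : Set where
    field
      unstamped : Fresh s
      ranked    : RankedAt s
      blk<      : ∀ (v : V) → arrs s aBlk (toℕ v) < regs s rround

  data Phase (s : State) : Set where
    active : regs s rfound ≡ 1 → Round s → Phase s
    over   : regs s rfound ≡ 0 → RankedAt s → AllRanked (arrs s aRank) → Phase s

  -- A round either ranks a vertex or clears `rfound`, so this falls every time. It is at most n + 1
  -- at the start, which bounds the number of rounds.
  remaining : State → ℕ
  remaining s = regs s rfound + undone (arrs s aRank)

  round-cost : ℕ
  round-cost = 2 + (blockHeads-cost + (pick-cost + (2 + (expand-cost + 1))))

  round-correct : ∀ {s} → Basic s → Table s → Listed s → CoreFacts (arrs s aCore) → Round s → regs s rfound ≡ 1 →
    Does round s (λ s′ t → t + Work s′ ≤ round-cost + Work s × Phase s′ × remaining s′ < remaining s)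
  round-correct {s} bs tb ls facts rd found≡ =
    block (rfound ≔ lit 0) {Q = Within 2 (λ s₁ → s₁ ≡ run (rfound ≔ lit 0) s)} (≤-refl , refl) ► λ { {s₁} {t₁} k₁ (le₁ , refl) →
    let bs₁ = basic-keeps k₁ bs ; ls₁ = listed-keeps k₁ ls in
    blockHeads-correct bs₁ ls₁ (Round.blk< rd) ► λ { {s₂} {t₂} k₂ (le₂ , blk) →
    let bs₂ = basic-keeps k₂ bs₁ ; ls₂ = listed-keeps k₂ ls₁ in
    pick-correct bs₂ ls₂ (keep-reg k₂ rfound) ► λ { {s₃} {t₃} k₃ (le₃ , ch) →
    let bs₃ = basic-keeps k₃ bs₂ ; ls₃ = listed-keeps k₃ ls₂
        tb₃ = table-keeps k₃ (table-keeps k₂ (table-keeps k₁ tb))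
        rank≡ : arrs s₃ aRank ≡ arrs s aRank
        rank≡ = trans (keep-arr k₃ aRank) (keep-arr k₂ aRank)
        col≡ : arrs s₃ aCol ≡ arrs s aCol
        col≡ = trans (keep-arr k₃ aCol) (keep-arr k₂ aCol)
        core≡ : arrs s₃ aCore ≡ arrs s aCore
        core≡ = trans (keep-arr k₃ aCore) (keep-arr k₂ aCore)
        rd≡ : regs s₃ rround ≡ regs s rround
        rd≡ = trans (keep-reg k₃ rround) (keep-reg k₂ rround)
        blk₃ : Blocking (arrs s aCore) (arrs s aRank) (regs s rround) (arrs s₃ aBlk) arcs
        blk₃ = subst (λ f → Blocking (arrs s aCore) (arrs s aRank) (regs s rround) f arcs) (sym (keep-arr k₃ aBlk)) blk
        ch₃ : Choice (arrs s aRank) (arrs s₃ aBlk) (regs s rround) (regs s₃ rfound) (regs s₃ rw) arcs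
        ch₃ = subst₂ (λ r rd → Choice r (arrs s₃ aBlk) rd (regs s₃ rfound) (regs s₃ rw) arcs) (keep-arr k₂ aRank) (keep-reg k₂ rround)
          (subst (λ b → Choice (arrs s₂ aRank) b (regs s₂ rround) (regs s₃ rfound) (regs s₃ rw) arcs) (sym (keep-arr k₃ aBlk)) ch)
        rk₃ : RankedAt s₃
        rk₃ = subst (λ rd → Ranked (arrs s₃ aRank) (arrs s₃ aCol) rd) (sym rd≡)
          (subst₂ (λ r c → Ranked r c (regs s rround)) (sym rank≡) (sym col≡) (Round.ranked rd))
        work≡ : Work s₃ ≡ Work s
        work≡ = cong (λ c → free c * single-unit) col≡
        fr₃ : Fresh s₃
        fr₃ = λ i → subst₂ (λ f st → f i ≤ st) (sym (trans (keep-arr k₃ aMark) (keep-arr k₂ aMark)))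
                (sym (trans (keep-reg k₃ rstamp) (keep-reg k₂ rstamp))) (Round.unstamped rd i)
    in branch
      (λ ne → case ch₃ of λ
        { (inj₁ (z , _)) → ⊥-elim (ne z)
        ; (inj₂ (f≡1 , v , w≡ , r≡0 , b≢)) →
          mapDoes (λ { {s₄} {t₄} k₄ (le₄ , fr₄ , rk₄ , rd₄ , lt) →
              round-total {x = 2} {fk = Work s} {Work s₄} le₁ le₂ le₃ (≤-trans le₄ (+-mono-≤ (m≤m+n expand-cost 1) (≤-reflexive work≡))) ,
              active (trans (keep-reg k₄ rfound) f≡1) (record { unstamped = fr₄ ; ranked = rk₄
                ; blk< = λ u → subst₂ (λ b rd → b (toℕ u) < rd) (sym (keep-arr k₄ aBlk)) (sym (trans rd₄ (cong suc rd≡))) (s≤s (proj₁ blk₃ u)) }) ,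
              subst₂ (λ f g → f + undone (arrs s₄ aRank) < g + undone (arrs s aRank)) (sym (trans (keep-reg k₄ rfound) f≡1)) (sym found≡)
                (s≤s (subst (λ r → undone (arrs s₄ aRank) < undone r) rank≡ lt)) })
            (expand-correct bs₃ tb₃ ls₃ facts fr₃ rk₃ w≡ (trans (cong (λ r → r (toℕ v)) rank≡) r≡0)
              (λ u c z → b≢ (proj₂ (proj₂ blk₃) u v (CoreFacts.within facts c) c (trans (cong (λ r → r (toℕ u)) (sym rank≡)) z)))) })
      (λ z → case ch₃ of λ
        { (inj₂ (f≡1 , _)) → case trans (sym f≡1) z of λ ()
        ; (inj₁ (_ , stuck)) → block skip
            (round-total {x = 2} {fk = Work s} {Work s₃} le₁ le₂ le₃ (+-mono-≤ (m≤n+m 1 expand-cost) (≤-reflexive work≡)) ,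
             over z rk₃ (subst AllRanked (sym rank≡) (none-chosen {arrs s aCore} {arrs s aRank} {arrs s₃ aBlk} facts blk₃ stuck)) ,
             subst₂ (λ f g → f + undone (arrs s₃ aRank) < g + undone (arrs s aRank)) (sym z) (sym found≡) (s≤s (≤-reflexive (cong undone rank≡)))) }) } } }

  orient-cost : ℕ
  orient-cost = 4 + (length arcs * single-unit + suc n * (2 + round-cost) + 2)

  phase-ranked : ∀ {s} → Phase s → regs s rfound ≡ 0 → RankedAt s × AllRanked (arrs s aRank)
  phase-ranked (active f≡1 _) z = case trans (sym f≡1) z of λ ()
  phase-ranked (over _ rnk all) _ = rnk , all

  phase-active : ∀ {s} → Phase s → regs s rfound ≢ 0 → regs s rfound ≡ 1 × Round s
  phase-active (active f≡1 r) _ = f≡1 , r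
  phase-active (over z _ _) ne = ⊥-elim (ne z)

  orient-correct : ∀ {s} → Basic s → Table s → Listed s → CoreFacts (arrs s aCore) → Fresh s → (∀ e → ¬ Col (arrs s aCol) e) →
    (∀ k → arrs s aRank k ≡ 0) → (∀ k → arrs s aBlk k ≡ 0) →
    Does orient s (Within orient-cost (λ s′ → RankedAt s′ × AllRanked (arrs s′ aRank)))
  orient-correct {s} bs tb ls facts fr blank rank₀ blk₀ =
    block (rround ≔ lit 1 ⨾ rfound ≔ lit 1) {Q = Within 4 (λ s₁ → s₁ ≡ run (rround ≔ lit 1 ⨾ rfound ≔ lit 1) s)} (≤-refl , refl) ▷ λ { {s₁} k₁ refl →
    mapDoes (λ { {s₂} _ (τ , refl , (ph , le) , z) → +-monoˡ-≤ 2 (≤-trans (≤-trans (m≤m+n τ (Work s₂)) (m≤m+n _ _)) le) , phase-ranked ph z })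
      (while (λ s′ τ → Phase s′ × τ + Work s′ + remaining s′ * (2 + round-cost) ≤ length arcs * single-unit + suc n * (2 + round-cost)) remaining
        (λ {s₂} {τ} k₂ (ph , le) ne →
          let f≡1 , rd = phase-active ph ne in
          mapDoes (λ { {s₃} {t} _ (le′ , ph′ , lt) → (ph′ , rounds-total round-cost {τ} {t} {Work s₂} {Work s₃} {remaining s₂} {remaining s₃} le le′ lt) , lt })
            (round-correct (basic-keeps k₂ (basic-keeps k₁ bs)) (table-keeps k₂ (table-keeps k₁ tb)) (listed-keeps k₂ (listed-keeps k₁ ls))
              (subst CoreFacts (sym (keep-arr k₂ aCore)) facts) rd f≡1))
        (active refl (record { unstamped = fr
          ; ranked = record { rank< = λ v → subst (_< 1) (sym (rank₀ _)) (s≤s z≤n)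
            ; colouring = record { within = λ {e} c → ⊥-elim (blank e c) ; asym = λ {x} {y} c → ⊥-elim (blank (x , y) c) ; closed = λ {e} c → ⊥-elim (blank e c) }
            ; done = λ _ nz → ⊥-elim (nz (rank₀ _)) ; led = λ {e} c → ⊥-elim (blank e c) }
          ; blk< = λ v → subst (_< 1) (sym (blk₀ _)) (s≤s z≤n) }) ,
         +-mono-≤ (*-monoˡ-≤ single-unit (free-bound (arrs s aCol))) (*-monoˡ-≤ (2 + round-cost) (s≤s (undone-bound (arrs s aRank)))))) }

  ranked-mtto : ∀ {r col rd} → Ranked r col rd → AllRanked r → IsMTTO 𝒢 (Col col)
  ranked-mtto {r} {col} rnk all = isMTTO λ {t} {x} c → led⇒¬cyclic (λ v → r (toℕ v)) leader (suc (r (toℕ x))) ≤-refl c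
    where
    open Ranked rnk
    almost : Almost (Col col)
    almost = record { within = λ { {_ , _} c → ∈arcs⁻ (Colouring.within colouring c) } ; total = λ xy → done xy (all xy)
      ; asym = λ {x} {y} → Colouring.asym colouring {x} {y} ; closed = λ {e} {f} → Colouring.closed colouring {e} {f} }
    open AlmostProperties almost
    leader : ∀ {f} → Col col f → ∃₂ λ x y → Col col (x , y) × (x , y) ⟶* f × (proj₂ f ≡ x ⊎ r (toℕ x) < r (toℕ (proj₂ f)))
    leader {u , v} c with x , y , cxy , re , nz , la ← led c = x , y , cxy , re ,
      [ inj₁ , [ (λ z → ⊥-elim (all (adj-sym (∈arcs⁻ (Colouring.within colouring c))) z)) , inj₂ ]′ ]′ la

  mtto-resp : ∀ {O O′ : Pred A 0ℓ} → (∀ {e} → O e → O′ e) → (∀ {e} → O′ e → O e) → IsMTTO 𝒢 O → IsMTTO 𝒢 O′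
  mtto-resp to from mt = record
    { orientation = record
      { within-AP = within-AP ∘ from
      ; exactly-one = λ ab → [ (λ (p , q) → inj₁ (to p , q ∘ from)) , (λ (p , q) → inj₂ (p ∘ from , to q)) ]′ (exactly-one ab) }
    ; transitive = λ ab bc le → let (ac , lt) = transitive (from ab) (from bc) le in to ac , lt }
    where
    open IsMTTO mt
    open IsOrientation orientation

  output-cost : ℕ
  output-cost = m * (cost outputBody + 8) + 6

  output-correct : ∀ {s} → Basic s → Input s → IsMTTO 𝒢 (Col (arrs s aCol)) →
    Does output s (Within output-cost (λ s′ → IsMTTO 𝒢 (outputArcs 𝒢 es s′)))
  output-correct {s} bs inp mt =
    mapDoes (λ { {s′} _ (le , out≡) → le , mtto-resp (λ {e} → to s′ (λ k → out≡ k (Finₚ.toℕ<n k)) e) (λ {e} → from s′ (λ k → out≡ k (Finₚ.toℕ<n k)) e) mt })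
      (for≤ (cost outputBody) (Basic.m≡ bs) (λ i s′ → Written (arrs s′ aOut) i)
        (λ {i} {s₁} i<m k i≡ wr → block outputBody (≤-refl ,
          write {arrs s₁ aOut} {i} i≡ (cong (1 ∸_) (cong₂ (λ f j → f j) (keep-arr k aCol)
            (Basic.cell≡ (basic-keeps k bs)
              (trans (cong₂ (λ f j → f j) (Input.U≡ (input-keeps k inp)) i≡) (trans (cong (at (map sourceᴬ es)) (sym (Finₚ.toℕ-fromℕ< i<m))) (at-map-lookup sourceᴬ es (fromℕ< i<m))))
              (trans (cong₂ (λ f j → f j) (Input.V≡ (input-keeps k inp)) i≡) (trans (cong (at (map targetᴬ es)) (sym (Finₚ.toℕ-fromℕ< i<m))) (at-map-lookup targetᴬ es (fromℕ< i<m)))))))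
            (Finₚ.toℕ-fromℕ< i<m) wr))
        (λ _ ()))
    where
    open IsMTTO mt
    open IsOrientation orientation
    col = arrs s aCol
    Written : (ℕ → ℕ) → ℕ → Set
    Written f i = ∀ (k : Fin m) → toℕ k < i → f (toℕ k) ≡ 1 ∸ col (codeᴬ (lookup es k))
    write : ∀ {f i j v k} → j ≡ i → v ≡ 1 ∸ col (codeᴬ (lookup es k)) → toℕ k ≡ i → Written f i → Written (update f j v) (suc i)
    write {f} {k = k} refl refl refl old l (s≤s l≤) with toℕ k ℕ.≟ toℕ l
    ... | yes eq with refl ← Finₚ.toℕ-injective eq = refl
    ... | no ne = old l (≤∧≢⇒< l≤ (≢-sym ne))
    zero⇒col : ∀ {e} → 1 ∸ col (codeᴬ e) ≡ 0 → Col col e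
    zero⇒col {e} z c with () ← trans (sym z) (cong (1 ∸_) c)
    one⇒¬col : ∀ {e} → 1 ∸ col (codeᴬ e) ≡ 1 → ¬ Col col e
    one⇒¬col {e} o c with col (codeᴬ e)
    ... | zero  = c refl
    ... | suc k with () ← trans (sym (0∸n≡0 k)) o
    col⇒zero : ∀ {e} → Col col e → 1 ∸ col (codeᴬ e) ≡ 0
    col⇒zero {e} c with col (codeᴬ e)
    ... | zero  = ⊥-elim (c refl)
    ... | suc k = 0∸n≡0 k
    ¬col⇒one : ∀ {e} → ¬ Col col e → 1 ∸ col (codeᴬ e) ≡ 1
    ¬col⇒one {e} ¬c with col (codeᴬ e)
    ... | zero  = refl
    ... | suc k = ⊥-elim (¬c λ ())
    exclusive : ∀ {x y} → Col col (x , y) → ¬ Col col (y , x)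
    exclusive c c′ = [ (λ p → proj₂ p c′) , (λ q → proj₁ q c) ]′ (exactly-one (within-AP c))
    from : ∀ s′ → (∀ k → arrs s′ aOut (toℕ k) ≡ 1 ∸ col (codeᴬ (lookup es k))) → ∀ e → outputArcs 𝒢 es s′ e → Col col e
    from s′ out≡ e (k , inj₁ (refl , z)) = zero⇒col {lookup es k} (trans (sym (out≡ k)) z)
    from s′ out≡ (x , y) (k , inj₂ (eq , o)) with exactly-one (∈arcs⁻ (∈-++⁺ˡ (subst (_∈ₗ es) eq (∈-lookup k))))
    ... | inj₂ (_ , c) = c
    ... | inj₁ (c , _) = ⊥-elim (one⇒¬col {y , x} (subst (λ e → 1 ∸ col (codeᴬ e) ≡ 1) eq (trans (sym (out≡ k)) o)) c)
    to : ∀ s′ → (∀ k → arrs s′ aOut (toℕ k) ≡ 1 ∸ col (codeᴬ (lookup es k))) → ∀ e → Col col e → outputArcs 𝒢 es s′ e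
    to s′ out≡ (x , y) c with ∈-++⁻ es (∈arcs⁺ (within-AP c))
    ... | inj₁ e∈ = Any.index e∈ , inj₁ (sym (lookup-index e∈) , trans (out≡ (Any.index e∈)) (col⇒zero {lookup es (Any.index e∈)} (subst (Col col) (lookup-index e∈) c)))
    ... | inj₂ e∈ with (u , v) , ē∈ , refl ← ∈-map⁻ swap e∈ =
      Any.index ē∈ , inj₂ (sym (lookup-index ē∈) , trans (out≡ (Any.index ē∈)) (¬col⇒one {lookup es (Any.index ē∈)} (subst (¬_ ∘ Col col) (lookup-index ē∈) (exclusive c))))

-- Counting the scanned neighbours.

sum-mono : ∀ {X : Set} {f g : X → ℕ} xs → (∀ x → f x ≤ g x) → sum (map f xs) ≤ sum (map g xs)
sum-mono [] _ = z≤n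
sum-mono (x ∷ xs) le = +-mono-≤ (le x) (sum-mono xs le)

sum-bounded : ∀ {X : Set} {f : X → ℕ} c xs → (∀ x → f x ≤ c) → sum (map f xs) ≤ length xs * c
sum-bounded c [] _ = z≤n
sum-bounded c (x ∷ xs) le = +-mono-≤ (le x) (sum-bounded c xs le)

sum-+ : ∀ {X : Set} (f g : X → ℕ) xs → sum (map (λ x → f x + g x) xs) ≡ sum (map f xs) + sum (map g xs)
sum-+ f g [] = refl
sum-+ f g (x ∷ xs) = trans (cong (f x + g x +_) (sum-+ f g xs)) (interchange (f x) (g x) (sum (map f xs)) (sum (map g xs)))

sum-product : ∀ {X Y : Set} (f : X → Y → ℕ) xs ys →
  sum (map (λ x → sum (map (f x) ys)) xs) ≡ sum (map (λ (x , y) → f x y) (cartesianProduct xs ys))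
sum-product f [] ys = refl
sum-product f (x ∷ xs) ys = trans (cong₂ _+_ (cong sum (Listₚ.map-∘ ys)) (sum-product f xs ys))
  (trans (sym (sum-++ (map f′ (map (x ,_) ys)) (map f′ (cartesianProduct xs ys))))
    (cong sum (sym (Listₚ.map-++ f′ (map (x ,_) ys) (cartesianProduct xs ys)))))
  where
  f′ = λ (x , y) → f x y

sum-support : ∀ {X : Set} {P : X → Set} (P? : ∀ x → Dec (P x)) {f : X → ℕ} c xs → (∀ x → f x ≤ c) → (∀ x → ¬ P x → f x ≡ 0) →
  sum (map f xs) ≤ length (filter P? xs) * c
sum-support P? c [] _ _ = z≤n
sum-support P? c (x ∷ xs) le z with ih ← sum-support P? c xs le z | P? x
... | yes _ = +-mono-≤ (le x) ih
... | no ¬p = ≤-trans (+-monoˡ-≤ _ (≤-reflexive (z x ¬p))) ih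

length-concatMap : ∀ {X Y : Set} (f : X → List Y) k xs → (∀ x → length (f x) ≡ k) → length (concatMap f xs) ≡ length xs * k
length-concatMap f k [] _ = refl
length-concatMap f k (x ∷ xs) eq = trans (Listₚ.length-++ (f x)) (cong₂ _+_ (eq x) (length-concatMap f k xs eq))

module Counting (𝒢 : TemporalGraph) (es : List (Arc 𝒢)) (es↭ : es ↭ edges 𝒢) where
  open TemporalGraph 𝒢
  open Intervals 𝒢
  open Codes n
  open Listing 𝒢 es es↭
  open ConflictTable 𝒢 es es↭

  private
    indicator : V → V → ℕ
    indicator u j with u Finₚ.≟ j
    ... | yes _ = 1
    ... | no _  = 0

    indicator-∉ : ∀ u {js} → All (u ≢_) js → sum (map (indicator u) js) ≡ 0
    indicator-∉ u [] = refl
    indicator-∉ u {j ∷ js} (ne ∷ nes) with u Finₚ.≟ j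
    ... | yes eq = ⊥-elim (ne eq)
    ... | no _ = indicator-∉ u nes

    indicator-sum : ∀ u {js} → Unique js → sum (map (indicator u) js) ≤ 1
    indicator-sum u [] = z≤n
    indicator-sum u {j ∷ js} (j∉ ∷ un) with u Finₚ.≟ j
    ... | yes refl = s≤s (≤-reflexive (indicator-∉ u j∉))
    ... | no _ = indicator-sum u un

    nb-∷ : ∀ u v xs j → length (nb j ((u , v) ∷ xs)) ≤ indicator u j + length (nb j xs)
    nb-∷ u v xs j with u Finₚ.≟ j
    ... | yes _ = ≤-refl
    ... | no _  = ≤-refl

  -- Each arc is counted at its source only.
  degree-sum : ∀ xs → sum (map (λ j → length (nb j xs)) (allFin n)) ≤ length xs
  degree-sum [] = ≤-trans (sum-bounded 0 (allFin n) (λ _ → z≤n)) (≤-reflexive (*-zeroʳ (length (allFin n))))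
  degree-sum ((u , v) ∷ xs) = begin
    sum (map (λ j → length (nb j ((u , v) ∷ xs))) (allFin n)) ≤⟨ sum-mono (allFin n) (nb-∷ u v xs) ⟩
    sum (map (λ j → indicator u j + length (nb j xs)) (allFin n)) ≡⟨ sum-+ (indicator u) (λ j → length (nb j xs)) (allFin n) ⟩
    sum (map (indicator u) (allFin n)) + sum (map (λ j → length (nb j xs)) (allFin n)) ≤⟨ +-mono-≤ (indicator-sum u (Uniqueₚ.allFin⁺ n)) (degree-sum xs) ⟩
    suc (length xs) ∎
    where open ≤-Reasoning

  Scanning : A × V → Set
  Scanning ((x , y) , j) = 0 < α 𝒢 j x × All-Mono j x y

  scanning? : ∀ p → Dec (Scanning p)
  scanning? ((x , y) , j) = (0 ℕ.<? α 𝒢 j x) ×-dec All-Mono? j x y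

  opaque
    unfolding scanned

    scanned≤ : ∀ e j → scanned e j ≤ length (nb j arcs)
    scanned≤ (x , y) j with 0 ℕ.<? α 𝒢 j x | All-Mono? j x y
    ... | yes _ | yes _ = ≤-refl
    ... | yes _ | no _  = z≤n
    ... | no _  | _     = z≤n

    scanned-support : ∀ p → ¬ Scanning p → scanned (proj₁ p) (proj₂ p) ≡ 0
    scanned-support ((x , y) , j) ¬p with 0 ℕ.<? α 𝒢 j x | All-Mono? j x y
    ... | yes p | yes q = ⊥-elim (¬p (p , q))
    ... | yes _ | no _  = refl
    ... | no _  | _     = refl

  total-scans : ℕ
  total-scans = sum (map scans arcs)

  -- For a fixed arc, every third vertex scans at most its own neighbours, and the degrees add up to
  -- at most the number of arcs.
  scans≤arcs² : total-scans ≤ length arcs * length arcs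
  scans≤arcs² = sum-bounded (length arcs) arcs λ e → ≤-trans (sum-mono (allFin n) (scanned≤ e)) (degree-sum arcs)

  private
    Tri : V → V → V → Set
    Tri x y z = ∃[ t ] Mono (suc t) x y × Mono (suc t) y z × Mono (suc t) x z

    tri-swap₁ : ∀ {x y z} → Tri x y z → Tri y x z
    tri-swap₁ (t , p , q , r) = t , mono-sym p , r , q

    tri-swap₂ : ∀ {x y z} → Tri x y z → Tri x z y
    tri-swap₂ (t , p , q , r) = t , r , mono-sym q , p

    tri⇒monolabel : ∀ {x y z} → Tri x y z → MonolabelTriangle 𝒢 x y z
    tri⇒monolabel (t , p , q , r) with xy , l₁ ← mono⇒label p | yz , l₂ ← mono⇒label q | xz , l₃ ← mono⇒label r =
      (xy , yz , xz) , trans l₁ (sym l₂) , trans l₂ (sym l₃) , t , l₁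

    tri-≢ : ∀ {x y z} → Tri x y z → x ≢ y
    tri-≢ (t , p , _) = adj⇒≢ (proj₁ (mono⇒label p))

    Triple = V × V × V

    arrangements : Triple → List (A × V)
    arrangements (a , b , c) =
      ((a , b) , c) ∷ ((b , a) , c) ∷ ((a , c) , b) ∷ ((c , a) , b) ∷ ((b , c) , a) ∷ ((c , b) , a) ∷ []

    sorted∈ : ∀ {a b c} → a Fin.< b → b Fin.< c → Tri a b c → (a , b , c) ∈ₗ monolabelTriangles 𝒢
    sorted∈ {a} {b} {c} a<b b<c t = ∈-filter⁺ _ (∈-cartesianProduct⁺ (∈-allFin a) (∈-cartesianProduct⁺ (∈-allFin b) (∈-allFin c)))
      (a<b , b<c , tri⇒monolabel t)

    arranged : ∀ {a b c p} → a Fin.< b → b Fin.< c → Tri a b c → p ∈ₗ arrangements (a , b , c) →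
      p ∈ₗ concatMap arrangements (monolabelTriangles 𝒢)
    arranged a<b b<c t p∈ = ∈-concatMap⁺ arrangements (lose (sorted∈ a<b b<c t) p∈)

    tri∈ : ∀ {x y z} → Tri x y z → ((x , y) , z) ∈ₗ concatMap arrangements (monolabelTriangles 𝒢)
    tri∈ {x} {y} {z} t with Finₚ.<-cmp x y | Finₚ.<-cmp y z | Finₚ.<-cmp x z
    ... | tri≈ _ eq _ | _ | _ = ⊥-elim (tri-≢ t eq)
    ... | _ | tri≈ _ eq _ | _ = ⊥-elim (tri-≢ (tri-swap₂ (tri-swap₁ t)) eq)
    ... | _ | _ | tri≈ _ eq _ = ⊥-elim (tri-≢ (tri-swap₂ t) eq)
    ... | tri< xy _ _ | tri< yz _ _ | _ = arranged xy yz t (here refl)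
    ... | tri> _ _ yx | _ | tri< xz _ _ = arranged yx xz (tri-swap₁ t) (there (here refl))
    ... | _ | tri> _ _ zy | tri< xz _ _ = arranged xz zy (tri-swap₂ t) (there (there (here refl)))
    ... | _ | tri< yz _ _ | tri> _ _ zx = arranged yz zx (tri-swap₂ (tri-swap₁ t)) (there (there (there (here refl))))
    ... | tri< xy _ _ | _ | tri> _ _ zx = arranged zx xy (tri-swap₁ (tri-swap₂ t)) (there (there (there (there (here refl)))))
    ... | tri> _ _ yx | tri> _ _ zy | _ = arranged zy yx (tri-swap₁ (tri-swap₂ (tri-swap₁ t))) (there (there (there (there (there (here refl))))))

    scanning⇒tri : ∀ {x y j} → Scanning ((x , y) , j) → Tri x y j
    scanning⇒tri {x} {y} {j} (0<α , jx , xy , jy) with α 𝒢 x y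
    ... | zero  = ⊥-elim (n≮0 (subst (0 <_) (Mono.α≡ jx) 0<α))
    ... | suc t = t , xy , mono-sym jy , mono-sym jx

  -- Scans occur only for an arc and a third vertex that form a monolabel triangle. A triangle
  -- accounts for six such pairs, and a pair scans at most n neighbours. The positive `α j x`
  -- required for a scan excludes three pairwise non-adjacent vertices, which would pass the
  -- comparisons with t = 0.
  scans≤triangles : total-scans ≤ (#monolabelTriangles 𝒢 * 6) * n
  scans≤triangles = begin
    sum (map scans arcs) ≡⟨ sum-product scanned arcs (allFin n) ⟩
    sum (map (λ (e , j) → scanned e j) pairs) ≤⟨ sum-support scanning? n pairs (λ (e , j) → ≤-trans (scanned≤ e j) (deg-bound j)) scanned-support ⟩
    length (filter scanning? pairs) * n ≤⟨ *-monoˡ-≤ n (unique-⊆-length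
      (Uniqueₚ.filter⁺ scanning? (Uniqueₚ.cartesianProduct⁺ arcs-unique (Uniqueₚ.allFin⁺ n)))
      (λ {p} p∈ → tri∈ (scanning⇒tri (proj₂ (∈-filter⁻ scanning? {xs = pairs} p∈))))) ⟩
    length (concatMap arrangements (monolabelTriangles 𝒢)) * n ≡⟨ cong (_* n) (length-concatMap arrangements 6 (monolabelTriangles 𝒢) (λ _ → refl)) ⟩
    (#monolabelTriangles 𝒢 * 6) * n ∎
    where
    open ≤-Reasoning
    pairs = cartesianProduct arcs (allFin n)

  -- The two estimates are 6 k n and (2 m)² = 4 m²; the larger factor 6 serves for both, so that it
  -- can be taken out of the minimum.
  scans-bound : total-scans ≤ 6 * ((#monolabelTriangles 𝒢 * n) ⊓ (m * m))
  scans-bound = ≤-trans (⊓-glb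
      (≤-trans scans≤triangles (≤-reflexive (trans (cong (_* n) (*-comm (#monolabelTriangles 𝒢) 6)) (*-assoc 6 (#monolabelTriangles 𝒢) n))))
      (≤-trans scans≤arcs² (≤-trans (≤-reflexive (cong (λ l → l * l) length-arcs)) (square m))))
    (≤-reflexive (sym (*-distribˡ-⊓ 6 (#monolabelTriangles 𝒢 * n) (m * m))))
    where
    square : ∀ m → (m + m) * (m + m) ≤ 6 * (m * m)
    square m = ≤-trans (≤-reflexive (trans (*-distribˡ-+ (m + m) m m) (cong₂ _+_ (*-distribʳ-+ m m m) (*-distribʳ-+ m m m))))
      (≤-trans (≤-reflexive (trans (+-assoc q q (q + q)) (cong (λ k → q + (q + (q + k))) (sym (+-identityʳ q)))))
        (*-monoˡ-≤ q (≤ᵇ⇒≤ 4 6 tt)))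
      where
      q = m * m

-- From explicit costs to a single constant.

record Bound (X c U : ℕ) : Set where
  constructor bound
  field
    proof : X ≤ c * U
open Bound

infixr 5 _⊞_
_⊞_ : ∀ {X Y c d U} → Bound X c U → Bound Y d U → Bound (X + Y) (c + d) U
_⊞_ {c = c} {d} {U} p q = bound (≤-trans (+-mono-≤ (proof p) (proof q)) (≤-reflexive (sym (*-distribʳ-+ U c d))))

-- The expected sums of constants are compared by evaluation, not by unification.
exactly : ∀ {X c U} X′ c′ → Bound X c U → X ≡ X′ → c ≡ c′ → Bound X′ c′ U
exactly _ _ b refl refl = b

rearrange : ∀ M u → 6 * M * u ≡ 6 * u * M
rearrange M u = trans (*-assoc 6 M u) (trans (cong (6 *_) (*-comm M u)) (sym (*-assoc 6 u M)))

resp-bound : ∀ {X Y c U} → X ≡ Y → Bound Y c U → Bound X c U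
resp-bound refl b = b

rebound : ∀ {X c U V} → U ≤ V → Bound X c U → Bound X c V
rebound {c = c} le b = bound (≤-trans (proof b) (*-monoʳ-≤ c le))

flat : ∀ a {U} → 1 ≤ U → Bound a a U
flat a le = bound (≤-trans (≤-reflexive (sym (*-identityʳ a))) (*-monoʳ-≤ a le))

times : ∀ {X c U} k → Bound X c U → Bound (k * X) c (k * U)
times {X} {c} {U} k b = bound (≤-trans (*-monoʳ-≤ k (proof b))
  (≤-reflexive (trans (sym (*-assoc k c U)) (trans (cong (_* U) (*-comm k c)) (*-assoc c k U)))))

doubled : ∀ {X c U V} → V ≤ U + U → Bound X c V → Bound X (c + c) U
doubled {c = c} {U} le b = bound (≤-trans (proof b) (≤-trans (*-monoʳ-≤ c le)
  (≤-reflexive (trans (*-distribˡ-+ c U U) (sym (*-distribʳ-+ U c c))))))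

opaque
  -- Each constant follows the sum that makes up the corresponding cost: factors n and m become part
  -- of the unit, and a term that runs over all 2m arcs, or over n + 1 rounds, is written twice. The
  -- names involve no graph, so `kTotal` is one constant for all inputs.
  kPop kClose kSingle kLock kSearch kRows kList kMatrices kTests kSat kCore kReset kRound kOrient kOutput kBase kEdge kExpandArc kTotal : ℕ
  kPop = cost popFetch + ((cost visit + 8) + 6)
  kClose = 4 + kPop
  kSingle = kClose + 40
  kLock = 4 + (kPop + cost exchange)
  kSearch = ((kLock + kLock) + kLock) + 40
  kRows = (15 + 6) + (2 + (2 + ((15 + 6) + 4)))
  kList = (cost listArcsBody + 8) + 6
  kMatrices = ((6 + cost matricesBody + 8) + (6 + cost matricesBody + 8)) + 6
  kTests = (((((cost conflictTest + 9) + 8) + 26) + (((cost conflictTest + 9) + 8) + 26)) + 6 * (cost scanNeighbour + 8)) + 6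
  kBase = (cost start + cost start′ + (1 + size unmarkedEnds)) + 6
  kEdge = (2 + (cost edgeEnds + (1 + size fresh + (kBase + 1)))) + 8
  kSat = kEdge + ((kSearch + kSearch) + (kSearch + kSearch)) + 6
  kCore = (((6 + (cost coreInit + (((cost coreTest + 8) + 6) + cost (aCore [ cell x̂ ŷ ]≔ t̂)))) + 8) +
           ((6 + (cost coreInit + (((cost coreTest + 8) + 6) + cost (aCore [ cell x̂ ŷ ]≔ t̂)))) + 8)) + 6
  kReset = (((6 + cost (aCol [ cell x̂ ŷ ]≔ lit 0)) + 8) + ((6 + cost (aCol [ cell x̂ ŷ ]≔ lit 0)) + 8)) + 6
  kExpandArc = 6 + (1 + size (diff x̂ (reg rw))) + cost arcEnds + (1 + size fresh) + ((cost start + 6) + 1) + 8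
  kRound = 2 + (2 + ((((6 + cost blockBody) + 8) + ((6 + cost blockBody) + 8) + 6) + ((((6 + cost pickBody) + 8) + ((6 + cost pickBody) + 8) + 6) +
    (2 + ((cost rankChosen + (kExpandArc + kExpandArc + 6)) + 1)))))
  kOrient = 4 + (((kSingle + kSingle) + (kRound + kRound)) + 2)
  kOutput = (cost outputBody + 8) + 6
  kTotal = 4 + (kRows + (kList + (kMatrices + (kTests + (2 + (kSat + (2 + ((kCore + (kReset + (kOrient + kOutput))) + 1))))))))

opaque
  unfolding kTotal

  4≤kTotal : 4 ≤ kTotal
  4≤kTotal = ≤ᵇ⇒≤ 4 kTotal tt

-- The whole program and its running time.

module Assembly (𝒢 : TemporalGraph) (es : List (Arc 𝒢)) (es↭ : es ↭ edges 𝒢) where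
  open TemporalGraph 𝒢
  open Intervals 𝒢
  open Codes n
  open Listing 𝒢 es es↭
  open ConflictTable 𝒢 es es↭
  open Searching 𝒢 es es↭
  open SearchLoops 𝒢 es es↭
  open TwoSAT 𝒢 es es↭
  open Cores 𝒢 es es↭
  open Rounds 𝒢 es es↭
  open Counting 𝒢 es es↭

  Result : State → Set
  Result s = (regs s rans ≡ 1 × IsMTTO 𝒢 (outputArcs 𝒢 es s)) ⊎ (regs s rans ≡ 0 × Contradictory)

  second-cost main-cost : ℕ
  second-cost = core-cost + (reset-cost + (orient-cost + output-cost))
  main-cost = rows-cost + ((m * (cost listArcsBody + 8) + 6) + ((length arcs * (6 + cost matricesBody + 8) + 6) +
    (conflicts-cost + (2 + (sat-cost + (2 + (second-cost + 1)))))))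

  second-phase : ∀ {s} → Basic s → Table s → Listed s → Drawn s → Input s → Fresh s → Colouring (arrs s aCol) →
    (∀ {x y} → Adj x y → Col (arrs s aCol) (x , y) ⊎ Col (arrs s aCol) (y , x)) → regs s rans ≡ 1 →
    (∀ k → arrs s aCore k ≡ 0) → (∀ k → arrs s aRank k ≡ 0) → (∀ k → arrs s aBlk k ≡ 0) →
    Does (core ⨾ reset ⨾ orient ⨾ output) s (Within second-cost Result)
  second-phase {s} bs tb ls dr inp fr colr tot ans core₀ rank₀ blk₀ =
    core-correct bs dr ls colr tot core₀ ▷ λ { {s₁} k₁ facts →
    let bs₁ = basic-keeps k₁ bs ; ls₁ = listed-keeps k₁ ls ; tb₁ = table-keeps k₁ tb ; inp₁ = input-keeps k₁ inp in
    reset-correct bs₁ ls₁ (subst Colouring (sym (keep-arr k₁ aCol)) colr) ▷ λ { {s₂} k₂ blank →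
    let bs₂ = basic-keeps k₂ bs₁ ; ls₂ = listed-keeps k₂ ls₁ ; tb₂ = table-keeps k₂ tb₁ ; inp₂ = input-keeps k₂ inp₁ in
    orient-correct bs₂ tb₂ ls₂ (subst CoreFacts (sym (keep-arr k₂ aCore)) facts)
      (λ i → subst₂ (λ f st → f i ≤ st) (sym (trans (keep-arr k₂ aMark) (keep-arr k₁ aMark))) (sym (trans (keep-reg k₂ rstamp) (keep-reg k₁ rstamp))) (fr i))
      blank
      (λ i → trans (cong (λ f → f i) (trans (keep-arr k₂ aRank) (keep-arr k₁ aRank))) (rank₀ i))
      (λ i → trans (cong (λ f → f i) (trans (keep-arr k₂ aBlk) (keep-arr k₁ aBlk))) (blk₀ i)) ▷ λ { {s₃} k₃ (rnk , all) →
    mapDoes (λ { k₄ (le , mt) → le , inj₁ (trans (keep-reg k₄ rans) (trans (keep-reg k₃ rans) (trans (keep-reg k₂ rans) (trans (keep-reg k₁ rans) ans))) , mt) })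
      (output-correct (basic-keeps k₃ bs₂) (input-keeps k₃ inp₂) (ranked-mtto rnk all)) } } }

  main-phase : Does (rows ⨾ listArcs ⨾ matrices ⨾ conflicts ⨾ rans ≔ lit 1 ⨾ assign2SAT ⨾
     If reg rans Then (core ⨾ reset ⨾ orient ⨾ output) Else skip) s₀ (Within main-cost Result)
  main-phase =
    rows-correct refl refl refl ▷ λ { {s₁} k₁ bs₁ →
    let inp₁ = input-keeps k₁ (record { U≡ = refl ; V≡ = refl ; Off≡ = refl ; Lab≡ = refl }) in
    listArcs-correct bs₁ inp₁ ▷ λ { {s₂} k₂ ad →
    let bs₂ = basic-keeps k₂ bs₁ ; ls₂ = ArcData.listed ad ; inp₂ = input-keeps k₂ inp₁ in
    matrices-correct bs₂ ad (record { α₀ = zeros aα {s₂} (trans (keep-arr k₂ aα) (keep-arr k₁ aα)) refl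
        ; ω₀ = zeros aω {s₂} (trans (keep-arr k₂ aω) (keep-arr k₁ aω)) refl ; deg₀ = zeros aDeg {s₂} (trans (keep-arr k₂ aDeg) (keep-arr k₁ aDeg)) refl }) ▷ λ { {s₃} k₃ (dr₃ , ns₃) →
    let bs₃ = basic-keeps k₃ bs₂ ; ls₃ = listed-keeps k₃ ls₂ ; inp₃ = input-keeps k₃ inp₂ in
    conflicts-correct bs₃ dr₃ ns₃ ls₃ (zeros aS {s₃} (trans (keep-arr k₃ aS) (trans (keep-arr k₂ aS) (keep-arr k₁ aS))) refl) ▷ λ { {s₄} k₄ tb₄ →
    let bs₄ = basic-keeps k₄ bs₃ ; ls₄ = listed-keeps k₄ ls₃ ; inp₄ = input-keeps k₄ inp₃ ; dr₄ = drawn-keeps k₄ dr₃ in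
    block (rans ≔ lit 1) {Q = Within 2 (λ s₅ → s₅ ≡ run (rans ≔ lit 1) s₄)} (≤-refl , refl) ▷ λ { {s₅} k₅ refl →
    let bs₅ = basic-keeps k₅ bs₄ ; ls₅ = listed-keeps k₅ ls₄ ; inp₅ = input-keeps k₅ inp₄ ; dr₅ = drawn-keeps k₅ dr₄ ; tb₅ = table-keeps k₅ tb₄ in
    assign2SAT-correct bs₅ tb₅ inp₅ refl
      (λ i → ≤-reflexive (trans (zeros aMark {s₄} (trans (keep-arr k₄ aMark) (trans (keep-arr k₃ aMark) (trans (keep-arr k₂ aMark) (keep-arr k₁ aMark)))) refl i)
         (sym (trans (keep-reg k₄ rstamp) (trans (keep-reg k₃ rstamp) (trans (keep-reg k₂ rstamp) (keep-reg k₁ rstamp)))))))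
      (zeros aCol {s₄} (trans (keep-arr k₄ aCol) (trans (keep-arr k₃ aCol) (trans (keep-arr k₂ aCol) (keep-arr k₁ aCol)))) refl) ▷ λ
      { {s₆} k₆ (inj₁ (ans , fr , colr , tot)) → branch≤
          (λ _ → second-phase (basic-keeps k₆ bs₅) (table-keeps k₆ tb₅) (listed-keeps k₆ ls₅) (drawn-keeps k₆ dr₅) (input-keeps k₆ inp₅) fr colr tot ans
            (zeros aCore {s₆} (trans (keep-arr k₆ aCore) (trans (keep-arr k₄ aCore) (trans (keep-arr k₃ aCore) (trans (keep-arr k₂ aCore) (keep-arr k₁ aCore))))) refl)
            (zeros aRank {s₆} (trans (keep-arr k₆ aRank) (trans (keep-arr k₄ aRank) (trans (keep-arr k₃ aRank) (trans (keep-arr k₂ aRank) (keep-arr k₁ aRank))))) refl)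
            (zeros aBlk {s₆} (trans (keep-arr k₆ aBlk) (trans (keep-arr k₄ aBlk) (trans (keep-arr k₃ aBlk) (trans (keep-arr k₂ aBlk) (keep-arr k₁ aBlk))))) refl))
          (λ z → case trans (sym ans) z of λ ())
      ; {s₆} k₆ (inj₂ (ans , c)) → branch≤ (λ ne → ⊥-elim (ne ans)) (λ _ → block skip (≤-refl , inj₂ (ans , c))) } } } } } }
    where
    zeros : ∀ A {s} → arrs s A ≡ arrs s₀ A → (arrs s₀ A ≡ λ _ → 0) → ∀ k → arrs s A k ≡ 0
    zeros A p q k = trans (cong (λ f → f k) p) (cong (λ f → f k) q)

  -- With both numbers positive, n, m and 1 are all at most n m, which absorbs every term of lower
  -- order.
  module _ (1≤n : 1 ≤ n) (1≤m : 1 ≤ m) where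
    opaque
      unfolding kTotal

      private
        N M B : ℕ
        N = n * m
        M = (#monolabelTriangles 𝒢 * n) ⊓ (m * m)
        B = suc (N + M)

        self : ∀ k a → Bound (k * a) a k
        self k a = bound (≤-reflexive (*-comm k a))

        n≤N : n ≤ N
        n≤N = ≤-trans (≤-reflexive (sym (*-identityʳ n))) (*-monoʳ-≤ n 1≤m)

        m≤N : m ≤ N
        m≤N = ≤-trans (≤-reflexive (sym (*-identityˡ m))) (*-monoˡ-≤ m 1≤n)

        1≤N : 1 ≤ N
        1≤N = ≤-trans 1≤m m≤N

        N≤B : N ≤ B
        N≤B = m≤n⇒m≤1+n (m≤m+n N M)

        M≤B : M ≤ B
        M≤B = m≤n⇒m≤1+n (m≤n+m M N)

        arcs-times : ∀ {X c} → Bound X c n → Bound (length arcs * X) (c + c) N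
        arcs-times b = doubled (≤-reflexive (trans (cong (_* n) length-arcs) (trans (*-distribʳ-+ n m m) (cong₂ _+_ (*-comm m n) (*-comm m n)))))
          (times (length arcs) b)

        arcs-const : ∀ a → Bound (length arcs * a) (a + a) m
        arcs-const a = doubled (≤-reflexive length-arcs) (self (length arcs) a)

        bPop : Bound pop-cost kPop n
        bPop = exactly pop-cost kPop (flat (cost popFetch) 1≤n ⊞ (self n (cost visit + 8) ⊞ flat 6 1≤n)) refl refl

        bClose : Bound close-cost kClose n
        bClose = exactly close-cost kClose (flat 4 1≤n ⊞ bPop) refl refl

        bSingle : Bound single-unit kSingle n
        bSingle = exactly single-unit kSingle (bClose ⊞ flat 40 1≤n) (sym single-unit≡) refl

        bLock : Bound lockstep-cost kLock n
        bLock = exactly lockstep-cost kLock (flat 4 1≤n ⊞ (bPop ⊞ flat (cost exchange) 1≤n)) refl refl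

        bSearch : Bound search-cost kSearch n
        bSearch = exactly search-cost kSearch (((bLock ⊞ bLock) ⊞ bLock) ⊞ flat 40 1≤n) (sym search-cost≡) refl

        bRows : Bound rows-cost kRows n
        bRows = exactly rows-cost kRows ((self n 15 ⊞ flat 6 1≤n) ⊞ (flat 2 1≤n ⊞ (flat 2 1≤n ⊞ ((self n 15 ⊞ flat 6 1≤n) ⊞ flat 4 1≤n)))) refl refl

        bList : Bound (m * (cost listArcsBody + 8) + 6) kList m
        bList = exactly (m * (cost listArcsBody + 8) + 6) kList (self m (cost listArcsBody + 8) ⊞ flat 6 1≤m) refl refl

        bMatrices : Bound (length arcs * (6 + cost matricesBody + 8) + 6) kMatrices m
        bMatrices = exactly (length arcs * (6 + cost matricesBody + 8) + 6) kMatrices (arcs-const (6 + cost matricesBody + 8) ⊞ flat 6 1≤m) refl refl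

        bScans : Bound (total-scans * unit) (6 * (cost scanNeighbour + 8)) M
        bScans = bound (≤-trans (*-monoˡ-≤ unit scans-bound) (≤-reflexive (trans (cong (6 * M *_) (sym unit≡)) (rearrange M (cost scanNeighbour + 8)))))

        bArc : Bound arc-cost (((cost conflictTest + 9) + 8) + 26) n
        bArc = exactly arc-cost (((cost conflictTest + 9) + 8) + 26) (self n ((cost conflictTest + 9) + 8) ⊞ flat 26 1≤n) (sym (cong (λ c → n * (c + 8) + 26) test-cost≡)) refl

        bTests : Bound conflicts-cost kTests B
        -- Only the scans exceed n m; they contribute the minimum of k n and m². All other phases
        -- are bounded by multiples of n m.
        bTests = exactly conflicts-cost kTests ((rebound N≤B (arcs-times bArc) ⊞ rebound M≤B bScans) ⊞ flat 6 (s≤s z≤n)) refl refl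

        base≡ : base-cost ≡ kBase
        base≡ = base-cost≡

        edge≡ : edge-cost ≡ kEdge
        edge≡ = trans edge-cost≡ (cong (λ b → (2 + (cost edgeEnds + (1 + size fresh + (b + 1)))) + 8) base≡)

        bSat : Bound sat-cost kSat N
        bSat = exactly sat-cost kSat ((rebound m≤N (resp-bound (cong (m *_) edge≡) (self m kEdge)) ⊞
          resp-bound (*-distribʳ-+ search-cost (length arcs) (length arcs)) (arcs-times bSearch ⊞ arcs-times bSearch)) ⊞ flat 6 1≤N) refl refl

        bCore : Bound core-cost kCore N
        bCore = exactly core-cost kCore (arcs-times ((flat 6 1≤n ⊞ (flat (cost coreInit) 1≤n ⊞ ((self n (cost coreTest + 8) ⊞ flat 6 1≤n) ⊞
          flat (cost (aCore [ cell x̂ ŷ ]≔ t̂)) 1≤n))) ⊞ flat 8 1≤n) ⊞ flat 6 1≤N) refl refl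

        bReset : Bound reset-cost kReset m
        bReset = exactly reset-cost kReset (arcs-const ((6 + cost (aCol [ cell x̂ ŷ ]≔ lit 0)) + 8) ⊞ flat 6 1≤m) refl refl

        expand≡ : expand-arc-cost ≡ kExpandArc
        expand≡ = trans expand-arc-cost≡ (cong (λ b → 6 + (1 + size (diff x̂ (reg rw))) + cost arcEnds + (1 + size fresh) + (b + 1) + 8) single-base≡)

        bRound : Bound (2 + round-cost) kRound m
        bRound = exactly (2 + round-cost) kRound (flat 2 1≤m ⊞ (flat 2 1≤m ⊞ ((arcs-const ((6 + cost blockBody) + 8) ⊞ flat 6 1≤m) ⊞
          ((arcs-const ((6 + cost pickBody) + 8) ⊞ flat 6 1≤m) ⊞ (flat 2 1≤m ⊞ ((flat (cost rankChosen) 1≤m ⊞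
            (resp-bound (cong (length arcs *_) expand≡) (arcs-const kExpandArc) ⊞ flat 6 1≤m)) ⊞ flat 1 1≤m)))))) refl refl

        bOrient : Bound orient-cost kOrient N
        -- There are at most n + 1 rounds of cost O(m) besides the searches, and (n + 1) m ≤ 2 n m.
        bOrient = exactly orient-cost kOrient (flat 4 1≤N ⊞ ((arcs-times bSingle ⊞ doubled (+-monoˡ-≤ (n * m) m≤N) (times (suc n) bRound)) ⊞ flat 2 1≤N)) refl refl

        bOutput : Bound output-cost kOutput m
        bOutput = exactly output-cost kOutput (self m (cost outputBody + 8) ⊞ flat 6 1≤m) refl refl

      main-bound : Bound (4 + main-cost) kTotal (suc (n * m + (#monolabelTriangles 𝒢 * n) ⊓ (m * m)))
      main-bound = exactly (4 + main-cost) kTotal (flat 4 (s≤s z≤n) ⊞ (rebound (≤-trans n≤N N≤B) bRows ⊞ (rebound (≤-trans m≤N N≤B) bList ⊞ (rebound (≤-trans m≤N N≤B) bMatrices ⊞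
        (bTests ⊞ (flat 2 (s≤s z≤n) ⊞ (rebound N≤B bSat ⊞ (flat 2 (s≤s z≤n) ⊞
          ((rebound N≤B bCore ⊞ (rebound (≤-trans m≤N N≤B) bReset ⊞ (rebound N≤B bOrient ⊞ rebound (≤-trans m≤N N≤B) bOutput))) ⊞ flat 1 (s≤s z≤n)))))))))) refl refl

  bound≡ : suc (n * m + (#monolabelTriangles 𝒢 * n) ⊓ (m * m)) ≡ 1 + timeBound 𝒢
  bound≡ = cong (λ e → suc (n * e + (#monolabelTriangles 𝒢 * n) ⊓ (e * e))) m≡#edges

  construct : Does constructMTTO s₀ (Within (kTotal * (1 + timeBound 𝒢)) Result)
  construct = branch
    (λ ne → mapDoes (λ { _ (le , res) → ≤-trans (+-monoʳ-≤ 2 le) (≤-trans (m≤n+m (2 + main-cost) 2)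
        (subst (λ b → 4 + main-cost ≤ kTotal * b) bound≡ (proof (main-bound (vertices es ne) (n≢0⇒n>0 ne))))) , res })
      main-phase)
    (λ z → block (rans ≔ lit 1) (≤-trans 4≤kTotal (≤-trans (≤-reflexive (sym (*-identityʳ kTotal))) (*-monoʳ-≤ kTotal (s≤s z≤n))) , inj₁ (refl , edgeless z (run (rans ≔ lit 1) s₀))))
    where
    vertices : ∀ xs → length xs ≢ 0 → 1 ≤ n
    vertices [] ne = ⊥-elim (ne refl)
    vertices ((u , _) ∷ _) _ = ≤-trans (s≤s z≤n) (Finₚ.toℕ<n u)
    edgeless : m ≡ 0 → ∀ s → IsMTTO 𝒢 (outputArcs 𝒢 es s)
    edgeless z s = record
      { orientation = record { within-AP = λ (i , _) → no-index i ; exactly-one = λ ab → no-edge ab }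
      ; transitive = λ (i , _) _ _ → no-index i }
      where
      no-index : ∀ {a} {P : Set a} → Fin m → P
      no-index i = ⊥-elim (n≮0 (subst (toℕ i <_) z (Finₚ.toℕ<n i)))
      no-edge : ∀ {a} {P : Set a} {x y} → Adj x y → P
      no-edge xy = ⊥-elim (n≮0 (subst (1 ≤_) (trans length-arcs (cong₂ _+_ z z)) (nonempty (∈arcs⁺ xy))))

-- For mere existence any listing of the edges will do, so the program is run on the canonical one.
-- Both answers carry evidence in the final state: the oriented edges, or an edge whose directions
-- force each other.
decide-MTTO : ∀ 𝒢 → HasMTTO 𝒢 ⊎ Intervals.Contradictory 𝒢
decide-MTTO 𝒢 = decided (Assembly.construct 𝒢 (edges 𝒢) ↭-refl)
  where
  open Assembly 𝒢 (edges 𝒢) ↭-refl using (Result)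
  decided : ∀ {p s B} → Does p s (Within B Result) → HasMTTO 𝒢 ⊎ Intervals.Contradictory 𝒢
  decided (_ , _ , _ , _ , inj₁ (_ , mt)) = inj₁ (_ , mt)
  decided (_ , _ , _ , _ , inj₂ (_ , c))  = inj₂ c

theorem4 : ((𝒢 : TemporalGraph) →
    (HasMTTO 𝒢 ⇔ HasAMTTO 𝒢) × (HasAMTTO 𝒢 ⇔ InducesAcyclic 𝒢 (Ness 𝒢)))
    × ConstructsMTTOInO timeBound
theorem4 = equivalences , constructMTTO , kTotal , algorithm
  where
  equivalences : ∀ 𝒢 → (HasMTTO 𝒢 ⇔ HasAMTTO 𝒢) × (HasAMTTO 𝒢 ⇔ InducesAcyclic 𝒢 (Ness 𝒢))
  equivalences 𝒢 = mk⇔ weaken (λ (_ , am) → search (contradictory⇒¬almost (amtto⇒almost am))) ,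
      mk⇔ (λ (_ , am) → AlmostProperties.Ness-acyclic (amtto⇒almost am)) (λ acyc → weaken (search (contradictory⇒cycle acyc)))
    where
    open Intervals 𝒢
    weaken : HasMTTO 𝒢 → HasAMTTO 𝒢
    weaken (O , mt) = O , AlmostProperties.isAMTTO (mtto⇒almost mt)
    search : ¬ Contradictory → HasMTTO 𝒢
    search ¬c = [ id , (λ c → ⊥-elim (¬c c)) ]′ (decide-MTTO 𝒢)

  algorithm : ConstructsMTTOWithin (λ 𝒢 → kTotal * (1 + timeBound 𝒢)) constructMTTO
  algorithm 𝒢 es es↭ = correct (Assembly.construct 𝒢 es es↭)
    where
    open Intervals 𝒢
    open Assembly 𝒢 es es↭ using (Result)
    correct : ∀ {p s B} → Does p s (Within B Result) → ∃₂ λ s′ t → ⟨ p , s ⟩⇓ s′ [ t ] × t ≤ B × CorrectOutput 𝒢 es s′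
    correct (s′ , t , d , le , inj₁ ok) = s′ , t , d , le , inj₁ ok
    correct (s′ , t , d , le , inj₂ (z , c)) = s′ , t , d , le , inj₂ (z , λ (O , mt) → contradictory⇒¬almost (mtto⇒almost mt) c)
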